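{- There is an absolute constant $C>0$ such that the following holds. Let $\mathcal{F}_1,\dots,\mathcal{F}_t$ be set systems on an $n$-point ground set $V$, and let $\mathcal{F}$ be a set system on $V$ such that for each $F\in\mathcal{F}$ there are pairwise disjoint sets $F_1\in\mathcal{F}_1,\dots,F_t\in\mathcal{F}_t$ with $F=F_1\cup\cdots\cup F_t$. Then \[ \operatorname{herdisc}\mathcal{F}\le C\sqrt{\log|\mathcal{F}|}\sum_{i=1}^t(\log|\mathcal{F}_i|)\operatorname{herdisc}\mathcal{F}_i . \]
   Context: For a set system $\mathcal{F}$ on ground set $V$, $\operatorname{disc}\mathcal{F}=\min_{x\in\{ -1,1\}^V}\max_{F\in\mathcal{F}}\bigl|\sum_{v\in F}x_v\bigr|$, and $\operatorname{herdisc}\mathcal{F}=\max_{J\subseteq V}\operatorname{disc}(\mathcal{F}|_J)$, where $\mathcal{F}|_J=\{F\cap J:F\in\mathcal{F}\}$.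
   Formalization: The hypothesis |F| ≥ 2 is added: for |F| = 1 the right-hand side is 0 because log 1 = 0, while F = F_1 = {V} with V nonempty has hereditary discrepancy 1, and for empty F the logarithm is undefined. -}

module Defs where

open import Data.Empty using (⊥-elim)
open import Data.Fin using (Fin)
open import Data.Fin.Subset using (Subset; inside; outside; _∩_)
open import Data.Integer as ℤ using (ℤ; +_; -[1+_]; _◃_)
import Data.Integer.Properties as ℤ
import Data.Integer.Solver as ℤSolver
open import Data.List as List using (List)
open import Data.List.Extrema.Nat using (max)
open import Data.List.Membership.Propositional using (_∈_)
open import Data.List.Relation.Unary.Unique.Propositional using (Unique)
import Data.Bool.Properties as Bool
import Data.Vec.Properties as Vec
open import Data.Nat as ℕ using (ℕ; zero; suc; _⊓_; _⊔_; _^_)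
import Data.Nat.Properties as ℕ
open import Data.Nat.Coprimality as Coprime using (Coprime)
open import Data.Product using (∃; ∃-syntax; _×_; _,_; proj₁; proj₂)
open import Data.Rational
  using (ℚ; mkℚ; 0ℚ; 1ℚ; ½; _+_; _*_; _-_; -_; 1/_; _≤_; _<_; ↥_; ↧ₙ_; toℚᵘ; *≤*; *<*; Positive; positive; nonNegative)
open import Data.Rational.Properties
import Data.Rational as ℚ
open import Data.Rational.Solver using (module +-*-Solver)
open import Data.Rational.Unnormalised as ℚᵘ using (mkℚᵘ; _≃_)
import Data.Rational.Unnormalised.Properties as ℚᵘ
open import Data.Sign as Sign using (Sign)
open import Data.Sum using (_⊎_; inj₁; inj₂)
open import Data.Vec using (Vec; []; _∷_)
import Data.Vec.Functional as Fun
open import Relation.Binary.Definitions using (DecidableEquality)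
open import Relation.Binary.PropositionalEquality
open import Relation.Nullary using (Dec; yes; no)

-- Non-negative reals as located two-sided Dedekind cuts.
record ℝ≥0 : Set₁ where
  field
    lower upper     : ℚ → Set
    lower-negative  : ∀ {q} → q < 0ℚ → lower q
    upper-inhabited : ∃ upper
    lower-closed    : ∀ {p q} → p < q → lower q → lower p
    upper-closed    : ∀ {p q} → p < q → upper p → upper q
    lower-open      : ∀ {p} → lower p → ∃[ q ] p < q × lower q
    upper-open      : ∀ {q} → upper q → ∃[ p ] p < q × upper p
    disjoint        : ∀ {p q} → lower p → upper q → p < q
    located         : ∀ {p q} → p < q → lower p ⊎ upper q

open ℝ≥0

infix 4 _≤ᴿ_ _<ᴿ_

_≤ᴿ_ : ℝ≥0 → ℝ≥0 → Set
x ≤ᴿ y = ∀ q → lower x q → lower y q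

_<ᴿ_ : ℝ≥0 → ℝ≥0 → Set
x <ᴿ y = ∃[ q ] upper x q × lower y q

-- The real number sup (A ∪ {0}) = inf B.
cut : (A B : ℚ → Set) →
      ∃ B →
      (∀ {b} → B b → 0ℚ ≤ b) →
      (∀ {a b} → A a → B b → a ≤ b) →
      (∀ {p q} → 0ℚ ≤ p → p < q → (∃[ a ] p < a × A a) ⊎ (∃[ b ] b < q × B b)) →
      ℝ≥0
cut A B (b₀ , Bb₀) B≥0 A≤B loc = record
  { lower           = L
  ; upper           = U
  ; lower-negative  = inj₁
  ; upper-inhabited = b₀ + 1ℚ , b₀ , p<p+1 b₀ , Bb₀
  ; lower-closed    = λ where
      p<q (inj₁ q<0)           → inj₁ (<-trans p<q q<0)
      p<q (inj₂ (a , q<a , Aa)) → inj₂ (a , <-trans p<q q<a , Aa)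
  ; upper-closed    = λ where
      p<q (b , b<p , Bb) → b , <-trans b<p p<q , Bb
  ; lower-open      = λ where
      (inj₁ p<0)            → let m , p<m , m<0 = <-dense p<0 in m , p<m , inj₁ m<0
      (inj₂ (a , p<a , Aa)) → let m , p<m , m<a = <-dense p<a in m , p<m , inj₂ (a , m<a , Aa)
  ; upper-open      = λ where
      (b , b<q , Bb) → let m , b<m , m<q = <-dense b<q in m , m<q , (b , b<m , Bb)
  ; disjoint        = λ where
      (inj₁ p<0) (b , b<q , Bb)            → <-trans (<-≤-trans p<0 (B≥0 Bb)) b<q
      (inj₂ (a , p<a , Aa)) (b , b<q , Bb) → <-trans (<-≤-trans p<a (A≤B Aa Bb)) b<q
  ; located         = loc′
  }
  where
  p<p+1 : ∀ p → p < p + 1ℚ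
  p<p+1 p = subst (_< p + 1ℚ) (+-identityʳ p) (+-monoʳ-< p (positive⁻¹ 1ℚ))

  L U : ℚ → Set
  L q = q < 0ℚ ⊎ (∃[ a ] q < a × A a)
  U q = ∃[ b ] b < q × B b

  loc′ : ∀ {p q} → p < q → L p ⊎ U q
  loc′ {p} p<q with p <? 0ℚ
  ... | yes p<0 = inj₁ (inj₁ p<0)
  ... | no  p≮0 with loc (≮⇒≥ p≮0) p<q
  ...   | inj₁ l = inj₁ (inj₂ l)
  ...   | inj₂ u = inj₂ u

*-mono-≤-nonNeg : ∀ {a b c d} → 0ℚ ≤ b → 0ℚ ≤ c → a ≤ c → b ≤ d → a * b ≤ c * d
*-mono-≤-nonNeg {a} {b} {c} {d} 0≤b 0≤c a≤c b≤d = ≤-trans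
  (*-monoʳ-≤-nonNeg b {{nonNegative 0≤b}} a≤c)
  (*-monoˡ-≤-nonNeg c {{nonNegative 0≤c}} b≤d)

0≤* : ∀ {a b} → 0ℚ ≤ a → 0ℚ ≤ b → 0ℚ ≤ a * b
0≤* {a} {b} 0≤a 0≤b = subst (_≤ a * b) (*-zeroˡ 0ℚ) (*-mono-≤-nonNeg ≤-refl 0≤a 0≤a 0≤b)

*-mono-<-pos : ∀ {a c} → 0ℚ ≤ a → a < c → a * a < c * c
*-mono-<-pos {a} {c} 0≤a a<c = ≤-<-trans
  (*-monoˡ-≤-nonNeg a {{nonNegative 0≤a}} (<⇒≤ a<c))
  (*-monoˡ-<-pos c {{positive (≤-<-trans 0≤a a<c)}} a<c)

p<q⇒0<q-p : ∀ {p q} → p < q → 0ℚ < q - p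
p<q⇒0<q-p {p} {q} p<q = subst (_< q - p) (+-inverseʳ p) (+-monoˡ-< (- p) p<q)

p+[q-p]≡q : ∀ p q → p + (q - p) ≡ q
p+[q-p]≡q = solve 2 (λ p q → p :+ (q :- p) := q) refl where open +-*-Solver

halve : ∀ {δ} → 0ℚ < δ → ∃[ ε ] 0ℚ < ε × ε + ε ≡ δ
halve {δ} 0<δ = ½ * δ
  , subst (_< ½ * δ) (*-zeroʳ ½) (*-monoʳ-<-pos ½ 0<δ)
  , trans (sym (*-distribʳ-+ δ ½ ½)) (*-identityˡ δ)

infixl 7 _·_

_·_ : ℕ → ℚ → ℚ
zero  · δ = 0ℚ
suc k · δ = δ + k · δ

·-toℚᵘ : ∀ k n d .(c : Coprime ℤ.∣ n ∣ (suc d)) → toℚᵘ (k · mkℚ n d c) ≃ mkℚᵘ (+ k ℤ.* n) d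
·-toℚᵘ zero    n d c = ℚᵘ.*≡* refl
·-toℚᵘ (suc k) n d c = ℚᵘ.≃-trans (toℚᵘ-homo-+ (mkℚ n d c) (k · mkℚ n d c))
  (ℚᵘ.≃-trans (ℚᵘ.+-cong (ℚᵘ.≃-refl {mkℚᵘ n d}) (·-toℚᵘ k n d c)) (ℚᵘ.*≡* eq))
  where
  open ℤSolver.+-*-Solver
  D = + suc d
  eq : (n ℤ.* D ℤ.+ (+ k ℤ.* n) ℤ.* D) ℤ.* D ≡ ((+ suc k) ℤ.* n) ℤ.* (D ℤ.* D)
  eq = solve 3 (λ n k D → (n :* D :+ (k :* n) :* D) :* D := ((con (+ 1) :+ k) :* n) :* (D :* D))
         refl n (+ k) D

archimedean : ∀ M δ → 0ℚ < δ → ∃[ k ] M < k · δ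
archimedean M δ@(mkℚ -[1+ n ] d c) 0<δ = ⊥-elim (<-asym 0<δ (negative⁻¹ δ))
archimedean M δ@(mkℚ (+ zero) d c) (*<* (ℤ.+<+ ()))
archimedean M@(mkℚ m b _) δ@(mkℚ (+ suc n) d c) 0<δ = k , toℚᵘ-cancel-<
  (ℚᵘ.<-respʳ-≃ (ℚᵘ.≃-sym (·-toℚᵘ k (+ suc n) d c)) (ℚᵘ.*<* lt))
  where
  k = suc ℤ.∣ m ∣ ℕ.* suc d
  i≤∣i∣ : ∀ i → i ℤ.≤ + ℤ.∣ i ∣
  i≤∣i∣ (+ _)    = ℤ.≤-refl
  i≤∣i∣ -[1+ _ ] = ℤ.-≤+
  lt : m ℤ.* + suc d ℤ.< (+ k ℤ.* + suc n) ℤ.* + suc b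
  lt = ℤ.≤-<-trans (ℤ.*-monoʳ-≤-nonNeg (+ suc d) (i≤∣i∣ m))
    (subst₂ ℤ._<_ (ℤ.pos-* ℤ.∣ m ∣ (suc d))
      (trans (ℤ.pos-* (k ℕ.* suc n) (suc b)) (cong (ℤ._* + suc b) (ℤ.pos-* k (suc n))))
      (ℤ.+<+ (ℕ.<-≤-trans (ℕ.*-monoˡ-< (suc d) (ℕ.n<1+n ℤ.∣ m ∣))
        (ℕ.≤-trans (ℕ.m≤m*n k (suc n)) (ℕ.m≤m*n (k ℕ.* suc n) (suc b))))))

upper⇒0< : ∀ x {q} → upper x q → 0ℚ < q
upper⇒0< x u with upper-open x u
... | p , p<q , up = ≤-<-trans (≮⇒≥ λ p<0 →
  <-irrefl refl (disjoint x (lower-negative x p<0) up)) p<q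

module _ (x : ℝ≥0) {δ ε} (0<δ : 0ℚ < δ) (δ+δ≡ε : δ + δ ≡ ε) where

  search : ∀ k a → lower x a → upper x (a + k · δ) → ∃[ a ] lower x a × upper x (a + ε)
  search zero    a la u = ⊥-elim (<-irrefl (sym (+-identityʳ a)) (disjoint x la u))
  search (suc k) a la u with located x {a + δ} {a + ε}
    (+-monoʳ-< a (subst₂ _<_ (+-identityʳ δ) δ+δ≡ε (+-monoʳ-< δ 0<δ)))
  ... | inj₁ l  = search k (a + δ) l (subst (upper x) (sym (+-assoc a δ (k · δ))) u)
  ... | inj₂ u′ = a , la , u′

approximate : ∀ x ε → 0ℚ < ε → ∃[ a ] lower x a × upper x (a + ε)
approximate x ε 0<ε = go (halve 0<ε) (upper-inhabited x)
  where
  go : ∃[ δ ] 0ℚ < δ × δ + δ ≡ ε → ∃ (upper x) → ∃[ a ] lower x a × upper x (a + ε)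
  go (δ , 0<δ , δ+δ≡ε) (u , uu) = go′ (archimedean (u - (- 1ℚ)) δ 0<δ)
    where
    go′ : ∃[ k ] u - (- 1ℚ) < k · δ → ∃[ a ] lower x a × upper x (a + ε)
    go′ (k , lt) = search x 0<δ δ+δ≡ε k (- 1ℚ) (lower-negative x (negative⁻¹ (- 1ℚ)))
      (upper-closed x (subst (_< - 1ℚ + k · δ) (p+[q-p]≡q (- 1ℚ) u) (+-monoʳ-< (- 1ℚ) lt)) uu)

fromℕ : ℕ → ℝ≥0
fromℕ k = cut (_≡ r) (_≡ r) (r , refl) (λ { refl → 0≤r }) (λ { refl refl → ≤-refl }) loc
  where
  r = + k ℚ./ 1
  0≤r : 0ℚ ≤ r
  0≤r = nonNegative⁻¹ r {{normalize-nonNeg k 1}}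
  loc : ∀ {p q} → 0ℚ ≤ p → p < q → (∃[ a ] p < a × a ≡ r) ⊎ (∃[ b ] b < q × b ≡ r)
  loc {p} _ p<q with p <? r
  ... | yes p<r = inj₁ (r , p<r , refl)
  ... | no  p≮r = inj₂ (r , ≤-<-trans (≮⇒≥ p≮r) p<q , refl)

+-error : ∀ a b ε p m → ε + ε ≡ m - p → a + b ≤ p → (a + ε) + (b + ε) ≤ m
+-error a b ε p m ε+ε≡δ a+b≤p = subst₂ _≤_ eq (p+[q-p]≡q p m) (+-monoˡ-≤ (m - p) a+b≤p)
  where
  open +-*-Solver
  eq : (a + b) + (m - p) ≡ (a + ε) + (b + ε)
  eq = trans (cong (λ z → (a + b) + z) (sym ε+ε≡δ))
    (solve 3 (λ a b e → (a :+ b) :+ (e :+ e) := (a :+ e) :+ (b :+ e)) refl a b ε)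

-- A precision ε sufficient to locate a product relative to p < q, given
-- upper bounds M, N of its factors.
precision : ∀ {M N p q} → 0ℚ < M → 0ℚ < N → p < q →
  ∃[ ε ] 0ℚ < ε × ε ≤ 1ℚ × (∀ {s} → s < (M + N) + 1ℚ → ε * s < q - p)
precision {M} {N} {p} {q} 0<M 0<N p<q = go (q - p) (p<q⇒0<q-p p<q)
  where
  K = (M + N) + 1ℚ
  0≤K : 0ℚ ≤ K
  0≤K = +-mono-≤ (+-mono-≤ (<⇒≤ 0<M) (<⇒≤ 0<N)) (<⇒≤ (positive⁻¹ 1ℚ))
  go : ∀ δ → 0ℚ < δ → ∃[ ε ] 0ℚ < ε × ε ≤ 1ℚ × (∀ {s} → s < K → ε * s < δ)
  go δ 0<δ = ε , 0<ε , *-cancelʳ-≤-pos W (subst₂ _≤_ (sym εW≡δ) (sym (*-identityˡ W)) δ≤W)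
    , λ {s} s<K → subst (ε * s <_) εW≡δ (*-monoʳ-<-pos ε {{positive 0<ε}} (<-≤-trans s<K K≤W))
    where
    W = K + δ
    δ≤W : δ ≤ W
    δ≤W = subst (_≤ W) (+-identityˡ δ) (+-monoˡ-≤ δ 0≤K)
    K≤W : K ≤ W
    K≤W = subst (_≤ W) (+-identityʳ K) (+-monoʳ-≤ K (<⇒≤ 0<δ))
    instance
      W>0 : Positive W
      W>0 = positive (<-≤-trans 0<δ δ≤W)
      W≢0 : ℚ.NonZero W
      W≢0 = pos⇒nonZero W
      1/W>0 : Positive (1/ W)
      1/W>0 = 1/pos⇒pos W
    ε = δ * 1/ W
    εW≡δ : ε * W ≡ δ
    εW≡δ = trans (*-assoc δ (1/ W) W) (trans (cong (δ *_) (*-inverseˡ W)) (*-identityʳ δ))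
    0<ε : 0ℚ < ε
    0<ε = subst (_< ε) (*-zeroˡ (1/ W)) (*-monoˡ-<-pos (1/ W) 0<δ)

module _ {M N p q ε a b : ℚ} (0<M : 0ℚ < M) (0<N : 0ℚ < N) (0≤p : 0ℚ ≤ p)
         (ε≤1 : ε ≤ 1ℚ) (ε* : ∀ {s} → s < (M + N) + 1ℚ → ε * s < q - p)
         (a<M : a < M) (b<N : b < N) (0<a+ε : 0ℚ < a + ε) (0<b+ε : 0ℚ < b + ε) where

  private
    δ≤q : q - p ≤ q
    δ≤q = subst₂ _≤_ (+-identityˡ (q - p)) (p+[q-p]≡q p q) (+-monoˡ-≤ (q - p) 0≤p)
    M≤M+N : M ≤ M + N
    M≤M+N = subst (_≤ M + N) (+-identityʳ M) (+-monoʳ-≤ M (<⇒≤ 0<N))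
    N≤M+N : N ≤ M + N
    N≤M+N = subst (_≤ M + N) (+-identityˡ N) (+-monoˡ-≤ N (<⇒≤ 0<M))
    small : ∀ {c} → c < 0ℚ → c + ε ≤ ε
    small {c} c<0 = subst (c + ε ≤_) (+-identityˡ ε) (+-monoˡ-≤ ε (<⇒≤ c<0))
    eq : (a * b) + ε * ((a + b) + ε) ≡ (a + ε) * (b + ε)
    eq = solve 3 (λ a b e → (a :* b) :+ e :* ((a :+ b) :+ e) := (a :+ e) :* (b :+ e)) refl a b ε
      where open +-*-Solver

  *-error₁ : a < 0ℚ → (a + ε) * (b + ε) < q
  *-error₁ a<0 = <-≤-trans (≤-<-trans
    (*-monoʳ-≤-nonNeg (b + ε) {{nonNegative (<⇒≤ 0<b+ε)}} (small a<0))
    (ε* (+-mono-<-≤ (<-≤-trans b<N N≤M+N) ε≤1))) δ≤q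

  *-error₂ : b < 0ℚ → (a + ε) * (b + ε) < q
  *-error₂ b<0 = <-≤-trans (≤-<-trans
    (≤-trans (*-monoˡ-≤-nonNeg (a + ε) {{nonNegative (<⇒≤ 0<a+ε)}} (small b<0))
             (≤-reflexive (*-comm (a + ε) ε)))
    (ε* (+-mono-<-≤ (<-≤-trans a<M M≤M+N) ε≤1))) δ≤q

  *-error₃ : a * b ≤ p → (a + ε) * (b + ε) < q
  *-error₃ ab≤p = subst₂ _<_ eq (p+[q-p]≡q p q)
    (+-mono-≤-< ab≤p (ε* (+-mono-<-≤ (+-mono-< a<M b<N) ε≤1)))

infixl 6 _+ᴿ_
infixl 7 _*ᴿ_

_+ᴿ_ : ℝ≥0 → ℝ≥0 → ℝ≥0
x +ᴿ y = cut A B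
  (let b , ub = upper-inhabited x ; c , uc = upper-inhabited y in b + c , b , c , ub , uc , refl)
  (λ { (b , c , ub , uc , refl) → +-mono-≤ (<⇒≤ (upper⇒0< x ub)) (<⇒≤ (upper⇒0< y uc)) })
  (λ { (a , b , la , lb , refl) (c , d , uc , ud , refl) →
       +-mono-≤ (<⇒≤ (disjoint x la uc)) (<⇒≤ (disjoint y lb ud)) })
  loc
  where
  A B : ℚ → Set
  A r = ∃[ a ] ∃[ b ] lower x a × lower y b × r ≡ a + b
  B r = ∃[ a ] ∃[ b ] upper x a × upper y b × r ≡ a + b

  loc : ∀ {p q} → 0ℚ ≤ p → p < q → (∃[ a ] p < a × A a) ⊎ (∃[ b ] b < q × B b)
  loc {p} {q} _ p<q = go (<-dense p<q)
    where
    Result = (∃[ r ] p < r × A r) ⊎ (∃[ r ] r < q × B r)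
    go : ∃[ m ] p < m × m < q → Result
    go (m , p<m , m<q) = go₁ (halve (p<q⇒0<q-p p<m))
      where
      go₁ : ∃[ ε ] 0ℚ < ε × ε + ε ≡ m - p → Result
      go₁ (ε , 0<ε , ε+ε≡δ) = go₂ (approximate x ε 0<ε) (approximate y ε 0<ε)
        where
        go₂ : ∃[ a ] lower x a × upper x (a + ε) → ∃[ b ] lower y b × upper y (b + ε) → Result
        go₂ (a , la , uc) (b , lb , ud) = go₃ (p <? a + b)
          where
          go₃ : Dec (p < a + b) → Result
          go₃ (yes p<a+b) = inj₁ (a + b , p<a+b , a , b , la , lb , refl)
          go₃ (no  p≮a+b) = inj₂ ((a + ε) + (b + ε)
            , ≤-<-trans (+-error a b ε p m ε+ε≡δ (≮⇒≥ p≮a+b)) m<q , a + ε , b + ε , uc , ud , refl)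

_*ᴿ_ : ℝ≥0 → ℝ≥0 → ℝ≥0
x *ᴿ y = cut A B
  (let b , ub = upper-inhabited x ; c , uc = upper-inhabited y in b * c , b , c , ub , uc , refl)
  (λ { (b , c , ub , uc , refl) → 0≤* (<⇒≤ (upper⇒0< x ub)) (<⇒≤ (upper⇒0< y uc)) })
  (λ { (a , b , 0≤a , 0≤b , la , lb , refl) (c , d , uc , ud , refl) →
       *-mono-≤-nonNeg 0≤b (<⇒≤ (upper⇒0< x uc)) (<⇒≤ (disjoint x la uc)) (<⇒≤ (disjoint y lb ud)) })
  loc
  where
  A B : ℚ → Set
  A r = ∃[ a ] ∃[ b ] 0ℚ ≤ a × 0ℚ ≤ b × lower x a × lower y b × r ≡ a * b
  B r = ∃[ a ] ∃[ b ] upper x a × upper y b × r ≡ a * b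

  loc : ∀ {p q} → 0ℚ ≤ p → p < q → (∃[ a ] p < a × A a) ⊎ (∃[ b ] b < q × B b)
  loc {p} {q} 0≤p p<q = go (upper-inhabited x) (upper-inhabited y)
    where
    Result = (∃[ r ] p < r × A r) ⊎ (∃[ r ] r < q × B r)
    go : ∃ (upper x) → ∃ (upper y) → Result
    go (M , uM) (N , uN) = go₁ (precision 0<M 0<N p<q)
      where
      0<M = upper⇒0< x uM
      0<N = upper⇒0< y uN
      go₁ : ∃[ ε ] 0ℚ < ε × ε ≤ 1ℚ × (∀ {s} → s < (M + N) + 1ℚ → ε * s < q - p) → Result
      go₁ (ε , 0<ε , ε≤1 , ε*) = go₂ (approximate x ε 0<ε) (approximate y ε 0<ε)
        where
        go₂ : ∃[ a ] lower x a × upper x (a + ε) → ∃[ b ] lower y b × upper y (b + ε) → Result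
        go₂ (a , la , uc) (b , lb , ud) = go₃ (a <? 0ℚ) (b <? 0ℚ) (p <? a * b)
          where
          a<M = disjoint x la uM
          b<N = disjoint y lb uN
          0<c = upper⇒0< x uc
          0<d = upper⇒0< y ud
          upperCase : (a + ε) * (b + ε) < q → Result
          upperCase lt = inj₂ ((a + ε) * (b + ε) , lt , a + ε , b + ε , uc , ud , refl)
          go₃ : Dec (a < 0ℚ) → Dec (b < 0ℚ) → Dec (p < a * b) → Result
          go₃ (yes a<0) _ _ = upperCase (*-error₁ 0<M 0<N 0≤p ε≤1 ε* a<M b<N 0<c 0<d a<0)
          go₃ (no _) (yes b<0) _ = upperCase (*-error₂ 0<M 0<N 0≤p ε≤1 ε* a<M b<N 0<c 0<d b<0)
          go₃ (no _) (no _) (no p≮ab) =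
            upperCase (*-error₃ 0<M 0<N 0≤p ε≤1 ε* a<M b<N 0<c 0<d (≮⇒≥ p≮ab))
          go₃ (no a≮0) (no b≮0) (yes p<ab) =
            inj₁ (a * b , p<ab , a , b , ≮⇒≥ a≮0 , ≮⇒≥ b≮0 , la , lb , refl)

∑ : ∀ {t} → (Fin t → ℝ≥0) → ℝ≥0
∑ = Fun.foldr _+ᴿ_ (fromℕ 0)

√ : ℝ≥0 → ℝ≥0
√ x = cut A B inh proj₁ A≤B loc
  where
  A B : ℚ → Set
  A r = 0ℚ ≤ r × lower x (r * r)
  B r = 0ℚ ≤ r × upper x (r * r)

  inh : ∃ B
  inh = u + 1ℚ , 0≤u+1 , upper-closed x u<[u+1]² (proj₂ (upper-inhabited x))
    where
    u = proj₁ (upper-inhabited x)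
    0<u : 0ℚ < u
    0<u = upper⇒0< x (proj₂ (upper-inhabited x))
    0≤u+1 : 0ℚ ≤ u + 1ℚ
    0≤u+1 = +-mono-≤ (<⇒≤ 0<u) (<⇒≤ (positive⁻¹ 1ℚ))
    u<u+1 : u < u + 1ℚ
    u<u+1 = subst (_< u + 1ℚ) (+-identityʳ u) (+-monoʳ-< u (positive⁻¹ 1ℚ))
    1≤u+1 : 1ℚ ≤ u + 1ℚ
    1≤u+1 = +-monoˡ-≤ 1ℚ (<⇒≤ 0<u)
    u<[u+1]² : u < (u + 1ℚ) * (u + 1ℚ)
    u<[u+1]² = <-≤-trans u<u+1 (subst (_≤ (u + 1ℚ) * (u + 1ℚ)) (*-identityʳ (u + 1ℚ))
      (*-monoˡ-≤-nonNeg (u + 1ℚ) {{nonNegative 0≤u+1}} 1≤u+1))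

  A≤B : ∀ {a b} → A a → B b → a ≤ b
  A≤B (0≤a , la) (0≤b , ub) = ≮⇒≥ λ b<a →
    <-asym (disjoint x la ub) (*-mono-<-pos 0≤b b<a)

  loc : ∀ {p q} → 0ℚ ≤ p → p < q → (∃[ a ] p < a × A a) ⊎ (∃[ b ] b < q × B b)
  loc 0≤p p<q with <-dense p<q
  ... | s , p<s , s<q with <-dense p<s
  ...   | r , p<r , r<s with located x (*-mono-<-pos (≤-trans 0≤p (<⇒≤ p<r)) r<s)
  ...     | inj₁ l = inj₁ (r , p<r , ≤-trans 0≤p (<⇒≤ p<r) , l)
  ...     | inj₂ u = inj₂ (s , s<q , ≤-trans 0≤p (<⇒≤ p<s) , u)

-- The base 2 logarithm of m ≥ 1: a non-negative fraction a / d satisfies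
-- a / d ≤ log₂ m iff 2 ^ a ≤ m ^ d.  The value at 0 is irrelevant.
log : ℕ → ℝ≥0
log zero      = fromℕ 0
log m@(suc _) = cut A B (r₀ , 0≤r₀ , m≤2^r₀) proj₁ A≤B loc
  where
  A B : ℚ → Set
  A r = 0ℚ ≤ r × 2 ^ ℤ.∣ ↥ r ∣ ℕ.≤ m ^ ↧ₙ r
  B r = 0ℚ ≤ r × m ^ ↧ₙ r ℕ.≤ 2 ^ ℤ.∣ ↥ r ∣

  n≤2^n : ∀ n → n ℕ.< 2 ^ n
  n≤2^n zero    = ℕ.z<s
  n≤2^n (suc n) = ℕ.≤-trans (ℕ.≤-trans (ℕ.s≤s (n≤2^n n)) (ℕ.+-monoˡ-≤ (2 ^ n) (ℕ.m^n>0 2 n)))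
    (ℕ.≤-reflexive (cong (2 ^ n ℕ.+_) (sym (ℕ.+-identityʳ (2 ^ n)))))

  r₀ : ℚ
  r₀ = ℚ.mkℚ (+ m) 0 (Coprime.sym (Coprime.1-coprimeTo m))
  0≤r₀ : 0ℚ ≤ r₀
  0≤r₀ = nonNegative⁻¹ r₀
  m≤2^r₀ : m ^ 1 ℕ.≤ 2 ^ m
  m≤2^r₀ = subst (ℕ._≤ 2 ^ m) (sym (ℕ.*-identityʳ m)) (ℕ.<⇒≤ (n≤2^n m))

  A≤B : ∀ {a b} → A a → B b → a ≤ b
  A≤B {mkℚ -[1+ _ ] _ _} (*≤* () , _) _
  A≤B {mkℚ (+ _) _ _} {mkℚ -[1+ _ ] _ _} _ (*≤* () , _)
  A≤B {mkℚ (+ a) d-1 _} {mkℚ (+ b) e-1 _} (_ , 2^a≤m^d) (_ , m^e≤2^b) =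
    *≤* (subst₂ ℤ._≤_ (ℤ.pos-* a e) (ℤ.pos-* b d) (ℤ.+≤+ (ℕ.≮⇒≥ λ bd<ae →
      ℕ.<⇒≱ (ℕ.^-monoʳ-< 2 (ℕ.s≤s (ℕ.s≤s ℕ.z≤n)) bd<ae) 2^ae≤2^bd)))
    where
    d = suc d-1
    e = suc e-1
    open ℕ.≤-Reasoning
    2^ae≤2^bd : 2 ^ (a ℕ.* e) ℕ.≤ 2 ^ (b ℕ.* d)
    2^ae≤2^bd = begin
      2 ^ (a ℕ.* e)  ≡⟨ ℕ.^-*-assoc 2 a e ⟨
      (2 ^ a) ^ e    ≤⟨ ℕ.^-monoˡ-≤ e 2^a≤m^d ⟩
      (m ^ d) ^ e    ≡⟨ ℕ.^-*-assoc m d e ⟩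
      m ^ (d ℕ.* e)  ≡⟨ cong (m ^_) (ℕ.*-comm d e) ⟩
      m ^ (e ℕ.* d)  ≡⟨ ℕ.^-*-assoc m e d ⟨
      (m ^ e) ^ d    ≤⟨ ℕ.^-monoˡ-≤ d m^e≤2^b ⟩
      (2 ^ b) ^ d    ≡⟨ ℕ.^-*-assoc 2 b d ⟩
      2 ^ (b ℕ.* d)  ∎

  loc : ∀ {p q} → 0ℚ ≤ p → p < q → (∃[ a ] p < a × A a) ⊎ (∃[ b ] b < q × B b)
  loc 0≤p p<q with <-dense p<q
  ... | r , p<r , r<q with ℕ.≤-total (2 ^ ℤ.∣ ↥ r ∣) (m ^ ↧ₙ r)
  ...   | inj₁ l = inj₁ (r , p<r , ≤-trans 0≤p (<⇒≤ p<r) , l)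
  ...   | inj₂ u = inj₂ (r , r<q , ≤-trans 0≤p (<⇒≤ p<r) , u)

record SetSystem (n : ℕ) : Set where
  field
    sets   : List (Subset n)
    unique : Unique sets

open SetSystem

infix 4 _∈ˢ_

_∈ˢ_ : ∀ {n} → Subset n → SetSystem n → Set
F ∈ˢ 𝓕 = F ∈ sets 𝓕

card : ∀ {n} → SetSystem n → ℕ
card 𝓕 = List.length (sets 𝓕)

_≟ˢ_ : ∀ {n} → DecidableEquality (Subset n)
_≟ˢ_ = Vec.≡-dec Bool._≟_

-- 𝓕 ↾ J = { F ∩ J : F ∈ 𝓕 }, kept on the whole ground set: the values of a
-- colouring outside J do not enter the sums over the sets F ∩ J.
_↾_ : ∀ {n} → SetSystem n → Subset n → SetSystem n
𝓕 ↾ J = record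
  { sets   = List.deduplicate _≟ˢ_ (List.map (_∩ J) (sets 𝓕))
  ; unique = deduplicate-! (List.map (_∩ J) (sets 𝓕))
  }
  where open import Data.List.Relation.Unary.Unique.DecPropositional.Properties _≟ˢ_ using (deduplicate-!)

Colouring : ℕ → Set
Colouring = Vec Sign

signedSum : ∀ {n} → Subset n → Colouring n → ℤ
signedSum []            []      = + 0
signedSum (inside  ∷ F) (s ∷ x) = (s ◃ 1) ℤ.+ signedSum F x
signedSum (outside ∷ F) (s ∷ x) = signedSum F x

minColouring : ∀ {n} → (Colouring n → ℕ) → ℕ
minColouring {zero}  f = f []
minColouring {suc n} f =
  minColouring (λ x → f (Sign.+ ∷ x)) ⊓ minColouring (λ x → f (Sign.- ∷ x))

maxSubset : ∀ {n} → (Subset n → ℕ) → ℕ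
maxSubset {zero}  f = f []
maxSubset {suc n} f =
  maxSubset (λ J → f (inside ∷ J)) ⊔ maxSubset (λ J → f (outside ∷ J))

disc : ∀ {n} → SetSystem n → ℕ
disc 𝓕 = minColouring λ x → max 0 (List.map (λ F → ℤ.∣ signedSum F x ∣) (sets 𝓕))

herdisc : ∀ {n} → SetSystem n → ℕ
herdisc 𝓕 = maxSubset λ J → disc (𝓕 ↾ J)

{-# OPTIONS --safe #-}
module Submission where

-- The quantity interpolating between the two sides is the factorisation norm: write
-- an incidence matrix as A = B C and bound the rows of B and the columns of C in
-- Euclidean norm.  Factorisations of the 𝓕ᵢ are combined into one of 𝓕 by a direct
-- sum, so it remains to compare the norm with the hereditary discrepancy.
--
-- Upper bound for the norm.  Fix weights p on the rows and choose columns greedily, as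
-- long as their residual against the chosen ones has p-norm² > τ.  Every subset of
-- the k chosen columns has a signed sum of norm² ≤ H² Σp.  In the Gram–Schmidt basis
-- the i-th coordinate of such a sum is xᵢ plus a shift depending on the coordinates
-- already fixed, and at most one of the values xᵢ ∈ {-1, 0, 1} makes it less than 1/2,
-- so that few sign patterns are possible; as the 2ᵏ subsets give different patterns,
-- k τ ≤ 20 H² Σp.  Halving τ repeatedly and rescaling the basis vectors of each stage
-- gives a factorisation with |c|² = O(H log m) and Σ pᵣ |bᵣ|² = O(H log m) Σp, and
-- approachability makes the bound on the bᵣ uniform.
--
-- Lower bound for the norm.  The Gram–Schmidt walk started at 0 ends in a colouring x
-- for which ⟨b, C x⟩ is subgaussian for every b.  It is made deterministic by the
-- potential Σ E (D² + 16 k V)ᵏ with k ≈ log |𝓕|: here D is the final signed sum if the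
-- current pivot is rounded at random along the walk direction, and V is the part of
-- |b|² in the span of the columns that are not yet frozen.

open import Defs using (ℝ≥0; fromℕ; _≤ᴿ_; _<ᴿ_; _+ᴿ_; _*ᴿ_; ∑; √; log; SetSystem; _∈ˢ_; card; _≟ˢ_; _↾_; Colouring; signedSum; minColouring; maxSubset; disc; herdisc; 0≤*; archimedean; _·_; halve; p<q⇒0<q-p; *-mono-<-pos)
open import Data.Bool using (Bool; true; false; if_then_else_; _∧_; _∨_)
open import Data.Empty using (⊥; ⊥-elim)
open import Data.Fin as Fin using (Fin)
import Data.Fin.Properties as Fin
open import Data.Fin.Subset using (Subset; inside; outside; Empty; _∩_; ⋃)
import Data.Fin.Subset.Properties as Subset
open import Data.Integer as ℤ using (ℤ; _◃_)
import Data.Integer.Properties as ℤ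
open import Data.List as List using (List; []; _∷_; _++_; map; length; filter; concatMap; tabulate; allFin)
open import Data.List.Extrema.Nat using (max; xs≤max; max≤v⁺)
import Data.List.Membership.DecPropositional as DecMembership
open import Data.List.Membership.Propositional using (_∈_; _∉_)
open import Data.List.Membership.Propositional.Properties using (∈-allFin; ∈-map⁺; ∈-map⁻; ∈-filter⁺; ∈-filter⁻; ∈-deduplicate⁺; ∈-deduplicate⁻; ∈-lookup)
open import Data.List.Properties using (filter-notAll; length-tabulate; map-tabulate)
open import Data.List.Relation.Unary.All as All using (All; []; _∷_)
import Data.List.Relation.Unary.All.Properties as All
open import Data.List.Relation.Unary.Any as Any using (here; there)
open import Data.List.Relation.Unary.Any.Properties using (lookup-index)
open import Data.List.Relation.Unary.Unique.Propositional using (Unique; []; _∷_)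
open import Data.List.Relation.Unary.Unique.Propositional.Properties using (allFin⁺)
open import Data.Nat as ℕ using (ℕ; zero; suc)
open import Data.Nat.Coprimality as Coprime using (Coprime)
import Data.Nat.DivMod as ℕ
import Data.Nat.Properties as ℕ
open import Data.Nat.Solver using () renaming (module +-*-Solver to ℕ-Solver)
open import Data.Product using (Σ; ∃-syntax; _×_; _,_; proj₁; proj₂)
open import Data.Rational as ℚ using (ℚ; mkℚ; 0ℚ; 1ℚ; ½; _+_; _*_; _-_; -_; 1/_; ∣_∣; _≤_; _<_; toℚᵘ; positive; nonNegative; nonPositive; ≢-nonZero)
open import Data.Rational.Properties
open import Data.Rational.Solver using (module +-*-Solver)
open import Data.Rational.Unnormalised as ℚᵘ using (mkℚᵘ)
import Data.Rational.Unnormalised.Properties as ℚᵘ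
open import Data.Sign as Sign using (Sign)
open import Data.Sum using (_⊎_; inj₁; inj₂)
open import Data.Unit using (⊤; tt)
open import Data.Vec as Vec using (Vec; []; _∷_)
import Data.Vec.Functional as Fun
import Data.Vec.Properties as Vec
open import Function using (_∘_; case_of_)
open import Relation.Binary.PropositionalEquality using (_≡_; _≢_; refl; sym; trans; cong; cong₂; subst; subst₂; module ≡-Reasoning)
open import Relation.Nullary using (¬_; Dec; yes; no; does)
open import Relation.Nullary.Decidable using (¬?; dec-true; dec-false)
open import Relation.Nullary.Negation using (contradiction)

-- Rational arithmetic and finite sums

-- Hereditary discrepancy itself does not add up: good colourings of the 𝓕ᵢ need not agree.
-- Factorisations do, since they can be concatenated; bounding |b|² and |c|² by the same K makes K,
-- of order (log m) H, the quantity that is summed. The root of log |𝓕| is paid once, when the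
-- combined factorisation is turned into a colouring. Everything before the last comparison is
-- finite rational arithmetic, and this shapes the constructions. Square roots are avoided by giving
-- each rank-one term a weight, minimax theorems by an approximate game that loses a factor 2, and
-- expectations by a potential with two explicit outcomes. Logarithms and roots are rounded down to
-- integers, so that real numbers only have to be bounded below. A system with a single set has
-- logarithm 0, yet that set may be non-empty. Such systems are merged into one rank-one term of
-- norm at most 1. It is absorbed because two different members of 𝓕 force some 𝓖 i to have two
-- sets.

fromℤ : ℤ → ℚ
fromℤ i = i ℚ./ 1

ι : ℕ → ℚ
ι k = fromℤ (ℤ.+ k)

toℚᵘ-fromℤ : ∀ i → toℚᵘ (fromℤ i) ℚᵘ.≃ mkℚᵘ i 0
toℚᵘ-fromℤ i = toℚᵘ-fromℚᵘ (mkℚᵘ i 0)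

fromℤ-+ : ∀ i j → fromℤ (i ℤ.+ j) ≡ fromℤ i + fromℤ j
fromℤ-+ i j = toℚᵘ-injective (ℚᵘ.≃-trans (toℚᵘ-fromℤ (i ℤ.+ j)) (ℚᵘ.≃-sym
  (ℚᵘ.≃-trans (toℚᵘ-homo-+ (fromℤ i) (fromℤ j))
  (ℚᵘ.≃-trans (ℚᵘ.+-cong (toℚᵘ-fromℤ i) (toℚᵘ-fromℤ j))
    (ℚᵘ.*≡* (cong (ℤ._* ℤ.+ 1) (cong₂ ℤ._+_ (ℤ.*-identityʳ i) (ℤ.*-identityʳ j))))))))

fromℤ-* : ∀ i j → fromℤ (i ℤ.* j) ≡ fromℤ i * fromℤ j
fromℤ-* i j = toℚᵘ-injective (ℚᵘ.≃-trans (toℚᵘ-fromℤ (i ℤ.* j)) (ℚᵘ.≃-sym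
  (ℚᵘ.≃-trans (toℚᵘ-homo-* (fromℤ i) (fromℤ j))
  (ℚᵘ.≃-trans (ℚᵘ.*-cong (toℚᵘ-fromℤ i) (toℚᵘ-fromℤ j)) (ℚᵘ.*≡* refl)))))

fromℤ-mono-≤ : ∀ {i j} → i ℤ.≤ j → fromℤ i ≤ fromℤ j
fromℤ-mono-≤ {i} {j} i≤j = toℚᵘ-cancel-≤ (ℚᵘ.≤-respˡ-≃ (ℚᵘ.≃-sym (toℚᵘ-fromℤ i))
  (ℚᵘ.≤-respʳ-≃ (ℚᵘ.≃-sym (toℚᵘ-fromℤ j)) (ℚᵘ.*≤* (ℤ.*-monoʳ-≤-nonNeg (ℤ.+ 1) i≤j))))

fromℤ-cancel-≤ : ∀ {i j} → fromℤ i ≤ fromℤ j → i ℤ.≤ j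
fromℤ-cancel-≤ {i} {j} le with ℚᵘ.≤-respˡ-≃ (toℚᵘ-fromℤ i) (ℚᵘ.≤-respʳ-≃ (toℚᵘ-fromℤ j) (toℚᵘ-mono-≤ le))
... | ℚᵘ.*≤* le′ = subst₂ ℤ._≤_ (ℤ.*-identityʳ i) (ℤ.*-identityʳ j) le′

ι-+ : ∀ a b → ι (a ℕ.+ b) ≡ ι a + ι b
ι-+ a b = fromℤ-+ (ℤ.+ a) (ℤ.+ b)

ι-* : ∀ a b → ι (a ℕ.* b) ≡ ι a * ι b
ι-* a b = trans (cong fromℤ (ℤ.pos-* a b)) (fromℤ-* (ℤ.+ a) (ℤ.+ b))

ι-suc : ∀ a → ι (suc a) ≡ 1ℚ + ι a
ι-suc = ι-+ 1

ι-mono-≤ : ∀ {a b} → a ℕ.≤ b → ι a ≤ ι b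
ι-mono-≤ a≤b = fromℤ-mono-≤ (ℤ.+≤+ a≤b)

ι-cancel-≤ : ∀ {a b} → ι a ≤ ι b → a ℕ.≤ b
ι-cancel-≤ le = ℤ.drop‿+≤+ (fromℤ-cancel-≤ le)

0≤ι : ∀ a → 0ℚ ≤ ι a
0≤ι a = ι-mono-≤ {0} {a} ℕ.z≤n

0<ι : ∀ a → 0ℚ < ι (suc a)
0<ι a = <-≤-trans (positive⁻¹ 1ℚ) (ι-mono-≤ {1} {suc a} (ℕ.s≤s ℕ.z≤n))

<⇒≱ : ∀ {a b : ℚ} → a < b → ¬ b ≤ a
<⇒≱ a<b b≤a = <-irrefl refl (<-≤-trans a<b b≤a)

0≤1 : 0ℚ ≤ 1ℚ
0≤1 = <⇒≤ (positive⁻¹ 1ℚ)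

0≤+ : ∀ {a b} → 0ℚ ≤ a → 0ℚ ≤ b → 0ℚ ≤ a + b
0≤+ = +-mono-≤

0<× : ∀ {a b} → 0ℚ < a → 0ℚ < b → 0ℚ < a * b
0<× {a} {b} 0<a 0<b = subst (_< a * b) (*-zeroʳ a) (*-monoʳ-<-pos a {{positive 0<a}} 0<b)

infix 8 _²

_² : ℚ → ℚ
x ² = x * x

0≤-x : ∀ {x} → x ≤ 0ℚ → 0ℚ ≤ - x
0≤-x = neg-antimono-≤

0≤² : ∀ x → 0ℚ ≤ x ²
0≤² x with ≤-total 0ℚ x
... | inj₁ 0≤x = 0≤* 0≤x 0≤x
... | inj₂ x≤0 = subst (0ℚ ≤_) (solve 1 (λ x → :- x :* :- x := x :* x) refl x) (0≤* (0≤-x x≤0) (0≤-x x≤0))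
  where open +-*-Solver

≤-by : ∀ {a b} c → 0ℚ ≤ c → b ≡ a + c → a ≤ b
≤-by {a} c 0≤c refl = subst (_≤ a + c) (+-identityʳ a) (+-monoʳ-≤ a 0≤c)

≤⇒0≤- : ∀ {a b} → a ≤ b → 0ℚ ≤ b - a
≤⇒0≤- {a} {b} a≤b = subst (_≤ b - a) (+-inverseʳ a) (+-monoˡ-≤ (- a) a≤b)

0≤-⇒≤ : ∀ {a b} → 0ℚ ≤ b - a → a ≤ b
0≤-⇒≤ {a} {b} le = ≤-by (b - a) le (solve 2 (λ a b → b := a :+ (b :- a)) refl a b)
  where open +-*-Solver

*-monoˡ : ∀ {a b c} → 0ℚ ≤ c → a ≤ b → c * a ≤ c * b
*-monoˡ {c = c} 0≤c = *-monoˡ-≤-nonNeg c {{nonNegative 0≤c}}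

*-monoʳ : ∀ {a b c} → 0ℚ ≤ c → a ≤ b → a * c ≤ b * c
*-monoʳ {c = c} 0≤c = *-monoʳ-≤-nonNeg c {{nonNegative 0≤c}}

*-cancelʳ : ∀ {a b c} → 0ℚ < c → a * c ≤ b * c → a ≤ b
*-cancelʳ {c = c} 0<c = *-cancelʳ-≤-pos c {{positive 0<c}}

²-mono : ∀ {a b} → 0ℚ ≤ a → a ≤ b → a ² ≤ b ²
²-mono 0≤a a≤b = ≤-trans (*-monoˡ 0≤a a≤b) (*-monoʳ (≤-trans 0≤a a≤b) a≤b)

²-cancel : ∀ {a b} → 0ℚ ≤ b → a ² ≤ b ² → a ≤ b
²-cancel {a} {b} 0≤b le = ≮⇒≥ λ b<a → <⇒≱
  (≤-<-trans (*-monoˡ 0≤b (<⇒≤ b<a)) (*-monoˡ-<-pos a {{positive (≤-<-trans 0≤b b<a)}} b<a)) le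

²≡0⇒≡0 : ∀ {a} → a ² ≤ 0ℚ → a ≡ 0ℚ
²≡0⇒≡0 {a} le = ≤-antisym (²-cancel ≤-refl (≤-trans le ≤-refl))
  (subst (0ℚ ≤_) (solve 1 (λ x → :- :- x := x) refl a) (0≤-x (²-cancel ≤-refl
    (subst (_≤ 0ℚ) (solve 1 (λ x → x :* x := :- x :* :- x) refl a) le))))
  where open +-*-Solver

-- The inverse, with the junk value inv 0 = 0.
inv : ℚ → ℚ
inv x with x ≟ 0ℚ
... | yes _  = 0ℚ
... | no x≢0 = (1/ x) {{≢-nonZero x≢0}}

*-inv : ∀ {x} → x ≢ 0ℚ → x * inv x ≡ 1ℚ
*-inv {x} x≢0 with x ≟ 0ℚ
... | yes x≡0 = ⊥-elim (x≢0 x≡0)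
... | no x≢0′ = *-inverseʳ x {{≢-nonZero x≢0′}}

0<⇒≢0 : ∀ {x} → 0ℚ < x → x ≢ 0ℚ
0<⇒≢0 0<x refl = <-irrefl refl 0<x

0<inv : ∀ {x} → 0ℚ < x → 0ℚ < inv x
0<inv {x} 0<x = ≰⇒> λ le → <⇒≱ (positive⁻¹ 1ℚ) (subst (_≤ 0ℚ) (*-inv (0<⇒≢0 0<x))
  (subst (x * inv x ≤_) (*-zeroʳ x) (*-monoˡ (<⇒≤ 0<x) le)))

0≤inv : ∀ {x} → 0ℚ ≤ x → 0ℚ ≤ inv x
0≤inv {x} 0≤x with x ≟ 0ℚ in eq
... | yes _  = ≤-refl
... | no x≢0 = subst (0ℚ ≤_) lem (<⇒≤ (0<inv (≤∧≢⇒< 0≤x (x≢0 ∘ sym))))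
  where
  ≤∧≢⇒< : ∀ {a b} → a ≤ b → a ≢ b → a < b
  ≤∧≢⇒< {a} {b} a≤b a≢b = ≰⇒> λ b≤a → a≢b (≤-antisym a≤b b≤a)
  lem : inv x ≡ (1/ x) {{≢-nonZero x≢0}}
  lem rewrite eq = refl

-- The hypothesis admits d = 0: with `inv 0ℚ` equal to 0 the division remains correct when the
-- numerator vanishes together with the denominator, as it does for null vectors in Gram-Schmidt.
*-inv-cancel : ∀ {c d} → (d ≡ 0ℚ → c ≡ 0ℚ) → c * inv d * d ≡ c
*-inv-cancel {c} {d} d0⇒c0 = go (d ≟ 0ℚ)
  where
  open +-*-Solver
  go : Dec (d ≡ 0ℚ) → c * inv d * d ≡ c
  go (yes d≡0) = trans (cong (λ c → c * inv d * d) (d0⇒c0 d≡0)) (trans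
    (solve 2 (λ i d → con 0ℚ :* i :* d := con 0ℚ) refl (inv d) d) (sym (d0⇒c0 d≡0)))
  go (no d≢0)  = trans (solve 3 (λ c i d → c :* i :* d := c :* (d :* i)) refl c (inv d) d)
    (trans (cong (c *_) (*-inv d≢0)) (*-identityʳ c))

∑ₗ : ∀ {A : Set} → List A → (A → ℚ) → ℚ
∑ₗ []       f = 0ℚ
∑ₗ (x ∷ xs) f = f x + ∑ₗ xs f

syntax ∑ₗ xs (λ x → e) = ∑[ x ← xs ] e

module _ {A : Set} where
  open +-*-Solver

  ∑-cong : ∀ (xs : List A) {f g : A → ℚ} → (∀ x → f x ≡ g x) → ∑ₗ xs f ≡ ∑ₗ xs g
  ∑-cong []       eq = refl
  ∑-cong (x ∷ xs) eq = cong₂ _+_ (eq x) (∑-cong xs eq)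

  ∑-lin : ∀ (xs : List A) s (f : A → ℚ) t (g : A → ℚ) →
          ∑[ x ← xs ] (s * f x + t * g x) ≡ s * ∑ₗ xs f + t * ∑ₗ xs g
  ∑-lin []       s f t g = solve 2 (λ s t → con 0ℚ := s :* con 0ℚ :+ t :* con 0ℚ) refl s t
  ∑-lin (x ∷ xs) s f t g = trans (cong ((s * f x + t * g x) +_) (∑-lin xs s f t g))
    (solve 6 (λ s a t b p q → (s :* a :+ t :* b) :+ (s :* p :+ t :* q) := s :* (a :+ p) :+ t :* (b :+ q))
      refl s (f x) t (g x) (∑ₗ xs f) (∑ₗ xs g))

  ∑-+ : ∀ (xs : List A) (f g : A → ℚ) → ∑[ x ← xs ] (f x + g x) ≡ ∑ₗ xs f + ∑ₗ xs g
  ∑-+ xs f g = trans (∑-cong xs λ x → solve 2 (λ a b → a :+ b := con 1ℚ :* a :+ con 1ℚ :* b) refl (f x) (g x))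
    (trans (∑-lin xs 1ℚ f 1ℚ g) (cong₂ _+_ (*-identityˡ (∑ₗ xs f)) (*-identityˡ (∑ₗ xs g))))

  ∑-*ˡ : ∀ (xs : List A) s (f : A → ℚ) → ∑[ x ← xs ] (s * f x) ≡ s * ∑ₗ xs f
  ∑-*ˡ []       s f = sym (*-zeroʳ s)
  ∑-*ˡ (x ∷ xs) s f = trans (cong (s * f x +_) (∑-*ˡ xs s f)) (sym (*-distribˡ-+ s (f x) (∑ₗ xs f)))

  ∑-*ʳ : ∀ (xs : List A) s (f : A → ℚ) → ∑[ x ← xs ] (f x * s) ≡ ∑ₗ xs f * s
  ∑-*ʳ xs s f = trans (∑-cong xs λ x → *-comm (f x) s) (trans (∑-*ˡ xs s f) (*-comm s _))

  ∑-mono : ∀ (xs : List A) {f g : A → ℚ} → (∀ x → f x ≤ g x) → ∑ₗ xs f ≤ ∑ₗ xs g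
  ∑-mono []       le = ≤-refl
  ∑-mono (x ∷ xs) le = +-mono-≤ (le x) (∑-mono xs le)

  ∑-zero : ∀ (xs : List A) {f : A → ℚ} → (∀ x → f x ≡ 0ℚ) → ∑ₗ xs f ≡ 0ℚ
  ∑-zero []       eq = refl
  ∑-zero (x ∷ xs) eq = cong₂ _+_ (eq x) (∑-zero xs eq)

  0≤∑ : ∀ (xs : List A) {f : A → ℚ} → (∀ x → 0ℚ ≤ f x) → 0ℚ ≤ ∑ₗ xs f
  0≤∑ []       le = ≤-refl
  0≤∑ (x ∷ xs) le = 0≤+ (le x) (0≤∑ xs le)

  ∑-const : ∀ (xs : List A) s → ∑[ x ← xs ] s ≡ ι (length xs) * s
  ∑-const []       s = sym (*-zeroˡ s)
  ∑-const (x ∷ xs) s = trans (cong (s +_) (∑-const xs s))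
    (trans (solve 2 (λ s k → s :+ k :* s := (con 1ℚ :+ k) :* s) refl s (ι (length xs)))
      (cong (_* s) (sym (ι-suc (length xs)))))

  term≤∑ : ∀ (xs : List A) {f : A → ℚ} → (∀ x → 0ℚ ≤ f x) → ∀ {x} → x ∈ xs → f x ≤ ∑ₗ xs f
  term≤∑ (x ∷ xs) {f} le (here refl) = ≤-by (∑ₗ xs f) (0≤∑ xs le) refl
  term≤∑ (y ∷ xs) {f} le {x} (there x∈) = ≤-trans (term≤∑ xs le x∈)
    (≤-by (f y) (le y) (+-comm (f y) (∑ₗ xs f)))

  ∑-++ : ∀ (xs ys : List A) (f : A → ℚ) → ∑ₗ (xs ++ ys) f ≡ ∑ₗ xs f + ∑ₗ ys f
  ∑-++ []       ys f = sym (+-identityˡ _)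
  ∑-++ (x ∷ xs) ys f = trans (cong (f x +_) (∑-++ xs ys f)) (sym (+-assoc (f x) _ _))

∑-map : ∀ {A B : Set} (h : A → B) (xs : List A) (f : B → ℚ) → ∑ₗ (map h xs) f ≡ ∑ₗ xs (f ∘ h)
∑-map h []       f = refl
∑-map h (x ∷ xs) f = cong (f (h x) +_) (∑-map h xs f)

∑-swap : ∀ {A B : Set} (xs : List A) (ys : List B) (f : A → B → ℚ) →
         ∑[ x ← xs ] (∑[ y ← ys ] f x y) ≡ ∑[ y ← ys ] (∑[ x ← xs ] f x y)
∑-swap []       ys f = sym (∑-zero ys λ _ → refl)
∑-swap (x ∷ xs) ys f = trans (cong (∑ₗ ys (f x) +_) (∑-swap xs ys f)) (sym (∑-+ ys (f x) _))

-- Positive semidefinite forms and Gram–Schmidt residuals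

lc : ∀ {X : Set} → ℚ → (X → ℚ) → ℚ → (X → ℚ) → X → ℚ
lc s u t v i = s * u i + t * v i

-- Null vectors are allowed. Linearity is stated for the literal term `lc s u t v`, because a form
-- need not respect pointwise equality of functions; vectors are therefore always combined by `lc`.
record Form (X : Set) : Set where
  field
    ⟪_,_⟫   : (X → ℚ) → (X → ℚ) → ℚ
    ⟪⟫-sym  : ∀ u v → ⟪ u , v ⟫ ≡ ⟪ v , u ⟫
    ⟪⟫-linˡ : ∀ s u t v w → ⟪ lc s u t v , w ⟫ ≡ s * ⟪ u , w ⟫ + t * ⟪ v , w ⟫
    0≤⟪⟫    : ∀ u → 0ℚ ≤ ⟪ u , u ⟫

  open +-*-Solver

  ⟪⟫-linʳ : ∀ s u t v w → ⟪ w , lc s u t v ⟫ ≡ s * ⟪ w , u ⟫ + t * ⟪ w , v ⟫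
  ⟪⟫-linʳ s u t v w = trans (⟪⟫-sym w (lc s u t v)) (trans (⟪⟫-linˡ s u t v w)
    (cong₂ (λ a b → s * a + t * b) (⟪⟫-sym u w) (⟪⟫-sym v w)))

  ⟪lc,lc⟫ : ∀ s u t v → ⟪ lc s u t v , lc s u t v ⟫ ≡
            s * s * ⟪ u , u ⟫ + (1ℚ + 1ℚ) * (s * t * ⟪ u , v ⟫) + t * t * ⟪ v , v ⟫
  ⟪lc,lc⟫ s u t v = trans (⟪⟫-linˡ s u t v (lc s u t v))
    (trans (cong₂ (λ a b → s * a + t * b) (⟪⟫-linʳ s u t v u)
             (trans (⟪⟫-linʳ s u t v v) (cong (λ a → s * a + t * ⟪ v , v ⟫) (⟪⟫-sym v u))))
      (solve 5 (λ s t a b c → s :* (s :* a :+ t :* b) :+ t :* (s :* b :+ t :* c)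
               := s :* s :* a :+ (con 1ℚ :+ con 1ℚ) :* (s :* t :* b) :+ t :* t :* c)
        refl s t ⟪ u , u ⟫ ⟪ u , v ⟫ ⟪ v , v ⟫))

  private
    cauchy-schwarz-pos : ∀ u v → 0ℚ < ⟪ v , v ⟫ → ⟪ u , v ⟫ ² ≤ ⟪ u , u ⟫ * ⟪ v , v ⟫
    cauchy-schwarz-pos u v 0<d = *-cancelʳ 0<d (0≤-⇒≤ (subst (0ℚ ≤_)
      (trans (⟪lc,lc⟫ d u (- c) v)
        (solve 3 (λ a c d → d :* d :* a :+ (con 1ℚ :+ con 1ℚ) :* (d :* :- c :* c) :+ :- c :* :- c :* d
                 := a :* d :* d :- c :* c :* d) refl ⟪ u , u ⟫ c d))
      (0≤⟪⟫ (lc d u (- c) v))))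
      where
      c d : ℚ
      c = ⟪ u , v ⟫
      d = ⟪ v , v ⟫

  cauchy-schwarz : ∀ u v → ⟪ u , v ⟫ ² ≤ ⟪ u , u ⟫ * ⟪ v , v ⟫
  cauchy-schwarz u v with 0ℚ <? ⟪ v , v ⟫ | 0ℚ <? ⟪ u , u ⟫
  ... | yes 0<v | _ = cauchy-schwarz-pos u v 0<v
  ... | no _ | yes 0<u = subst₂ _≤_ (cong₂ _*_ (⟪⟫-sym v u) (⟪⟫-sym v u)) (*-comm _ ⟪ u , u ⟫)
                           (cauchy-schwarz-pos v u 0<u)
  -- When both norms vanish, |s u + v|² = 2 s c is non-negative for every s, and s = - c gives c² ≤
  -- 0.
  ... | no v≯0 | no u≯0 = ≤-trans (≤-reflexive c²≡0) (0≤* (0≤⟪⟫ u) (0≤⟪⟫ v))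
    where
    c : ℚ
    c = ⟪ u , v ⟫
    a≡0 : ⟪ u , u ⟫ ≡ 0ℚ
    a≡0 = ≤-antisym (≮⇒≥ u≯0) (0≤⟪⟫ u)
    d≡0 : ⟪ v , v ⟫ ≡ 0ℚ
    d≡0 = ≤-antisym (≮⇒≥ v≯0) (0≤⟪⟫ v)
    expand : ∀ s → 0ℚ ≤ (1ℚ + 1ℚ) * (s * c)
    expand s = subst (0ℚ ≤_) (trans (⟪lc,lc⟫ s u 1ℚ v)
      (trans (cong₂ (λ a d → s * s * a + (1ℚ + 1ℚ) * (s * 1ℚ * c) + 1ℚ * 1ℚ * d) a≡0 d≡0)
        (solve 2 (λ s c → s :* s :* con 0ℚ :+ (con 1ℚ :+ con 1ℚ) :* (s :* con 1ℚ :* c) :+ con 1ℚ :* con 1ℚ :* con 0ℚ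
                 := (con 1ℚ :+ con 1ℚ) :* (s :* c)) refl s c)))
      (0≤⟪⟫ (lc s u 1ℚ v))
    c²≡0 : c ² ≡ 0ℚ
    c²≡0 = ≤-antisym (*-cancelʳ {c = 1ℚ + 1ℚ} (positive⁻¹ (1ℚ + 1ℚ)) (0≤-⇒≤ (subst (0ℚ ≤_)
      (solve 1 (λ c → (con 1ℚ :+ con 1ℚ) :* (:- c :* c)
               := con 0ℚ :* (con 1ℚ :+ con 1ℚ) :- c :* c :* (con 1ℚ :+ con 1ℚ)) refl c) (expand (- c))))) (0≤² c)

  null-orthogonal : ∀ u v → ⟪ v , v ⟫ ≡ 0ℚ → ⟪ u , v ⟫ ≡ 0ℚ
  null-orthogonal u v d≡0 = ²≡0⇒≡0 (≤-trans (cauchy-schwarz u v)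
    (≤-reflexive (trans (cong (⟪ u , u ⟫ *_) d≡0) (*-zeroʳ ⟪ u , u ⟫))))

  ⟪⟫*inv : ∀ u v → ⟪ u , v ⟫ * inv ⟪ v , v ⟫ * ⟪ v , v ⟫ ≡ ⟪ u , v ⟫
  ⟪⟫*inv u v = *-inv-cancel (null-orthogonal u v)

module Residual {X I : Set} (𝔽 : Form X) (col : I → X → ℚ) where
  open Form 𝔽
  open +-*-Solver

  coef : (X → ℚ) → (X → ℚ) → ℚ
  coef y e = ⟪ y , e ⟫ * inv ⟪ e , e ⟫

  -- Gram-Schmidt reads the list from its tail, so that prepending a column extends the orthogonal
  -- basis without changing it. A column whose residual is null subtracts nothing, its coefficient
  -- being 0 by the convention for `inv`.
  res : List I → (X → ℚ) → X → ℚ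
  res []      y = y
  res (j ∷ L) y = lc 1ℚ (res L y) (- coef (res L y) (res L (col j))) (res L (col j))

  ⟪res,⟫ : ∀ j L y w → ⟪ res (j ∷ L) y , w ⟫ ≡
           ⟪ res L y , w ⟫ - coef (res L y) (res L (col j)) * ⟪ res L (col j) , w ⟫
  ⟪res,⟫ j L y w = trans (⟪⟫-linˡ 1ℚ (res L y) (- c) (res L (col j)) w)
    (solve 3 (λ a c b → con 1ℚ :* a :+ :- c :* b := a :- c :* b) refl ⟪ res L y , w ⟫ c ⟪ res L (col j) , w ⟫)
    where
    c : ℚ
    c = coef (res L y) (res L (col j))

  -- This is P = P* P for the orthogonal projection `res L`. In the induction the correction of w
  -- along the new basis vector e drops out, since the residual r is orthogonal to e.
  res-selfadjoint : ∀ L y w → ⟪ res L y , w ⟫ ≡ ⟪ res L y , res L w ⟫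
  res-selfadjoint []      y w = refl
  res-selfadjoint (j ∷ L) y w = begin
    ⟪ res (j ∷ L) y , w ⟫                        ≡⟨ ⟪res,⟫ j L y w ⟩
    ⟪ y′ , w ⟫ - c * ⟪ e , w ⟫                   ≡⟨ cong₂ (λ a b → a - c * b) (res-selfadjoint L y w)
        (res-selfadjoint L (col j) w) ⟩
    ⟪ y′ , w′ ⟫ - c * ⟪ e , w′ ⟫                 ≡⟨ ⟪res,⟫ j L y w′ ⟨
    ⟪ r , w′ ⟫                                   ≡⟨ solve 2
        (λ a b → a := con 1ℚ :* a :+ :- b :* con 0ℚ) refl ⟪ r , w′ ⟫ c′ ⟩
    1ℚ * ⟪ r , w′ ⟫ + - c′ * 0ℚ                  ≡⟨ cong (λ a → 1ℚ * ⟪ r , w′ ⟫ + - c′ * a) r⊥e ⟨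
    1ℚ * ⟪ r , w′ ⟫ + - c′ * ⟪ r , e ⟫           ≡⟨ ⟪⟫-linʳ 1ℚ w′ (- c′) e r ⟨
    ⟪ r , res (j ∷ L) w ⟫                        ∎
    where
    open ≡-Reasoning
    y′ w′ e r : X → ℚ
    y′ = res L y
    w′ = res L w
    e  = res L (col j)
    r  = res (j ∷ L) y
    c c′ : ℚ
    c  = coef y′ e
    c′ = coef w′ e
    r⊥e : ⟪ r , e ⟫ ≡ 0ℚ
    r⊥e = trans (⟪res,⟫ j L y e) (trans (cong (λ a → ⟪ y′ , e ⟫ - a) (⟪⟫*inv y′ e)) (+-inverseʳ ⟪ y′ , e ⟫))

  res⊥col : ∀ L y {j} → j ∈ L → ⟪ res L y , col j ⟫ ≡ 0ℚ
  res⊥col (j ∷ L) y (here refl) = trans (⟪res,⟫ j L y (col j)) (trans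
    (cong₂ (λ a b → a - coef (res L y) e * b) (res-selfadjoint L y (col j)) (res-selfadjoint L (col j) (col j)))
    (trans (cong (λ a → ⟪ res L y , e ⟫ - a) (⟪⟫*inv (res L y) e)) (+-inverseʳ ⟪ res L y , e ⟫)))
    where
    e : X → ℚ
    e = res L (col j)
  res⊥col (i ∷ L) y {j} (there j∈L) = trans (⟪res,⟫ i L y (col j)) (trans
    (cong₂ (λ a b → a - c * b) (res⊥col L y j∈L) (res⊥col L (col i) j∈L))
    (solve 1 (λ c → con 0ℚ :- c :* con 0ℚ := con 0ℚ) refl c))
    where
    c : ℚ
    c = coef (res L y) (res L (col i))

  ⟪res,res⟫ : ∀ L y w → ⟪ res L y , res L w ⟫ ≡ ⟪ y , res L w ⟫
  ⟪res,res⟫ L y w = trans (⟪⟫-sym (res L y) (res L w)) (trans (sym (res-selfadjoint L w y)) (⟪⟫-sym (res L w) y))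

  ∣res∣² : ∀ j L y → ⟪ res (j ∷ L) y , res (j ∷ L) y ⟫ ≡
           ⟪ res L y , res L y ⟫ - ⟪ y , res L (col j) ⟫ ² * inv ⟪ res L (col j) , res L (col j) ⟫
  ∣res∣² j L y = begin
    ⟪ res (j ∷ L) y , res (j ∷ L) y ⟫     ≡⟨ res-selfadjoint (j ∷ L) y y ⟨
    ⟪ res (j ∷ L) y , y ⟫                 ≡⟨ ⟪res,⟫ j L y y ⟩
    ⟪ y′ , y ⟫ - ⟪ y′ , e ⟫ * i * ⟪ e , y ⟫ ≡⟨ cong₂ (λ a b → a - b * i * ⟪ e , y ⟫) (res-selfadjoint L y y)
        (⟪res,res⟫ L y (col j)) ⟩
    ⟪ y′ , y′ ⟫ - ⟪ y , e ⟫ * i * ⟪ e , y ⟫ ≡⟨ cong (λ a → ⟪ y′ , y′ ⟫ - ⟪ y , e ⟫ * i * a) (⟪⟫-sym e y) ⟩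
    ⟪ y′ , y′ ⟫ - ⟪ y , e ⟫ * i * ⟪ y , e ⟫ ≡⟨ solve 3 (λ a b i →
        a :- b :* i :* b := a :- b :* b :* i) refl ⟪ y′ , y′ ⟫ ⟪ y , e ⟫ i ⟩
    ⟪ y′ , y′ ⟫ - ⟪ y , e ⟫ ² * i           ∎
    where
    open ≡-Reasoning
    y′ e : X → ℚ
    y′ = res L y
    e  = res L (col j)
    i : ℚ
    i = inv ⟪ e , e ⟫

coordForm : ∀ {T : Set} (ts : List T) (w : T → ℚ) → (∀ t → 0ℚ ≤ w t) → Form T
coordForm ts w 0≤w = record
  { ⟪_,_⟫   = λ u v → ∑[ t ← ts ] (w t * (u t * v t))
  ; ⟪⟫-sym  = λ u v → ∑-cong ts λ t → cong (w t *_) (*-comm (u t) (v t))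
  ; ⟪⟫-linˡ = λ a u b v z → trans (∑-cong ts λ t →
      solve 6 (λ a u b v z w → w :* ((a :* u :+ b :* v) :* z) := a :* (w :* (u :* z)) :+ b :* (w :* (v :* z)))
        refl a (u t) b (v t) (z t) (w t)) (∑-lin ts a _ b _)
  ; 0≤⟪⟫    = λ u → 0≤∑ ts λ t → 0≤* (0≤w t) (0≤² (u t))
  }
  where open +-*-Solver

-- Power inequalities

infixr 8 _^ᵠ_

_^ᵠ_ : ℚ → ℕ → ℚ
x ^ᵠ zero  = 1ℚ
x ^ᵠ suc k = x * x ^ᵠ k

0≤^ : ∀ {a} k → 0ℚ ≤ a → 0ℚ ≤ a ^ᵠ k
0≤^ zero    0≤a = 0≤1
0≤^ (suc k) 0≤a = 0≤* 0≤a (0≤^ k 0≤a)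

^-mono : ∀ {a b} k → 0ℚ ≤ a → a ≤ b → a ^ᵠ k ≤ b ^ᵠ k
^-mono zero    0≤a a≤b = ≤-refl
^-mono (suc k) 0≤a a≤b = ≤-trans (*-monoˡ 0≤a (^-mono k 0≤a a≤b)) (*-monoʳ (0≤^ k (≤-trans 0≤a a≤b)) a≤b)

0<^ : ∀ {a} k → 0ℚ < a → 0ℚ < a ^ᵠ k
0<^ zero    0<a = positive⁻¹ 1ℚ
0<^ (suc k) 0<a = 0<× 0<a (0<^ k 0<a)

^-cancel : ∀ {a b} k → 0ℚ ≤ b → a ^ᵠ suc k ≤ b ^ᵠ suc k → a ≤ b
^-cancel {a} {b} k 0≤b le = ≮⇒≥ λ b<a → <⇒≱
  (≤-<-trans (*-monoˡ 0≤b (^-mono k 0≤b (<⇒≤ b<a)))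
    (subst₂ _<_ (*-comm (a ^ᵠ k) b) (*-comm (a ^ᵠ k) a)
      (*-monoʳ-<-pos (a ^ᵠ k) {{positive (0<^ k (≤-<-trans 0≤b b<a))}} b<a))) le

0≤[a-b][aᵏ-bᵏ] : ∀ {a b} k → 0ℚ ≤ a → 0ℚ ≤ b → 0ℚ ≤ (a - b) * (a ^ᵠ k - b ^ᵠ k)
0≤[a-b][aᵏ-bᵏ] {a} {b} k 0≤a 0≤b with ≤-total a b
... | inj₁ a≤b = subst (0ℚ ≤_)
    (solve 4 (λ a b p q → (b :- a) :* (q :- p) := (a :- b) :* (p :- q)) refl a b (a ^ᵠ k) (b ^ᵠ k))
    (0≤* (≤⇒0≤- a≤b) (≤⇒0≤- (^-mono k 0≤a a≤b)))
  where open +-*-Solver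
... | inj₂ b≤a = 0≤* (≤⇒0≤- b≤a) (≤⇒0≤- (^-mono k 0≤b b≤a))

-- Convexity: the tangent of the power function at a stays below its graph at b. The induction step
-- is a times the previous case, with (a - b)(a^(k+1) - b^(k+1)) ≥ 0 added.
^-tangent : ∀ {a b} k → 0ℚ ≤ a → 0ℚ ≤ b →
            a ^ᵠ suc k ≤ b ^ᵠ suc k + (1ℚ + ι k) * ((a - b) * a ^ᵠ k)
^-tangent {a} {b} zero 0≤a 0≤b = ≤-reflexive
  (solve 2 (λ a b → a :* con 1ℚ := b :* con 1ℚ :+ (con 1ℚ :+ con 0ℚ) :* ((a :- b) :* con 1ℚ)) refl a b)
  where open +-*-Solver
^-tangent {a} {b} (suc k) 0≤a 0≤b = ≤-trans (*-monoˡ 0≤a (^-tangent k 0≤a 0≤b))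
  (≤-by ((a - b) * (a ^ᵠ suc k - b ^ᵠ suc k)) (0≤[a-b][aᵏ-bᵏ] (suc k) 0≤a 0≤b)
    (trans (cong (λ K → b * b ^ᵠ suc k + (1ℚ + K) * ((a - b) * a ^ᵠ suc k)) (ι-suc k))
      (solve 5 (λ a b p q J → b :* q :+ (con 1ℚ :+ (con 1ℚ :+ J)) :* ((a :- b) :* (a :* p))
        := a :* (q :+ (con 1ℚ :+ J) :* ((a :- b) :* p)) :+ (a :- b) :* (a :* p :- q))
        refl a b (a ^ᵠ k) (b ^ᵠ suc k) (ι k))))
  where open +-*-Solver

≤∣∣ : ∀ a → a ≤ ∣ a ∣
≤∣∣ a with ≤-total 0ℚ a
... | inj₁ 0≤a = ≤-reflexive (sym (0≤p⇒∣p∣≡p 0≤a))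
... | inj₂ a≤0 = ≤-trans a≤0 (0≤∣p∣ a)

∣∣≤ : ∀ {a b} → a ≤ b → - a ≤ b → ∣ a ∣ ≤ b
∣∣≤ {a} {b} a≤b -a≤b with ∣p∣≡p∨∣p∣≡-p a
... | inj₁ eq = subst (_≤ b) (sym eq) a≤b
... | inj₂ eq = subst (_≤ b) (sym eq) -a≤b

module _ (P Q : ℚ) {c : ℚ} (0≤c : 0ℚ ≤ c) where
  open +-*-Solver
  private
    A B : ℚ
    A = P ² + c
    B = Q ² + c
    0≤A : 0ℚ ≤ A
    0≤A = 0≤+ (0≤² P) 0≤c
    0≤B : 0ℚ ≤ B
    0≤B = 0≤+ (0≤² Q) 0≤c

  module _ (B≤A : B ≤ A) where
    private
      Q²≤P² : Q ² ≤ P ²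
      Q²≤P² = 0≤-⇒≤ (subst (0ℚ ≤_) (solve 3 (λ p q c → (p :+ c) :- (q :+ c) := p :- q) refl (P ²) (Q ²) c)
          (≤⇒0≤- B≤A))

      ∣Q[P+Q]∣≤2A : ∣ Q * (P + Q) ∣ ≤ (1ℚ + 1ℚ) * A
      ∣Q[P+Q]∣≤2A = ∣∣≤
        (*-cancelʳ 0<2 (≤-by ((P - Q) ² + (d + d + d) + 4c) (0≤+ (0≤+ (0≤² (P - Q)) (0≤+ (0≤+ 0≤d 0≤d) 0≤d)) 0≤4c)
          (solve 3 (λ p q c → (two :* (p :* p :+ c)) :* two := (q :* (p :+ q)) :* two :+
            ((p :- q) :* (p :- q) :+ (p :* p :- q :* q :+ (p :* p :- q :* q) :+ (p :* p :- q :* q)) :+ two :*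
                (two :* c)))
            refl P Q c)))
        (*-cancelʳ 0<2 (≤-by ((P + Q) ² + (P ² + P ² + P ² + Q ²) + 4c)
          (0≤+ (0≤+ (0≤² (P + Q)) (0≤+ (0≤+ (0≤+ (0≤² P) (0≤² P)) (0≤² P)) (0≤² Q))) 0≤4c)
          (solve 3 (λ p q c → (two :* (p :* p :+ c)) :* two := (:- (q :* (p :+ q))) :* two :+
            ((p :+ q) :* (p :+ q) :+ (p :* p :+ p :* p :+ p :* p :+ q :* q) :+ two :* (two :* c)))
            refl P Q c)))
        where
        two : ∀ {n} → Polynomial n
        two = con 1ℚ :+ con 1ℚ
        0<2 : 0ℚ < 1ℚ + 1ℚ
        0<2 = positive⁻¹ (1ℚ + 1ℚ)
        d 4c : ℚ
        d  = P ² - Q ²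
        4c = (1ℚ + 1ℚ) * ((1ℚ + 1ℚ) * c)
        0≤d : 0ℚ ≤ d
        0≤d = ≤⇒0≤- Q²≤P²
        0≤4c : 0ℚ ≤ 4c
        0≤4c = 0≤* (<⇒≤ 0<2) (0≤* (<⇒≤ 0<2) 0≤c)

      -- Telescoping: A^(j+1) - B^(j+1) = A (A^j - B^j) + (A - B) B^j, where A - B = (P - Q)(P + Q).
      -- Each round adds a term controlled by |Q (P + Q)| ≤ 2 A and B ≤ A.
      ∣Q[Aʲ-Bʲ]∣ : ∀ j → ∣ Q * (A ^ᵠ j - B ^ᵠ j) ∣ ≤ (ι j + ι j) * (∣ P - Q ∣ * A ^ᵠ j)
      ∣Q[Aʲ-Bʲ]∣ zero = ≤-reflexive (trans (cong ∣_∣ (solve 1 (λ q → q :* (con 1ℚ :- con 1ℚ) := con 0ℚ) refl Q))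
        (sym (*-zeroˡ (∣ P - Q ∣ * 1ℚ))))
      ∣Q[Aʲ-Bʲ]∣ (suc j) = begin
        ∣ Q * (A * Aʲ - B * Bʲ) ∣
          ≡⟨ cong ∣_∣ (solve 5 (λ p q c a b → q :* ((p :* p :+ c) :* a :- (q :* q :+ c) :* b)
               := (p :* p :+ c) :* (q :* (a :- b)) :+ (p :- q) :* (q :* (p :+ q)) :* b) refl P Q c Aʲ Bʲ) ⟩
        ∣ A * (Q * (Aʲ - Bʲ)) + (P - Q) * (Q * (P + Q)) * Bʲ ∣
          ≤⟨ ∣p+q∣≤∣p∣+∣q∣ (A * (Q * (Aʲ - Bʲ))) ((P - Q) * (Q * (P + Q)) * Bʲ) ⟩
        ∣ A * (Q * (Aʲ - Bʲ)) ∣ + ∣ (P - Q) * (Q * (P + Q)) * Bʲ ∣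
          ≡⟨ cong₂ _+_ (trans (∣p*q∣≡∣p∣*∣q∣ A _) (cong (_* ∣ Q * (Aʲ - Bʲ) ∣) (0≤p⇒∣p∣≡p 0≤A)))
               (trans (∣p*q∣≡∣p∣*∣q∣ ((P - Q) * (Q * (P + Q))) Bʲ)
                   (cong₂ _*_ (∣p*q∣≡∣p∣*∣q∣ (P - Q) _) (0≤p⇒∣p∣≡p (0≤^ j 0≤B)))) ⟩
        A * ∣ Q * (Aʲ - Bʲ) ∣ + ∣ P - Q ∣ * ∣ Q * (P + Q) ∣ * Bʲ
          ≤⟨ +-mono-≤ (*-monoˡ 0≤A (∣Q[Aʲ-Bʲ]∣ j))
               (≤-trans (*-monoʳ (0≤^ j 0≤B) (*-monoˡ (0≤∣p∣ (P - Q)) ∣Q[P+Q]∣≤2A))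
                 (*-monoˡ (0≤* (0≤∣p∣ (P - Q)) (0≤* (<⇒≤ (positive⁻¹ (1ℚ + 1ℚ))) 0≤A)) (^-mono j 0≤B B≤A))) ⟩
        A * ((ι j + ι j) * (∣ P - Q ∣ * Aʲ)) + ∣ P - Q ∣ * ((1ℚ + 1ℚ) * A) * Aʲ
          ≡⟨ solve 4 (λ A J d a → A :* ((J :+ J) :* (d :* a)) :+ d :* ((con 1ℚ :+ con 1ℚ) :* A) :* a
               := ((con 1ℚ :+ J) :+ (con 1ℚ :+ J)) :* (d :* (A :* a))) refl A (ι j) ∣ P - Q ∣ Aʲ ⟩
        ((1ℚ + ι j) + (1ℚ + ι j)) * (∣ P - Q ∣ * (A * Aʲ))
          ≡⟨ cong (λ K → (K + K) * (∣ P - Q ∣ * (A * Aʲ))) (ι-suc j) ⟨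
        (ι (suc j) + ι (suc j)) * (∣ P - Q ∣ * (A * Aʲ)) ∎
        where
        open ≤-Reasoning
        Aʲ Bʲ : ℚ
        Aʲ = A ^ᵠ j
        Bʲ = B ^ᵠ j

    ∣PAʲ-QBʲ∣-ordered : ∀ j → ∣ P * A ^ᵠ j - Q * B ^ᵠ j ∣ ≤ (1ℚ + (ι j + ι j)) * (∣ P - Q ∣ * A ^ᵠ j)
    ∣PAʲ-QBʲ∣-ordered j = begin
      ∣ P * Aʲ - Q * Bʲ ∣
        ≡⟨ cong ∣_∣ (solve 4 (λ p q a b → p :* a :- q :* b := (p :- q) :* a :+ q :* (a :- b)) refl P Q Aʲ Bʲ) ⟩
      ∣ (P - Q) * Aʲ + Q * (Aʲ - Bʲ) ∣
        ≤⟨ ∣p+q∣≤∣p∣+∣q∣ ((P - Q) * Aʲ) (Q * (Aʲ - Bʲ)) ⟩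
      ∣ (P - Q) * Aʲ ∣ + ∣ Q * (Aʲ - Bʲ) ∣
        ≤⟨ +-mono-≤ (≤-reflexive (trans (∣p*q∣≡∣p∣*∣q∣ (P - Q) Aʲ) (cong (∣ P - Q ∣ *_) (0≤p⇒∣p∣≡p (0≤^ j 0≤A)))))
             (∣Q[Aʲ-Bʲ]∣ j) ⟩
      ∣ P - Q ∣ * Aʲ + (ι j + ι j) * (∣ P - Q ∣ * Aʲ)
        ≡⟨ solve 2 (λ x K → x :+ K :* x := (con 1ℚ :+ K) :* x) refl (∣ P - Q ∣ * Aʲ) (ι j + ι j) ⟩
      (1ℚ + (ι j + ι j)) * (∣ P - Q ∣ * Aʲ) ∎
      where
      open ≤-Reasoning
      Aʲ Bʲ : ℚ
      Aʲ = A ^ᵠ j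
      Bʲ = B ^ᵠ j

-- A discrete mean value theorem: x (x² + c)^j has derivative at most (2j + 1)(x² + c)^j, which
-- between P and Q is bounded by the sum of its values at the two ends.
∣PAʲ-QBʲ∣ : ∀ P Q {c} → 0ℚ ≤ c → ∀ j →
  ∣ P * (P ² + c) ^ᵠ j - Q * (Q ² + c) ^ᵠ j ∣ ≤
  (1ℚ + (ι j + ι j)) * (∣ P - Q ∣ * ((P ² + c) ^ᵠ j + (Q ² + c) ^ᵠ j))
∣PAʲ-QBʲ∣ P Q {c} 0≤c j with ≤-total (Q ² + c) (P ² + c)
... | inj₁ B≤A = ≤-trans (∣PAʲ-QBʲ∣-ordered P Q 0≤c B≤A j)
    (*-monoˡ (0≤+ 0≤1 (0≤+ (0≤ι j) (0≤ι j))) (*-monoˡ (0≤∣p∣ (P - Q))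
    (≤-by {(P ² + c) ^ᵠ j} ((Q ² + c) ^ᵠ j) (0≤^ j (0≤+ (0≤² Q) 0≤c)) refl)))
... | inj₂ A≤B = ≤-trans (≤-reflexive (∣-∣-swap (P * (P ² + c) ^ᵠ j) (Q * (Q ² + c) ^ᵠ j)))
    (≤-trans (∣PAʲ-QBʲ∣-ordered Q P 0≤c A≤B j)
    (*-monoˡ (0≤+ 0≤1 (0≤+ (0≤ι j) (0≤ι j))) (subst (∣ Q - P ∣ * (Q ² + c) ^ᵠ j ≤_)
      (cong (_* ((P ² + c) ^ᵠ j + (Q ² + c) ^ᵠ j)) (∣-∣-swap Q P))
      (*-monoˡ (0≤∣p∣ (Q - P)) (≤-by ((P ² + c) ^ᵠ j) (0≤^ j (0≤+ (0≤² P) 0≤c))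
          (+-comm ((P ² + c) ^ᵠ j) ((Q ² + c) ^ᵠ j)))))))
  where
  open +-*-Solver
  ∣-∣-swap : ∀ a b → ∣ a - b ∣ ≡ ∣ b - a ∣
  ∣-∣-swap a b = trans (cong ∣_∣ (solve 2 (λ a b → a :- b := :- (b :- a)) refl a b)) (∣-p∣≡∣p∣ (b - a))

16ℚ : ℚ
16ℚ = ι 16

-- α and β are the probabilities of ending at +1 and
-- -1, and D ± … are the corresponding final values of the signed sum.
potential : ℕ → (α β D z V : ℚ) → ℚ
potential k α β D z V =
  α * ((D + (β + β) * z) ² + 16ℚ * ι k * V) ^ᵠ k + β * ((D - (α + α) * z) ² + 16ℚ * ι k * V) ^ᵠ k

module _ (j : ℕ) {α β : ℚ} (0≤α : 0ℚ ≤ α) (0≤β : 0ℚ ≤ β) (α+β≡1 : α + β ≡ 1ℚ)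
         (D z ρ V W : ℚ) (0≤V : 0ℚ ≤ V) (∣ρz∣≤W : ∣ ρ * (z + ρ) ∣ ≤ W) where
  open +-*-Solver
  private
    J κ P Q P₀ Q₀ A B A₀ B₀ : ℚ
    J  = ι j
    κ  = 16ℚ * ι (suc j)
    P  = D + (β + β) * (z + ρ)
    Q  = D - (α + α) * (z + ρ)
    P₀ = D + (β + β) * z
    Q₀ = D - (α + α) * z
    A  = P ² + κ * V
    B  = Q ² + κ * V
    A₀ = P₀ ² + κ * (V + W)
    B₀ = Q₀ ² + κ * (V + W)
    0≤κ : 0ℚ ≤ κ
    0≤κ = 0≤* (0≤ι 16) (0≤ι (suc j))
    0≤W : 0ℚ ≤ W
    0≤W = ≤-trans (0≤∣p∣ (ρ * (z + ρ))) ∣ρz∣≤W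
    0≤A : 0ℚ ≤ A
    0≤A = 0≤+ (0≤² P) (0≤* 0≤κ 0≤V)
    0≤B : 0ℚ ≤ B
    0≤B = 0≤+ (0≤² Q) (0≤* 0≤κ 0≤V)
    Aʲ Bʲ : ℚ
    Aʲ = A ^ᵠ j
    Bʲ = B ^ᵠ j
    0≤Aʲ : 0ℚ ≤ Aʲ
    0≤Aʲ = 0≤^ j 0≤A
    0≤Bʲ : 0ℚ ≤ Bʲ
    0≤Bʲ = 0≤^ j 0≤B
    α≤1 : α ≤ 1ℚ
    α≤1 = ≤-by β 0≤β (sym α+β≡1)
    β≤1 : β ≤ 1ℚ
    β≤1 = ≤-by α 0≤α (trans (sym α+β≡1) (+-comm α β))

    P-Q : P - Q ≡ (1ℚ + 1ℚ) * (z + ρ)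
    P-Q = trans (solve 4 (λ D α β y → (D :+ (β :+ β) :* y) :- (D :- (α :+ α) :* y)
                          := ((α :+ β) :+ (α :+ β)) :* y) refl D α β (z + ρ))
            (cong (λ s → (s + s) * (z + ρ)) α+β≡1)

    Y : ℚ
    Y = P * Aʲ - Q * Bʲ

    ρY≤ : ρ * Y ≤ (1ℚ + (J + J)) * ((1ℚ + 1ℚ) * W * (Aʲ + Bʲ))
    ρY≤ = begin
      ρ * Y           ≤⟨ ≤∣∣ (ρ * Y) ⟩
      ∣ ρ * Y ∣       ≡⟨ ∣p*q∣≡∣p∣*∣q∣ ρ Y ⟩
      ∣ ρ ∣ * ∣ Y ∣   ≤⟨ *-monoˡ (0≤∣p∣ ρ) (∣PAʲ-QBʲ∣ P Q (0≤* 0≤κ 0≤V) j) ⟩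
      ∣ ρ ∣ * ((1ℚ + (J + J)) * (∣ P - Q ∣ * (Aʲ + Bʲ)))
        ≡⟨ cong (λ d → ∣ ρ ∣ * ((1ℚ + (J + J)) * (d * (Aʲ + Bʲ))))
            (trans (cong ∣_∣ P-Q) (∣p*q∣≡∣p∣*∣q∣ (1ℚ + 1ℚ) (z + ρ))) ⟩
      ∣ ρ ∣ * ((1ℚ + (J + J)) * ((1ℚ + 1ℚ) * ∣ z + ρ ∣ * (Aʲ + Bʲ)))
        ≡⟨ solve 4 (λ r K y s → r :* (K :* ((con 1ℚ :+ con 1ℚ) :* y :* s)) := K :*
            ((con 1ℚ :+ con 1ℚ) :* (r :* y) :* s))
             refl (∣ ρ ∣) (1ℚ + (J + J)) (∣ z + ρ ∣) (Aʲ + Bʲ) ⟩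
      (1ℚ + (J + J)) * ((1ℚ + 1ℚ) * (∣ ρ ∣ * ∣ z + ρ ∣) * (Aʲ + Bʲ))
        ≡⟨ cong (λ y → (1ℚ + (J + J)) * ((1ℚ + 1ℚ) * y * (Aʲ + Bʲ))) (∣p*q∣≡∣p∣*∣q∣ ρ (z + ρ)) ⟨
      (1ℚ + (J + J)) * ((1ℚ + 1ℚ) * ∣ ρ * (z + ρ) ∣ * (Aʲ + Bʲ))
        ≤⟨ *-monoˡ (0≤+ 0≤1 (0≤+ (0≤ι j) (0≤ι j))) (*-monoʳ (0≤+ 0≤Aʲ 0≤Bʲ)
            (*-monoˡ (<⇒≤ (positive⁻¹ (1ℚ + 1ℚ))) ∣ρz∣≤W)) ⟩
      (1ℚ + (J + J)) * ((1ℚ + 1ℚ) * W * (Aʲ + Bʲ)) ∎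
      where open ≤-Reasoning

    -- The factor 16 of the potential comes from here. The bound on ρ Y makes the first-order term
    -- at most 8 (1 + 2j) W αβ (Aʲ + Bʲ); moreover αβ ≤ α, αβ ≤ β and 8 (1 + 2j) ≤ 16 (j + 1).
    slack : 0ℚ ≤ κ * W * (α * Aʲ + β * Bʲ) - ι 4 * (α * β) * (ρ * Y)
    slack = subst (0ℚ ≤_) (trans
        (solve 7 (λ J W a b α β r →
            (con (ι 4) :* (α :* β)) :* ((con 1ℚ :+ (J :+ J)) :* ((con 1ℚ :+ con 1ℚ) :* W :* (a :+ b)) :- r)
             :+ con (ι 8) :* (con 1ℚ :+ (J :+ J)) :* W :* (α :* a :* (con 1ℚ :- β) :+ β :* b :* (con 1ℚ :- α))
             :+ con (ι 8) :* W :* (α :* a :+ β :* b)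
           := con (ι 16) :* (con 1ℚ :+ J) :* W :* (α :* a :+ β :* b) :- con (ι 4) :* (α :* β) :* r)
           refl J W Aʲ Bʲ α β (ρ * Y))
        (cong (λ K → 16ℚ * K * W * (α * Aʲ + β * Bʲ) - ι 4 * (α * β) * (ρ * Y)) (sym (ι-suc j))))
      (0≤+ (0≤+
        (0≤* (0≤* (0≤ι 4) (0≤* 0≤α 0≤β)) (≤⇒0≤- ρY≤))
        (0≤* (0≤* (0≤* (0≤ι 8) (0≤+ 0≤1 (0≤+ (0≤ι j) (0≤ι j)))) 0≤W)
          (0≤+ (0≤* (0≤* 0≤α 0≤Aʲ) (≤⇒0≤- β≤1)) (0≤* (0≤* 0≤β 0≤Bʲ) (≤⇒0≤- α≤1)))))
        (0≤* (0≤* (0≤ι 8) 0≤W) (0≤+ (0≤* 0≤α 0≤Aʲ) (0≤* 0≤β 0≤Bʲ))))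

  -- The mean of the two outcomes is D whatever z is, so changing z only alters their spread. By
  -- `^-tangent` at the new values this costs at most a multiple of 4 αβ ρ Y minus squares: the
  -- weights α · 2β and β · 2α agree, leaving the difference Y, which is small by `∣PAʲ-QBʲ∣`. The
  -- decrease W of V pays for it.
  potential-step : potential (suc j) α β D (z + ρ) V ≤ potential (suc j) α β D z (V + W)
  potential-step = begin
    α * A ^ᵠ suc j + β * B ^ᵠ suc j
      ≤⟨ +-mono-≤ (*-monoˡ 0≤α (^-tangent j 0≤A 0≤A₀)) (*-monoˡ 0≤β (^-tangent j 0≤B 0≤B₀)) ⟩
    α * (A₀ ^ᵠ suc j + (1ℚ + J) * ((A - A₀) * Aʲ)) + β * (B₀ ^ᵠ suc j + (1ℚ + J) * ((B - B₀) * Bʲ))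
      ≤⟨ ≤-by ((1ℚ + J) * ((κ * W * (α * Aʲ + β * Bʲ) - ι 4 * (α * β) * (ρ * Y))
                 + (α * Aʲ * ((β + β) * ρ) ² + β * Bʲ * ((α + α) * ρ) ²)))
          (0≤* (0≤+ 0≤1 (0≤ι j)) (0≤+ slack (0≤+ (0≤* (0≤* 0≤α 0≤Aʲ) (0≤² ((β + β) * ρ)))
              (0≤* (0≤* 0≤β 0≤Bʲ) (0≤² ((α + α) * ρ))))))
          (solve 13 (λ D z ρ α β κ V W a b p q J →
             let P  = D :+ (β :+ β) :* (z :+ ρ) ; Q  = D :- (α :+ α) :* (z :+ ρ)
                 P₀ = D :+ (β :+ β) :* z        ; Q₀ = D :- (α :+ α) :* z
                 A  = P :* P :+ κ :* V           ; B  = Q :* Q :+ κ :* V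
                 A₀ = P₀ :* P₀ :+ κ :* (V :+ W)  ; B₀ = Q₀ :* Q₀ :+ κ :* (V :+ W)
             in α :* p :+ β :* q :=
                (α :* (p :+ (con 1ℚ :+ J) :* ((A :- A₀) :* a)) :+ β :* (q :+ (con 1ℚ :+ J) :* ((B :- B₀) :* b)))
                :+ (con 1ℚ :+ J) :* ((κ :* W :* (α :* a :+ β :* b) :- con (ι 4) :* (α :* β) :*
                    (ρ :* (P :* a :- Q :* b)))
                   :+ (α :* a :* (((β :+ β) :* ρ) :* ((β :+ β) :* ρ)) :+ β :* b :*
                       (((α :+ α) :* ρ) :* ((α :+ α) :* ρ)))))
             refl D z ρ α β κ V W Aʲ Bʲ (A₀ ^ᵠ suc j) (B₀ ^ᵠ suc j) J) ⟩
    α * A₀ ^ᵠ suc j + β * B₀ ^ᵠ suc j ∎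
    where
    open ≤-Reasoning
    0≤A₀ : 0ℚ ≤ A₀
    0≤A₀ = 0≤+ (0≤² P₀) (0≤* 0≤κ (0≤+ 0≤V 0≤W))
    0≤B₀ : 0ℚ ≤ B₀
    0≤B₀ = 0≤+ (0≤² Q₀) (0≤* 0≤κ (0≤+ 0≤V 0≤W))

-- The Gram–Schmidt walk

-- With z′ = z + ρ the right side equals E - (1 - ω) m + ½ (1 - ω) ρ², and 2|m| ≤ E by AM-GM since
-- ρ² = d γ. The loss γ of budget alone does not control ρ z′; the growth d of ω supplies the other
-- half, ½ d z′², of E.
transition : ∀ {z ρ ω d β γ} → ρ ² ≡ d * γ → 0ℚ ≤ d → 0ℚ ≤ γ → 0ℚ ≤ ω → ω ≤ 1ℚ →
  ∣ ρ * (z + ρ) ∣ ≤ ((β + β) + ½ * ((1ℚ - ω) * z ²)) -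
                    (((β - γ) + (β - γ)) + ½ * ((1ℚ - (ω + d)) * (z + ρ) ²))
transition {z} {ρ} {ω} {d} {β} {γ} ρ²≡dγ 0≤d 0≤γ 0≤ω ω≤1 = ∣∣≤
  (≤-by (½ * ((1ℚ + (1ℚ - ω)) * (E - (m + m)) + ω * E) + ½ * ((1ℚ - ω) * ρ ²))
    (0≤+ (0≤* 0≤½ (0≤+ (0≤* (0≤+ 0≤1 0≤φ) (≤⇒0≤- 2m≤E)) (0≤* 0≤ω 0≤E))) (0≤* 0≤½ (0≤* 0≤φ (0≤² ρ))))
    (solve 6 (λ z ρ ω d β γ →
      let m = ρ :* (z :+ ρ) ; E = (γ :+ γ) :+ con ½ :* (d :* ((z :+ ρ) :* (z :+ ρ))) in
      ((β :+ β) :+ con ½ :* ((con 1ℚ :- ω) :* (z :* z))) :-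
        (((β :- γ) :+ (β :- γ)) :+ con ½ :* ((con 1ℚ :- (ω :+ d)) :* ((z :+ ρ) :* (z :+ ρ))))
      := m :+ (con ½ :* ((con 1ℚ :+ (con 1ℚ :- ω)) :* (E :- (m :+ m)) :+ ω :* E) :+ con ½ :*
          ((con 1ℚ :- ω) :* (ρ :* ρ))))
      refl z ρ ω d β γ))
  (≤-by (½ * (ω * (E - (- m + - m)) + (1ℚ + (1ℚ - ω)) * E) + ½ * ((1ℚ - ω) * ρ ²))
    (0≤+ (0≤* 0≤½ (0≤+ (0≤* 0≤ω (≤⇒0≤- -2m≤E)) (0≤* (0≤+ 0≤1 0≤φ) 0≤E))) (0≤* 0≤½ (0≤* 0≤φ (0≤² ρ))))
    (solve 6 (λ z ρ ω d β γ →
      let m = ρ :* (z :+ ρ) ; E = (γ :+ γ) :+ con ½ :* (d :* ((z :+ ρ) :* (z :+ ρ))) in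
      ((β :+ β) :+ con ½ :* ((con 1ℚ :- ω) :* (z :* z))) :-
        (((β :- γ) :+ (β :- γ)) :+ con ½ :* ((con 1ℚ :- (ω :+ d)) :* ((z :+ ρ) :* (z :+ ρ))))
      := :- m :+ (con ½ :* (ω :* (E :- (:- m :+ :- m)) :+ (con 1ℚ :+ (con 1ℚ :- ω)) :* E) :+ con ½ :*
          ((con 1ℚ :- ω) :* (ρ :* ρ))))
      refl z ρ ω d β γ))
  where
  open +-*-Solver
  m E : ℚ
  m = ρ * (z + ρ)
  E = (γ + γ) + ½ * (d * (z + ρ) ²)
  0≤½ : 0ℚ ≤ ½
  0≤½ = <⇒≤ (positive⁻¹ ½)
  0≤φ : 0ℚ ≤ 1ℚ - ω
  0≤φ = ≤⇒0≤- ω≤1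
  0≤E : 0ℚ ≤ E
  0≤E = 0≤+ (0≤+ 0≤γ 0≤γ) (0≤* 0≤½ (0≤* 0≤d (0≤² (z + ρ))))
  -- (2γ + dz′²/2)² ≥ 4 γ d z′² = (2 ρ z′)²
  amgm : (m + m) ² ≤ E ²
  amgm = ≤-by (((γ + γ) - ½ * (d * (z + ρ) ²)) ²) (0≤² ((γ + γ) - ½ * (d * (z + ρ) ²))) (trans
    (solve 4 (λ γ d y ρ → ((γ :+ γ) :+ con ½ :* (d :* (y :* y))) :* ((γ :+ γ) :+ con ½ :* (d :* (y :* y)))
      := (con (ι 4) :* (y :* y)) :* (d :* γ) :+
         ((γ :+ γ) :- con ½ :* (d :* (y :* y))) :* ((γ :+ γ) :- con ½ :* (d :* (y :* y)))) refl γ d (z + ρ) ρ)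
    (cong (_+ ((γ + γ) - ½ * (d * (z + ρ) ²)) ²) (trans (cong (ι 4 * (z + ρ) ² *_) (sym ρ²≡dγ))
      (solve 2 (λ y ρ → (con (ι 4) :* (y :* y)) :* (ρ :* ρ) := (ρ :* y :+ ρ :* y) :* (ρ :* y :+ ρ :* y)) refl
          (z + ρ) ρ))))
  2m≤E : m + m ≤ E
  2m≤E = ²-cancel 0≤E amgm
  -2m≤E : - m + - m ≤ E
  -2m≤E = ²-cancel 0≤E (subst (_≤ E ²) (solve 1 (λ m → (m :+ m) :* (m :+ m) := (:- m :+ :- m) :*
      (:- m :+ :- m)) refl m) amgm)

potential-0 : ∀ k {α β} D V → α + β ≡ 1ℚ → potential k α β D 0ℚ V ≡ (D ² + 16ℚ * ι k * V) ^ᵠ k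
potential-0 k {α} {β} D V α+β≡1 = trans (cong₂ (λ P Q →
    α * (P ² + 16ℚ * ι k * V) ^ᵠ k + β * (Q ² + 16ℚ * ι k * V) ^ᵠ k)
    (solve 2 (λ D β → D :+ (β :+ β) :* con 0ℚ := D) refl D β)
        (solve 2 (λ D α → D :- (α :+ α) :* con 0ℚ := D) refl D α))
  (trans (sym (*-distribʳ-+ h α β)) (trans (cong (_* h) α+β≡1) (*-identityˡ h)))
  where
  open +-*-Solver
  h : ℚ
  h = (D ² + 16ℚ * ι k * V) ^ᵠ k

potential-10 : ∀ k D z V → potential k 1ℚ 0ℚ D z V ≡ (D ² + 16ℚ * ι k * V) ^ᵠ k
potential-10 k D z V = trans (cong (λ P → 1ℚ * (P ² + 16ℚ * ι k * V) ^ᵠ k + 0ℚ * Q)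
    (solve 2 (λ D z → D :+ (con 0ℚ :+ con 0ℚ) :* z := D) refl D z))
  (solve 2 (λ h q → con 1ℚ :* h :+ con 0ℚ :* q := h) refl ((D ² + 16ℚ * ι k * V) ^ᵠ k) Q)
  where
  open +-*-Solver
  Q : ℚ
  Q = ((D - (1ℚ + 1ℚ) * z) ² + 16ℚ * ι k * V) ^ᵠ k

potential-01 : ∀ k D z V → potential k 0ℚ 1ℚ D z V ≡ (D ² + 16ℚ * ι k * V) ^ᵠ k
potential-01 k D z V = trans (cong (λ Q → 0ℚ * P + 1ℚ * (Q ² + 16ℚ * ι k * V) ^ᵠ k)
    (solve 2 (λ D z → D :- (con 0ℚ :+ con 0ℚ) :* z := D) refl D z))
  (solve 2 (λ h p → con 0ℚ :* p :+ con 1ℚ :* h := h) refl ((D ² + 16ℚ * ι k * V) ^ᵠ k) P)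
  where
  open +-*-Solver
  P : ℚ
  P = ((D + (1ℚ + 1ℚ) * z) ² + 16ℚ * ι k * V) ^ᵠ k

-- Steps inside the cube

InRange Hit : ℚ → Set
InRange y = - 1ℚ ≤ y × y ≤ 1ℚ
Hit y = y ≡ 1ℚ ⊎ y ≡ - 1ℚ

Hit⇒InRange : ∀ {y} → Hit y → InRange y
Hit⇒InRange (inj₁ refl) = <⇒≤ (<-trans (negative⁻¹ (- 1ℚ)) (positive⁻¹ 1ℚ)) , ≤-refl
Hit⇒InRange (inj₂ refl) = ≤-refl , <⇒≤ (<-trans (negative⁻¹ (- 1ℚ)) (positive⁻¹ 1ℚ))

shrink : ∀ {x v δ δ′} → InRange x → InRange (x + δ * v) → 0ℚ ≤ δ′ → δ′ ≤ δ → InRange (x + δ′ * v)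
shrink {x} {v} {δ} {δ′} (lo , hi) (lo′ , hi′) 0≤δ′ δ′≤δ with ≤-total 0ℚ v
... | inj₁ 0≤v = ≤-trans lo (≤-by (δ′ * v) (0≤* 0≤δ′ 0≤v) refl) , ≤-trans (+-monoʳ-≤ x (*-monoʳ 0≤v δ′≤δ)) hi′
... | inj₂ v≤0 = ≤-trans lo′ (+-monoʳ-≤ x (*-monoʳ-≤-nonPos v {{nonPositive v≤0}} δ′≤δ))
    , ≤-trans (≤-by (δ′ * - v) (0≤* 0≤δ′ (0≤-x v≤0)) (solve 3
        (λ x d v → x := x :+ d :* v :+ d :* :- v) refl x δ′ v)) hi
  where open +-*-Solver

clip-upper : ∀ {x v δ} → x ≤ 1ℚ → 0ℚ ≤ δ → 1ℚ < x + δ * v → ∃[ δ′ ] 0ℚ ≤ δ′ × δ′ ≤ δ × x + δ′ * v ≡ 1ℚ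
clip-upper {x} {v} {δ} x≤1 0≤δ over = δ′ , 0≤* (≤⇒0≤- x≤1) (0≤inv (<⇒≤ 0<v)) ,
    *-cancelʳ 0<v (≤-trans (≤-reflexive δ′v) 1-x≤δv) ,
    trans (cong (x +_) δ′v) (solve 1 (λ x → x :+ (con 1ℚ :- x) := con 1ℚ) refl x)
  where
  open +-*-Solver
  1-x≤δv : 1ℚ - x ≤ δ * v
  1-x≤δv = 0≤-⇒≤ (subst (0ℚ ≤_) (solve 2 (λ x y → x :+ y :- con 1ℚ := y :- (con 1ℚ :- x)) refl x (δ * v))
      (≤⇒0≤- (<⇒≤ over)))
  0<v : 0ℚ < v
  0<v = ≰⇒> λ v≤0 → <⇒≱ over (≤-trans (≤-by (δ * - v) (0≤* 0≤δ (0≤-x v≤0))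
    (solve 3 (λ x d v → x := x :+ d :* v :+ d :* :- v) refl x δ v)) x≤1)
  δ′ : ℚ
  δ′ = (1ℚ - x) * inv v
  δ′v : δ′ * v ≡ 1ℚ - x
  δ′v = *-inv-cancel λ v≡0 → ⊥-elim (0<⇒≢0 0<v v≡0)

clip₁ : ∀ {x v δ} → InRange x → 0ℚ ≤ δ →
        InRange (x + δ * v) ⊎ (∃[ δ′ ] 0ℚ ≤ δ′ × δ′ ≤ δ × Hit (x + δ′ * v))
clip₁ {x} {v} {δ} (lo , hi) 0≤δ with (x + δ * v) ≤? 1ℚ | - 1ℚ ≤? (x + δ * v)
... | yes p | yes q = inj₁ (q , p)
... | no ¬p | _ = let δ′ , a , b , c = clip-upper hi 0≤δ (≰⇒> ¬p) in inj₂ (δ′ , a , b , inj₁ c)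
... | yes _ | no ¬q = let δ′ , a , b , c = clip-upper { - x} { - v} (neg-antimono-≤ lo) 0≤δ
                                             (subst (1ℚ <_) (neg x δ v) (neg-antimono-< (≰⇒> ¬q)))
    in inj₂ (δ′ , a , b , inj₂ (trans (solve 1 (λ y → y := :- :- y) refl (x + δ′ * v)) (cong -_ (trans (neg x δ′ v) c))))
  where
  open +-*-Solver
  neg : ∀ x δ v → - (x + δ * v) ≡ - x + δ * - v
  neg = solve 3 (λ x d v → :- (x :+ d :* v) := :- x :+ d :* :- v) refl

-- The step is shortened once for every coordinate that would leave [-1, 1]; by convexity (`shrink`)
-- the coordinates treated earlier stay in range.
clip : ∀ {I : Set} (x v : I → ℚ) → (∀ i → InRange (x i)) → ∀ L {δ} → 0ℚ ≤ δ →
  ∃[ δ′ ] 0ℚ ≤ δ′ × δ′ ≤ δ × (∀ {i} → i ∈ L → InRange (x i + δ′ * v i)) ×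
          (δ′ ≡ δ ⊎ ∃[ j ] j ∈ L × Hit (x j + δ′ * v j))
clip x v ok []      {δ} 0≤δ = δ , 0≤δ , ≤-refl , (λ ()) , inj₁ refl
clip x v ok (i ∷ L) {δ} 0≤δ with clip x v ok L 0≤δ
... | δ₁ , 0≤δ₁ , δ₁≤δ , fits , end with clip₁ {x i} {v i} (ok i) 0≤δ₁
...   | inj₁ fit = δ₁ , 0≤δ₁ , δ₁≤δ , (λ { (here refl) → fit ; (there i∈) → fits i∈ }) ,
          (case end)
  where
  case : δ₁ ≡ δ ⊎ (∃[ j ] j ∈ L × Hit (x j + δ₁ * v j)) → δ₁ ≡ δ ⊎ (∃[ j ] j ∈ i ∷ L × Hit (x j + δ₁ * v j))
  case (inj₁ eq)           = inj₁ eq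
  case (inj₂ (j , j∈ , h)) = inj₂ (j , there j∈ , h)
...   | inj₂ (δ₂ , 0≤δ₂ , δ₂≤δ₁ , hit) = δ₂ , 0≤δ₂ , ≤-trans δ₂≤δ₁ δ₁≤δ ,
          (λ { (here refl) → Hit⇒InRange hit ; {j} (there j∈) → shrink (ok j) (fits j∈) 0≤δ₂ δ₂≤δ₁ }) ,
          inj₂ (i , here refl , hit)
unit : ∀ {n} → Fin n → Fin n → ℚ
unit i i′ = if does (i Fin.≟ i′) then 1ℚ else 0ℚ

unit-≡ : ∀ {n} (i : Fin n) → unit i i ≡ 1ℚ
unit-≡ i with i Fin.≟ i
... | yes _ = refl
... | no i≢i = contradiction refl i≢i

unit-≢ : ∀ {n} {i i′ : Fin n} → i ≢ i′ → unit i i′ ≡ 0ℚ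
unit-≢ {i = i} {i′} i≢i′ with i Fin.≟ i′
... | yes i≡i′ = contradiction i≡i′ i≢i′
... | no _ = refl

potential-drop : ∀ j {α β D z ρ z′ V V′} → 0ℚ ≤ α → 0ℚ ≤ β → α + β ≡ 1ℚ → z′ ≡ z + ρ → 0ℚ ≤ V′ →
                 ∣ ρ * (z + ρ) ∣ ≤ V - V′ → potential (suc j) α β D z′ V′ ≤ potential (suc j) α β D z V
potential-drop j {α} {β} {D} {z} {ρ} {z′} {V} {V′} 0≤α 0≤β α+β≡1 refl 0≤V′ le =
  subst (λ v → potential (suc j) α β D (z + ρ) V′ ≤ potential (suc j) α β D z v)
    (solve 2 (λ a b → a :+ (b :- a) := b) refl V′ V)
    (potential-step j 0≤α 0≤β α+β≡1 D z ρ V′ (V - V′) 0≤V′ le)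
  where open +-*-Solver

-- The form is ⟨C u, C v⟩ and f r u is ⟨b, C u⟩ for the r-th row b; `unit≤1` and `f-bound` normalise
-- the columns and rows to length at most 1. `expand` serves to pass from orthogonality to the units
-- in S to orthogonality to every vector supported on S.
module GramSchmidtWalk {n : ℕ} (𝔽 : Form (Fin n)) {R : Set} (rows : List R) (f : R → (Fin n → ℚ) → ℚ)
  (expand : ∀ w u → Form.⟪_,_⟫ 𝔽 w u ≡ ∑[ i ← allFin n ] (u i * Form.⟪_,_⟫ 𝔽 w (unit i)))
  (unit≤1 : ∀ i → Form.⟪_,_⟫ 𝔽 (unit i) (unit i) ≤ 1ℚ)
  (f-lin : ∀ r s u t v → f r (lc s u t v) ≡ s * f r u + t * f r v)
  (f-bound : ∀ r u → f r u ² ≤ Form.⟪_,_⟫ 𝔽 u u)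
  (j₀ : ℕ) where

  open Form 𝔽
  open Residual 𝔽 unit
  open DecMembership (Fin._≟_ {n}) using (_∈?_)
  open +-*-Solver

  k : ℕ
  k = suc j₀

  Supp : List (Fin n) → (Fin n → ℚ) → Set
  Supp S u = ∀ i → i ∉ S → u i ≡ 0ℚ

  Orth : List (Fin n) → (Fin n → ℚ) → Set
  Orth S w = ∀ u → Supp S u → ⟪ w , u ⟫ ≡ 0ℚ

  res-off : ∀ S y {i} → i ∉ S → res S y i ≡ y i
  res-off []      y i∉ = refl
  res-off (j ∷ S) y {i} i∉ = trans (cong₂ (λ a b → 1ℚ * a + - c * b) (res-off S y (i∉ ∘ there))
      (trans (res-off S (unit j) (i∉ ∘ there)) (unit-≢ λ j≡i → i∉ (here (sym j≡i)))))
    (solve 2 (λ a c → con 1ℚ :* a :+ :- c :* con 0ℚ := a) refl (y i) c)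
    where
    c : ℚ
    c = coef (res S y) (res S (unit j))

  res-Orth : ∀ S y → Orth S (res S y)
  res-Orth S y u supp = trans (expand (res S y) u) (∑-zero (allFin n) zeros)
    where
    zeros : ∀ i → u i * ⟪ res S y , unit i ⟫ ≡ 0ℚ
    zeros i with i ∈? S
    ... | yes i∈S = trans (cong (u i *_) (res⊥col S y i∈S)) (*-zeroʳ (u i))
    ... | no  i∉S = trans (cong (_* ⟪ res S y , unit i ⟫) (supp i i∉S)) (*-zeroˡ ⟪ res S y , unit i ⟫)

  infixl 6 _∖_

  _∖_ : List (Fin n) → Fin n → List (Fin n)
  S ∖ j = filter (λ i → ¬? (i Fin.≟ j)) S

  ∉∖-self : ∀ S j → j ∉ S ∖ j
  ∉∖-self S j j∈ = proj₂ (∈-filter⁻ (λ i → ¬? (i Fin.≟ j)) {xs = S} j∈) refl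

  ∉∖-⊆ : ∀ S j {i} → i ∉ S → i ∉ S ∖ j
  ∉∖-⊆ S j i∉ i∈ = i∉ (proj₁ (∈-filter⁻ (λ i → ¬? (i Fin.≟ j)) {xs = S} i∈))

  ∉∖⁻ : ∀ S j {i} → i ∉ S ∖ j → i ≢ j → i ∉ S
  ∉∖⁻ S j i∉ i≢j i∈ = i∉ (∈-filter⁺ (λ i → ¬? (i Fin.≟ j)) i∈ i≢j)

  length-∖ : ∀ S {j} → j ∈ S → length (S ∖ j) ℕ.< length S
  length-∖ S {j} j∈ = filter-notAll (λ i → ¬? (i Fin.≟ j)) S (Any.map (λ { refl i≢i → i≢i refl }) j∈)

  -- An upper bound for the squared norm of the projection of the functional
  -- f r to the span of S.
  Budget : List (Fin n) → (R → ℚ) → Set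
  Budget S β = (∀ r → 0ℚ ≤ β r) × (∀ r u → Supp S u → f r u ² ≤ β r * ⟪ u , u ⟫)

  module Remove (S : List (Fin n)) {j : Fin n} (j∈S : j ∈ S) {β : R → ℚ} (budget : Budget S β) where
    e : Fin n → ℚ
    e = res (S ∖ j) (unit j)

    d : ℚ
    d = ⟪ e , e ⟫

    e-j : e j ≡ 1ℚ
    e-j = trans (res-off (S ∖ j) (unit j) (∉∖-self S j)) (unit-≡ j)

    e-off : ∀ {i} → i ∉ S ∖ j → i ≢ j → e i ≡ 0ℚ
    e-off i∉ i≢j = trans (res-off (S ∖ j) (unit j) i∉) (unit-≢ (i≢j ∘ sym))

    e-Supp : Supp S e
    e-Supp i i∉S = e-off (∉∖-⊆ S j i∉S) λ { refl → i∉S j∈S }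

    e-Orth : Orth (S ∖ j) e
    e-Orth = res-Orth (S ∖ j) (unit j)

    Supp-∖ : ∀ {u} → Supp (S ∖ j) u → Supp S u
    Supp-∖ supp i i∉S = supp i (∉∖-⊆ S j i∉S)

    Supp-lc : ∀ s t {u v} → Supp S u → Supp S v → Supp S (lc s u t v)
    Supp-lc s t su sv i i∉ = trans (cong₂ (λ a b → s * a + t * b) (su i i∉) (sv i i∉))
      (solve 2 (λ s t → s :* con 0ℚ :+ t :* con 0ℚ := con 0ℚ) refl s t)

    -- The squared length of the component of f r along e, which is exactly the budget lost when j
    -- is removed.
    γ : R → ℚ
    γ r = f r e ² * inv d

    0≤γ : ∀ r → 0ℚ ≤ γ r
    0≤γ r = 0≤* (0≤² (f r e)) (0≤inv (0≤⟪⟫ e))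

    γd : ∀ r → γ r * d ≡ f r e ²
    γd r = *-inv-cancel λ d≡0 → ≤-antisym (≤-trans (proj₂ budget r e e-Supp)
      (≤-reflexive (trans (cong (β r *_) d≡0) (*-zeroʳ (β r))))) (0≤² (f r e))

    γ≡0 : ∀ r → ¬ 0ℚ < d → γ r ≡ 0ℚ
    γ≡0 r d≯0 = trans (cong (_* inv d) (trans (sym (γd r)) (trans (cong (γ r *_) d≡0) (*-zeroʳ (γ r)))))
        (*-zeroˡ (inv d))
      where
      d≡0 : d ≡ 0ℚ
      d≡0 = ≤-antisym (≮⇒≥ d≯0) (0≤⟪⟫ e)

    γ≤β : ∀ r → γ r ≤ β r
    γ≤β r = go (0ℚ <? d)
      where
      go : Dec (0ℚ < d) → γ r ≤ β r
      go (yes 0<d) = *-cancelʳ 0<d (subst (_≤ β r * d) (sym (γd r)) (proj₂ budget r e e-Supp))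
      go (no d≯0)  = subst (_≤ β r) (sym (γ≡0 r d≯0)) (proj₁ budget r)

    -- Bessel's inequality for two orthogonal directions, (f u)² / |u|² + (f e)² / |e|² ≤ β, cleared
    -- of denominators. It is the old budget evaluated at the combination of u and e on which f is
    -- largest for its norm.
    budget′ : Budget (S ∖ j) (λ r → β r - γ r)
    budget′ = (λ r → ≤⇒0≤- (γ≤β r)) , bound
      where
      bound : ∀ r u → Supp (S ∖ j) u → f r u ² ≤ (β r - γ r) * ⟪ u , u ⟫
      bound r u supp = go (0ℚ <? d)
        where
        a b N X : ℚ
        a = f r u
        b = f r e
        N = ⟪ u , u ⟫
        X = a ² * d + b ² * N
        u⊥e : ⟪ u , e ⟫ ≡ 0ℚ
        u⊥e = trans (⟪⟫-sym u e) (e-Orth u supp)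
        -- the budget on S for s u + c e with s = a d and c = b N
        X²≤ : X * X ≤ β r * N * d * X
        X²≤ = subst₂ _≤_
          (trans (cong₂ _*_ (f-lin r (a * d) u (b * N) e) (f-lin r (a * d) u (b * N) e))
            (solve 4 (λ a b d N → (a :* d :* a :+ b :* N :* b) :* (a :* d :* a :+ b :* N :* b)
              := (a :* a :* d :+ b :* b :* N) :* (a :* a :* d :+ b :* b :* N)) refl a b d N))
          (trans (cong (β r *_) (trans (⟪lc,lc⟫ (a * d) u (b * N) e)
              (cong (λ o → a * d * (a * d) * N + (1ℚ + 1ℚ) * (a * d * (b * N) * o) + b * N * (b * N) * d) u⊥e)))
            (solve 5 (λ a b d N β → β :* (a :* d :* (a :* d) :* N :+ (con 1ℚ :+ con 1ℚ) :*
                (a :* d :* (b :* N) :* con 0ℚ) :+ b :* N :* (b :* N) :* d)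
              := β :* N :* d :* (a :* a :* d :+ b :* b :* N)) refl a b d N (β r)))
          (proj₂ budget r (lc (a * d) u (b * N) e) (Supp-lc (a * d) (b * N) (Supp-∖ supp) e-Supp))
        X≤ : Dec (0ℚ < X) → X ≤ β r * N * d
        X≤ (yes 0<X) = *-cancelʳ 0<X X²≤
        X≤ (no X≯0)  = ≤-trans (≮⇒≥ X≯0) (0≤* (0≤* (proj₁ budget r) (0≤⟪⟫ u)) (0≤⟪⟫ e))
        go : Dec (0ℚ < d) → a ² ≤ (β r - γ r) * N
        go (yes 0<d) = *-cancelʳ 0<d (≤-by (β r * N * d - X) (≤⇒0≤- (X≤ (0ℚ <? X))) (trans
          (solve 4 (λ β γ N d → (β :- γ) :* N :* d := β :* N :* d :- γ :* d :* N) refl (β r) (γ r) N d)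
          (trans (cong (λ g → β r * N * d - g * N) (γd r))
            (solve 5 (λ a b d N β → β :* N :* d :- b :* b :* N := a :* a :* d :+
                (β :* N :* d :- (a :* a :* d :+ b :* b :* N))) refl a b d N (β r)))))
        go (no d≯0) = subst (λ g → a ² ≤ (β r - g) * N) (sym (γ≡0 r d≯0))
          (≤-trans (proj₂ budget r u (Supp-∖ supp)) (≤-reflexive
              (solve 2 (λ β N → β :* N := (β :- con 0ℚ) :* N) refl (β r) N)))

  -- S holds the live coordinates other than the pivot p, and w acts as the residual of `unit p`
  -- modulo S. It is characterised by these properties instead of being computed, so that it can be
  -- corrected by one vector when S shrinks.
  record Pivot (S : List (Fin n)) (p : Fin n) : Set where
    field
      w     : Fin n → ℚ
      p∉S   : p ∉ S
      w-p   : w p ≡ 1ℚ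
      w-off : ∀ {i} → i ∉ S → i ≢ p → w i ≡ 0ℚ
      w-Orth : Orth S w

    ω : ℚ
    ω = ⟪ w , w ⟫

    ω≤1 : ω ≤ 1ℚ
    ω≤1 = go (0ℚ <? ω)
      where
      ω≡ : ω ≡ ⟪ w , unit p ⟫
      ω≡ = p-q≡0⇒ (trans (sym (trans (⟪⟫-linʳ 1ℚ w (- 1ℚ) (unit p) w)
        (solve 2 (λ a b → con 1ℚ :* a :+ :- con 1ℚ :* b := a :- b) refl ω ⟪ w , unit p ⟫)))
        (w-Orth (lc 1ℚ w (- 1ℚ) (unit p)) supp))
        where
        p-q≡0⇒ : ∀ {a b} → a - b ≡ 0ℚ → a ≡ b
        p-q≡0⇒ {a} {b} eq = trans (solve 2 (λ a b → a := (a :- b) :+ b) refl a b)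
            (trans (cong (_+ b) eq) (+-identityˡ b))
        supp : Supp S (lc 1ℚ w (- 1ℚ) (unit p))
        supp i i∉ with i Fin.≟ p
        ... | yes refl = trans (cong₂ (λ a b → 1ℚ * a + - 1ℚ * b) w-p (unit-≡ p)) refl
        ... | no i≢p = trans (cong₂ (λ a b → 1ℚ * a + - 1ℚ * b) (w-off i∉ i≢p) (unit-≢ (i≢p ∘ sym))) refl
      go : Dec (0ℚ < ω) → ω ≤ 1ℚ
      go (yes 0<ω) = *-cancelʳ 0<ω (≤-trans (≤-reflexive (cong₂ _*_ ω≡ ω≡)) (≤-trans (cauchy-schwarz w (unit p))
        (≤-trans (*-monoˡ (0≤⟪⟫ w) (unit≤1 p)) (≤-reflexive (*-comm ω 1ℚ)))))
      go (no ω≯0) = ≤-trans (≮⇒≥ ω≯0) 0≤1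

    -- The second summand is a reserve that is drawn upon as ω grows towards 1; it pays for the
    -- growth of f r w in `transition`.
    V : (R → ℚ) → R → ℚ
    V β r = (β r + β r) + ½ * ((1ℚ - ω) * f r w ²)

    0≤V : ∀ {β} → (∀ r → 0ℚ ≤ β r) → ∀ r → 0ℚ ≤ V β r
    0≤V 0≤β r = 0≤+ (0≤+ (0≤β r) (0≤β r)) (0≤* (<⇒≤ (positive⁻¹ ½)) (0≤* (≤⇒0≤- ω≤1) (0≤² (f r w))))

    ⁺ ⁻ : (Fin n → ℚ) → ℚ
    ⁺ x = ½ * (1ℚ + x p)
    ⁻ x = ½ * (1ℚ - x p)

    ⁺+⁻ : ∀ x → ⁺ x + ⁻ x ≡ 1ℚ
    ⁺+⁻ x = solve 1 (λ y → con ½ :* (con 1ℚ :+ y) :+ con ½ :* (con 1ℚ :- y) := con 1ℚ) refl (x p)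

    Φ : (Fin n → ℚ) → (R → ℚ) → ℚ
    Φ x β = ∑[ r ← rows ] potential k (⁺ x) (⁻ x) (f r x) (f r w) (V β r)

  Φ₀ : (Fin n → ℚ) → (R → ℚ) → ℚ
  Φ₀ x β = ∑[ r ← rows ] ((f r x ² + 16ℚ * ι k * (β r + β r)) ^ᵠ k)

  module _ {x : Fin n → ℚ} (range : ∀ i → InRange (x i)) where

    0≤½[1+x] : ∀ p → 0ℚ ≤ ½ * (1ℚ + x p)
    0≤½[1+x] p = 0≤* (<⇒≤ (positive⁻¹ ½)) (subst (0ℚ ≤_) (+-comm (x p) 1ℚ) (≤⇒0≤- (proj₁ (range p))))

    0≤½[1-x] : ∀ p → 0ℚ ≤ ½ * (1ℚ - x p)
    0≤½[1-x] p = 0≤* (<⇒≤ (positive⁻¹ ½)) (≤⇒0≤- (proj₂ (range p)))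

    module _ (S : List (Fin n)) {p : Fin n} (p∈S : p ∈ S) {β : R → ℚ} (budget : Budget S β) where
      open Remove S p∈S budget

      newPivot : Pivot (S ∖ p) p
      newPivot = record { w = e ; p∉S = ∉∖-self S p ; w-p = e-j ; w-off = e-off ; w-Orth = e-Orth }

      -- The state without a pivot counts as z = 0 and ω = 0, where both outcomes coincide and the
      -- choice of p is irrelevant. Choosing p is then a `transition` with ρ = f r e.
      newPivot-Φ : Pivot.Φ newPivot x (λ r → β r - γ r) ≤ Φ₀ x β
      newPivot-Φ = ∑-mono rows λ r → ≤-trans
        (potential-drop j₀ {⁺ x} {⁻ x} {f r x} {0ℚ} {f r e} {V = β r + β r} (0≤½[1+x] p) (0≤½[1-x] p) (⁺+⁻ x)
            (sym (+-identityˡ (f r e)))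
          (0≤V (proj₁ budget′) r)
          (≤-trans (transition {0ℚ} {f r e} {0ℚ} {d} {β r} {γ r} (trans (sym (γd r)) (*-comm (γ r) d)) (0≤⟪⟫ e)
              (0≤γ r) ≤-refl 0≤1)
            (≤-reflexive (solve 4 (λ β γ d z →
              ((β :+ β) :+ con ½ :* ((con 1ℚ :- con 0ℚ) :* (con 0ℚ :* con 0ℚ))) :-
                (((β :- γ) :+ (β :- γ)) :+ con ½ :* ((con 1ℚ :- (con 0ℚ :+ d)) :* ((con 0ℚ :+ z) :* (con 0ℚ :+ z))))
              := (β :+ β) :- (((β :- γ) :+ (β :- γ)) :+ con ½ :* ((con 1ℚ :- d) :* (z :* z))))
              refl (β r) (γ r) d (f r e)))))
        (≤-reflexive (potential-0 k {⁺ x} {⁻ x} (f r x) (β r + β r) (⁺+⁻ x)))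
        where open Pivot newPivot

    module _ (S : List (Fin n)) {p j : Fin n} (j∈S : j ∈ S) {β : R → ℚ} (budget : Budget S β)
        (piv : Pivot S p) where
      open Remove S j∈S budget
      open Pivot piv

      private
        t : ℚ
        t = - w j

        p≢j : p ≢ j
        p≢j refl = p∉S j∈S

        w′ : Fin n → ℚ
        w′ = lc 1ℚ w t e

      -- Adding t e with t = - w j cancels the coordinate j of w and preserves orthogonality. It
      -- raises ω by t² d and changes f r w by t (f r e), whose square is t² d times γ r: the
      -- situation of `transition`.
      dropPivot : Pivot (S ∖ j) p
      dropPivot = record
        { w = w′ ; p∉S = ∉∖-⊆ S j p∉S
        ; w-p = trans (cong₂ (λ a b → 1ℚ * a + t * b) w-p (e-off (∉∖-⊆ S j p∉S) p≢j))
            (solve 1 (λ t → con 1ℚ :* con 1ℚ :+ t :* con 0ℚ := con 1ℚ) refl t)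
        ; w-off = off
        ; w-Orth = λ u supp → trans (⟪⟫-linˡ 1ℚ w t e u) (trans
            (cong₂ (λ a b → 1ℚ * a + t * b) (w-Orth u (Supp-∖ supp)) (e-Orth u supp))
            (solve 1 (λ t → con 1ℚ :* con 0ℚ :+ t :* con 0ℚ := con 0ℚ) refl t)) }
        where
        off : ∀ {i} → i ∉ S ∖ j → i ≢ p → w′ i ≡ 0ℚ
        off {i} i∉ i≢p with i Fin.≟ j
        ... | yes refl = trans (cong (λ b → 1ℚ * w j + t * b) e-j)
                (solve 1 (λ a → con 1ℚ :* a :+ :- a :* con 1ℚ := con 0ℚ) refl (w j))
        ... | no i≢j = trans (cong₂ (λ a b → 1ℚ * a + t * b) (w-off (∉∖⁻ S j i∉ i≢j) i≢p) (e-off i∉ i≢j))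
                (solve 1 (λ t → con 1ℚ :* con 0ℚ :+ t :* con 0ℚ := con 0ℚ) refl t)

      dropPivot-Φ : Pivot.Φ dropPivot x (λ r → β r - γ r) ≤ Φ x β
      dropPivot-Φ = ∑-mono rows λ r →
        potential-drop j₀ {⁺ x} {⁻ x} {f r x} {f r w} {t * f r e} {V = V β r} (0≤½[1+x] p) (0≤½[1-x] p) (⁺+⁻ x)
            (f-w′ r)
          (Pivot.0≤V dropPivot (proj₁ budget′) r)
          (≤-trans (transition {f r w} {t * f r e} {ω} {t * t * d} {β r} {γ r}
              (trans (solve 2 (λ t b → (t :* b) :* (t :* b) := t :* t :* (b :* b)) refl t (f r e))
                (trans (cong (t * t *_) (sym (γd r))) (solve 3
                    (λ t g d → t :* t :* (g :* d) := t :* t :* d :* g) refl t (γ r) d)))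
              (0≤* (0≤² t) (0≤⟪⟫ e)) (0≤γ r) (0≤⟪⟫ w) ω≤1)
            (≤-reflexive (cong₂ (λ o z → V β r - (((β r - γ r) + (β r - γ r)) + ½ * ((1ℚ - o) * z ²))) (sym ω′)
                (sym (f-w′ r)))))
        where
        f-w′ : ∀ r → f r w′ ≡ f r w + t * f r e
        f-w′ r = trans (f-lin r 1ℚ w t e) (cong (_+ t * f r e) (*-identityˡ (f r w)))
        ω′ : ⟪ w′ , w′ ⟫ ≡ ω + t * t * d
        ω′ = trans (⟪lc,lc⟫ 1ℚ w t e) (trans (cong (λ o → 1ℚ * 1ℚ * ω + (1ℚ + 1ℚ) * (1ℚ * t * o) + t * t * d)
            (w-Orth e e-Supp))
          (solve 3 (λ o t d → con 1ℚ :* con 1ℚ :* o :+ (con 1ℚ :+ con 1ℚ) :* (con 1ℚ :* t :* con 0ℚ) :+ t :* t :* d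
            := o :+ t :* t :* d) refl ω t d))

  module _ {S : List (Fin n)} {p : Fin n} (piv : Pivot S p) (β : R → ℚ) where
    open Pivot piv

    module _ (x : Fin n → ℚ) where
      hP hQ : R → ℚ
      hP r = ((f r x + (⁻ x + ⁻ x) * f r w) ² + 16ℚ * ι k * V β r) ^ᵠ k
      hQ r = ((f r x - (⁺ x + ⁺ x) * f r w) ² + 16ℚ * ι k * V β r) ^ᵠ k

      -- Along w the two outcomes P and Q do not change, so that Φ is affine.
      Φ-affine : ∀ c → Φ (lc 1ℚ x c w) β ≡ Φ x β + ½ * c * (∑ₗ rows hP - ∑ₗ rows hQ)
      Φ-affine c = trans (∑-cong rows step) (trans (∑-lin rows (⁺ x + ½ * c) hP (⁻ x - ½ * c) hQ) (trans
          (solve 5 (λ a b c P Q → (a :+ c) :* P :+ (b :- c) :* Q := (a :* P :+ b :* Q) :+ c :* (P :- Q))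
            refl (⁺ x) (⁻ x) (½ * c) (∑ₗ rows hP) (∑ₗ rows hQ))
          (cong (_+ ½ * c * (∑ₗ rows hP - ∑ₗ rows hQ)) (sym (∑-lin rows (⁺ x) hP (⁻ x) hQ)))))
        where
        x′ : Fin n → ℚ
        x′ = lc 1ℚ x c w
        x′-p : x′ p ≡ x p + c
        x′-p = trans (cong (λ a → 1ℚ * x p + c * a) w-p)
            (solve 2 (λ x c → con 1ℚ :* x :+ c :* con 1ℚ := x :+ c) refl (x p) c)
        step : ∀ r → potential k (⁺ x′) (⁻ x′) (f r x′) (f r w) (V β r) ≡
            (⁺ x + ½ * c) * hP r + (⁻ x - ½ * c) * hQ r
        step r = cong₂ _+_
          (cong₂ (λ a P → a * (P ² + 16ℚ * ι k * V β r) ^ᵠ k)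
            (trans (cong (λ y → ½ * (1ℚ + y)) x′-p) (solve 2
                (λ x c → con ½ :* (con 1ℚ :+ (x :+ c)) := con ½ :* (con 1ℚ :+ x) :+ con ½ :* c) refl (x p) c))
            (trans (cong₂ (λ D y → D + (½ * (1ℚ - y) + ½ * (1ℚ - y)) * f r w) (f-lin r 1ℚ x c w) x′-p)
              (solve 4 (λ D c z x → (con 1ℚ :* D :+ c :* z) :+
                  (con ½ :* (con 1ℚ :- (x :+ c)) :+ con ½ :* (con 1ℚ :- (x :+ c))) :* z
                := D :+ (con ½ :* (con 1ℚ :- x) :+ con ½ :* (con 1ℚ :- x)) :* z) refl (f r x) c (f r w) (x p))))
          (cong₂ (λ a P → a * (P ² + 16ℚ * ι k * V β r) ^ᵠ k)
            (trans (cong (λ y → ½ * (1ℚ - y)) x′-p) (solve 2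
                (λ x c → con ½ :* (con 1ℚ :- (x :+ c)) := con ½ :* (con 1ℚ :- x) :- con ½ :* c) refl (x p) c))
            (trans (cong₂ (λ D y → D - (½ * (1ℚ + y) + ½ * (1ℚ + y)) * f r w) (f-lin r 1ℚ x c w) x′-p)
              (solve 4 (λ D c z x → (con 1ℚ :* D :+ c :* z) :-
                  (con ½ :* (con 1ℚ :+ (x :+ c)) :+ con ½ :* (con 1ℚ :+ (x :+ c))) :* z
                := D :- (con ½ :* (con 1ℚ :+ x) :+ con ½ :* (con 1ℚ :+ x)) :* z) refl (f r x) c (f r w) (x p))))

    -- At ±1 one outcome has probability 1 and its value is D itself; the reserve in V is given up.
    Φ₀≤Φ : (∀ r → 0ℚ ≤ β r) → ∀ {x} → Hit (x p) → Φ₀ x β ≤ Φ x β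
    Φ₀≤Φ 0≤β {x} hit = ∑-mono rows λ r → ≤-trans (^-mono k (0≤+ (0≤² (f r x)) (0≤* 0≤κ (0≤+ (0≤β r) (0≤β r))))
        (+-monoʳ-≤ (f r x ²) (*-monoˡ 0≤κ (≤-by {β r + β r} (½ * ((1ℚ - ω) * f r w ²))
          (0≤* (<⇒≤ (positive⁻¹ ½)) (0≤* (≤⇒0≤- ω≤1) (0≤² (f r w)))) refl))))
        (≤-reflexive (sym (eq r hit)))
      where
      0≤κ : 0ℚ ≤ 16ℚ * ι k
      0≤κ = 0≤* (0≤ι 16) (0≤ι k)
      eq : ∀ r → Hit (x p) → potential k (⁺ x) (⁻ x) (f r x) (f r w) (V β r) ≡ (f r x ² + 16ℚ * ι k * V β r) ^ᵠ k
      eq r (inj₁ x≡1) = trans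
        (cong₂ (λ a b → potential k a b (f r x) (f r w) (V β r)) (cong (λ y → ½ * (1ℚ + y)) x≡1)
            (cong (λ y → ½ * (1ℚ - y)) x≡1))
        (potential-10 k (f r x) (f r w) (V β r))
      eq r (inj₂ x≡-1) = trans
        (cong₂ (λ a b → potential k a b (f r x) (f r w) (V β r)) (cong (λ y → ½ * (1ℚ + y)) x≡-1)
            (cong (λ y → ½ * (1ℚ - y)) x≡-1))
        (potential-01 k (f r x) (f r w) (V β r))

  Outcome : ℚ → Set
  Outcome Φ = ∃[ x ] (∀ i → Hit (x i)) × ∑[ r ← rows ] ((f r x ²) ^ᵠ k) ≤ Φ

  Outcome-mono : ∀ {Φ Φ′} → Φ ≤ Φ′ → Outcome Φ → Outcome Φ′
  Outcome-mono Φ≤Φ′ (x , hits , le) = x , hits , ≤-trans le Φ≤Φ′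

  -- The two directions ±w are treated together by means of a sign σ; δ₀ is
  -- the step at which the pivot itself reaches the boundary.
  record Direction {S p} (piv : Pivot S p) (β : R → ℚ) (x : Fin n → ℚ) : Set where
    field
      σ δ₀      : ℚ
      0≤δ₀      : 0ℚ ≤ δ₀
      pivot-hit : Hit (x p + δ₀ * (σ * Pivot.w piv p))
      descent   : ∀ δ → 0ℚ ≤ δ → Pivot.Φ piv (lc 1ℚ x (δ * σ) (Pivot.w piv)) β ≤ Pivot.Φ piv x β

  -- By `Φ-affine` the slope of Φ along w is ½ (∑ hP - ∑ hQ), so one of the directions ±w does not
  -- increase Φ. This choice replaces the random step of the walk.
  direction : ∀ {S p} (piv : Pivot S p) β {x} → InRange (x p) → Direction piv β x
  direction {S} {p} piv β {x} (lo , hi) = go (≤-total SP SQ)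
    where
    SP SQ : ℚ
    SP = ∑ₗ rows (hP piv β x)
    SQ = ∑ₗ rows (hQ piv β x)
    go : SP ≤ SQ ⊎ SQ ≤ SP → Direction piv β x
    go (inj₁ P≤Q) = record
      { σ = 1ℚ ; δ₀ = 1ℚ - x p ; 0≤δ₀ = ≤⇒0≤- hi
      ; pivot-hit = inj₁ (trans (cong (λ a → x p + (1ℚ - x p) * (1ℚ * a)) (Pivot.w-p piv))
          (solve 1 (λ x → x :+ (con 1ℚ :- x) :* (con 1ℚ :* con 1ℚ) := con 1ℚ) refl (x p)))
      ; descent = λ δ 0≤δ → ≤-by (½ * δ * (SQ - SP)) (0≤* (0≤* (<⇒≤ (positive⁻¹ ½)) 0≤δ) (≤⇒0≤- P≤Q))
          (trans (solve 4 (λ Φ δ P Q → Φ := (Φ :+ con ½ :* (δ :* con 1ℚ) :* (P :- Q)) :+ con ½ :* δ :*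
              (Q :- P)) refl (Pivot.Φ piv x β) δ SP SQ)
            (cong (_+ ½ * δ * (SQ - SP)) (sym (Φ-affine piv β x (δ * 1ℚ))))) }
    go (inj₂ Q≤P) = record
      { σ = - 1ℚ ; δ₀ = x p - - 1ℚ ; 0≤δ₀ = ≤⇒0≤- lo
      ; pivot-hit = inj₂ (trans (cong (λ a → x p + (x p - - 1ℚ) * (- 1ℚ * a)) (Pivot.w-p piv))
          (solve 1 (λ x → x :+ (x :- con (- 1ℚ)) :* (con (- 1ℚ) :* con 1ℚ) := con (- 1ℚ)) refl (x p)))
      ; descent = λ δ 0≤δ → ≤-by (½ * δ * (SP - SQ)) (0≤* (0≤* (<⇒≤ (positive⁻¹ ½)) 0≤δ) (≤⇒0≤- Q≤P))
          (trans (solve 4 (λ Φ δ P Q → Φ := (Φ :+ con ½ :* (δ :* con (- 1ℚ)) :* (P :- Q)) :+ con ½ :* δ :*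
              (P :- Q)) refl (Pivot.Φ piv x β) δ SP SQ)
            (cong (_+ ½ * δ * (SP - SQ)) (sym (Φ-affine piv β x (δ * - 1ℚ))))) }

  x′≡ : ∀ x δ σ (w : Fin n → ℚ) i → x i + δ * (σ * w i) ≡ lc 1ℚ x (δ * σ) w i
  x′≡ x δ σ w i = solve 4 (λ x δ σ w → x :+ δ :* (σ :* w) := con 1ℚ :* x :+ δ :* σ :* w) refl (x i) δ σ (w i)

  x′-off : ∀ {S p} (piv : Pivot S p) x c {i} → i ∉ S → i ≢ p → x i ≡ lc 1ℚ x c (Pivot.w piv) i
  x′-off piv x c {i} i∉ i≢p = trans (solve 2 (λ x c → x := con 1ℚ :* x :+ c :* con 0ℚ) refl (x i) c)
    (cong (λ a → 1ℚ * x i + c * a) (sym (Pivot.w-off piv i∉ i≢p)))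

  range′ : ∀ {S p} (piv : Pivot S p) {x δ δ₀ σ} → (∀ i → InRange (x i)) → 0ℚ ≤ δ → δ ≤ δ₀ →
    Hit (x p + δ₀ * (σ * Pivot.w piv p)) → (∀ {i} → i ∈ S → InRange (x i + δ * (σ * Pivot.w piv i))) →
    ∀ i → InRange (lc 1ℚ x (δ * σ) (Pivot.w piv) i)
  range′ {S} {p} piv {x} {δ} {δ₀} {σ} range 0≤δ δ≤δ₀ pivot-hit fits i = go (i Fin.≟ p) (i ∈? S)
    where
    go : Dec (i ≡ p) → Dec (i ∈ S) → InRange (lc 1ℚ x (δ * σ) (Pivot.w piv) i)
    go (yes refl) _ = subst InRange (x′≡ x δ σ (Pivot.w piv) p) (shrink (range p) (Hit⇒InRange pivot-hit) 0≤δ δ≤δ₀)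
    go (no _) (yes i∈S) = subst InRange (x′≡ x δ σ (Pivot.w piv) i) (fits i∈S)
    go (no i≢p) (no i∉S) = subst InRange (x′-off piv x (δ * σ) i∉S i≢p) (range i)

  mutual
    -- N bounds the number of coordinates in S and makes the recursion terminate: it drops when a
    -- pivot is taken out of S and when another coordinate freezes. A pivot that reaches the
    -- boundary returns to `walk` at the same N, its removal having been counted already.
    walk : ∀ N S x β → length S ℕ.≤ N → Budget S β → (∀ i → InRange (x i)) → (∀ i → i ∉ S → Hit (x i)) →
           Outcome (Φ₀ x β)
    walk N [] x β _ budget range frozen = x , (λ i → frozen i λ ()) , ∑-mono rows λ r → ^-mono k (0≤² (f r x))
      (≤-by (16ℚ * ι k * (β r + β r)) (0≤* (0≤* (0≤ι 16) (0≤ι k)) (0≤+ (proj₁ budget r) (proj₁ budget r))) refl)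
    walk (suc N) S@(p ∷ _) x β le budget range frozen = Outcome-mono (newPivot-Φ range S p∈S budget)
      (walkPivot N (S ∖ p) p (newPivot range S p∈S budget) x _ (ℕ.≤-pred (ℕ.≤-trans (length-∖ S p∈S) le))
        (Remove.budget′ S p∈S budget) range (λ i i∉ i≢p → frozen i (∉∖⁻ S p i∉ i≢p)))
      where
      p∈S : p ∈ S
      p∈S = here refl

    walkPivot : ∀ N S p (piv : Pivot S p) x β → length S ℕ.≤ N → Budget S β → (∀ i → InRange (x i)) →
                (∀ i → i ∉ S → i ≢ p → Hit (x i)) → Outcome (Pivot.Φ piv x β)
    walkPivot N S p piv x β le budget range frozen = advance N S p piv x β le budget range frozen dir
        (clip x (λ i → Direction.σ dir * Pivot.w piv i) range S (Direction.0≤δ₀ dir))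
      where
      dir : Direction piv β x
      dir = direction piv β (range p)

    advance : ∀ N S p (piv : Pivot S p) x β → length S ℕ.≤ N → Budget S β → (∀ i → InRange (x i)) →
              (∀ i → i ∉ S → i ≢ p → Hit (x i)) → (dir : Direction piv β x) →
              (∃[ δ ] 0ℚ ≤ δ × δ ≤ Direction.δ₀ dir ×
                      (∀ {i} → i ∈ S → InRange (x i + δ * (Direction.σ dir * Pivot.w piv i))) ×
                      (δ ≡ Direction.δ₀ dir ⊎ ∃[ j ] j ∈ S × Hit (x j + δ * (Direction.σ dir * Pivot.w piv j)))) →
              Outcome (Pivot.Φ piv x β)
    advance N S p piv x β le budget range frozen dir (δ , 0≤δ , δ≤δ₀ , fits , inj₁ δ≡δ₀) =
      Outcome-mono (descent δ 0≤δ) (Outcome-mono (Φ₀≤Φ piv β (proj₁ budget) hit-p)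
        (walk N S _ β le budget (range′ piv range 0≤δ δ≤δ₀ pivot-hit fits) frozen″))
      where
      open Direction dir
      open Pivot piv
      hit-p : Hit (lc 1ℚ x (δ * σ) w p)
      hit-p = subst Hit (trans (cong (λ d → x p + d * (σ * w p)) (sym δ≡δ₀)) (x′≡ x δ σ w p)) pivot-hit
      frozen″ : ∀ i → i ∉ S → Hit (lc 1ℚ x (δ * σ) w i)
      frozen″ i i∉ = case i Fin.≟ p of λ where
        (yes refl) → hit-p
        (no i≢p)   → subst Hit (x′-off piv x (δ * σ) i∉ i≢p) (frozen i i∉ i≢p)
    advance zero    S p piv x β le budget range frozen dir (δ , 0≤δ , δ≤δ₀ , fits , inj₂ (j , j∈S , hit)) =
      contradiction (ℕ.≤-trans (length-∖ S j∈S) le) ℕ.n≮0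
    advance (suc N) S p piv x β le budget range frozen dir (δ , 0≤δ , δ≤δ₀ , fits , inj₂ (j , j∈S , hit)) =
      Outcome-mono (descent δ 0≤δ) (Outcome-mono (dropPivot-Φ rng S j∈S budget piv)
        (walkPivot N (S ∖ j) p (dropPivot rng S j∈S budget piv) _ _ (ℕ.≤-pred (ℕ.≤-trans (length-∖ S j∈S) le))
          (Remove.budget′ S j∈S budget) rng frozen″))
      where
      open Direction dir
      open Pivot piv
      rng : ∀ i → InRange (lc 1ℚ x (δ * σ) w i)
      rng = range′ piv range 0≤δ δ≤δ₀ pivot-hit fits
      frozen″ : ∀ i → i ∉ S ∖ j → i ≢ p → Hit (lc 1ℚ x (δ * σ) w i)
      frozen″ i i∉ i≢p = case i Fin.≟ j of λ where
        (yes refl) → subst Hit (x′≡ x δ σ w i) hit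
        (no i≢j)   → subst Hit (x′-off piv x (δ * σ) (∉∖⁻ S j i∉ i≢j) i≢p) (frozen i (∉∖⁻ S j i∉ i≢j) i≢p)

  -- At the origin every D is 0 and every budget 1, so each row starts with (16 k · 2)^k, and at the
  -- end a single row is bounded by the whole sum. For k near the logarithm of the number of rows,
  -- the k-th root of that number is a constant.
  subgaussian-colouring : (∀ r → f r (λ _ → 0ℚ) ≡ 0ℚ) →
    ∃[ x ] (∀ i → Hit (x i)) × (∀ {r} → r ∈ rows → (f r x ²) ^ᵠ k ≤ ι (length rows) * (ι 32 * ι k) ^ᵠ k)
  subgaussian-colouring f-0 = let x , hits , le = outcome in
    x , hits , λ r∈ → ≤-trans (term≤∑ rows (λ r → 0≤^ k (0≤² (f r x))) r∈) (≤-trans le (≤-reflexive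
      (trans (∑-cong rows λ r → cong (_^ᵠ k) (trans (cong (λ D → D ² + 16ℚ * ι k * (1ℚ + 1ℚ)) (f-0 r))
        (solve 1 (λ K → con 0ℚ :* con 0ℚ :+ con 16ℚ :* K :* (con 1ℚ :+ con 1ℚ) := con (ι 32) :* K) refl (ι k))))
        (∑-const rows ((ι 32 * ι k) ^ᵠ k)))))
    where
    outcome : Outcome (Φ₀ (λ _ → 0ℚ) (λ _ → 1ℚ))
    outcome = walk (length (allFin n)) (allFin n) (λ _ → 0ℚ) (λ _ → 1ℚ) ℕ.≤-refl
      ((λ _ → 0≤1) , λ r u _ → ≤-trans (f-bound r u) (≤-reflexive (sym (*-identityˡ ⟪ u , u ⟫))))
      (λ _ → <⇒≤ (negative⁻¹ (- 1ℚ)) , 0≤1) (λ i i∉ → contradiction (∈-allFin i) i∉)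

-- Approachability

infix 8 _⁺

_⁺ : ℚ → ℚ
a ⁺ with 0ℚ ≤? a
... | yes _ = a
... | no  _ = 0ℚ

0≤⁺ : ∀ a → 0ℚ ≤ a ⁺
0≤⁺ a with 0ℚ ≤? a
... | yes 0≤a = 0≤a
... | no  _   = ≤-refl

≤⁺ : ∀ a → a ≤ a ⁺
≤⁺ a with 0ℚ ≤? a
... | yes 0≤a = ≤-refl
... | no  0≰a = <⇒≤ (≰⇒> 0≰a)

⁺*⁺ : ∀ a → a ⁺ * a ≡ a ⁺ * a ⁺
⁺*⁺ a with 0ℚ ≤? a
... | yes _ = refl
... | no  _ = *-zeroˡ a

⁺-+-² : ∀ a t → (a + t) ⁺ ² ≤ (a ⁺ + t) ²
⁺-+-² a t with 0ℚ ≤? a + t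
... | yes 0≤a+t = ²-mono 0≤a+t (+-monoˡ-≤ t (≤⁺ a))
... | no  _     = 0≤² (a ⁺ + t)

-- Blackwell's argument: answering the weights (z - κ)⁺ + η and averaging decreases
-- the squared distance of the current point to the box [0, κ]ᴵ.
module Approachability {S I : Set} (xs : List I) (complete : ∀ i → i ∈ xs)
  (z : S → I → ℚ) (0≤z : ∀ s i → 0ℚ ≤ z s i)
  (mix : ∀ τ s s′ → 0ℚ ≤ τ → τ ≤ 1ℚ → ∃[ s″ ] (∀ i → z s″ i ≡ (1ℚ - τ) * z s i + τ * z s′ i))
  (κ : ℚ) (0<κ : 0ℚ < κ)
  (respond : ∀ (w : I → ℚ) → (∀ i → 0ℚ < w i) → ∃[ s ] ∑[ i ← xs ] (w i * z s i) ≤ κ * ∑ₗ xs w) where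

  open +-*-Solver

  private
    N M η : ℚ
    N = ι (length xs)
    M = ι (suc (length xs))
    η = κ * inv (ι 4 * M)
    0≤N : 0ℚ ≤ N
    0≤N = 0≤ι (length xs)
    0≤κ : 0ℚ ≤ κ
    0≤κ = <⇒≤ 0<κ
    0<4M : 0ℚ < ι 4 * M
    0<4M = 0<× (0<ι 3) (0<ι (length xs))
    0<η : 0ℚ < η
    0<η = 0<× 0<κ (0<inv 0<4M)
    4Nη≤κ : ι 4 * N * η ≤ κ
    4Nη≤κ = ≤-trans (*-monoʳ (<⇒≤ 0<η) (*-monoˡ (0≤ι 4)
        (ι-mono-≤ {length xs} {suc (length xs)} (ℕ.n≤1+n (length xs)))))
      (≤-reflexive (trans (*-comm (ι 4 * M) η) (*-inv-cancel λ eq → ⊥-elim (0<⇒≢0 0<4M eq))))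

    y⁺ : S → I → ℚ
    y⁺ s i = (z s i - κ) ⁺

    Φ : S → ℚ
    Φ s = ∑[ i ← xs ] (y⁺ s i ²)

    module Step (Φ₀ : ℚ) (0≤Φ₀ : 0ℚ ≤ Φ₀) where
      Z R τ ε : ℚ
      -- Z bounds the coordinates of a response, because η z′ ≤ κ ∑ w. R then bounds ∑ Δ², and its
      -- last summand κ² gives τ ≤ 1. The change of Φ is at most - τ κ² + τ² R; τ is the minimiser
      -- and - ε the minimum.
      Z = κ * (N + Φ₀ + N * η) * inv η
      R = N * Z ² + (1ℚ + 1ℚ) * (N * κ ² + Φ₀) + κ ²
      τ = κ ² * inv (R + R)
      ε = ½ * (τ * κ ²)

      0<κ² : 0ℚ < κ ²
      0<κ² = 0<× 0<κ 0<κ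
      0≤rest : 0ℚ ≤ N * Z ² + (1ℚ + 1ℚ) * (N * κ ² + Φ₀)
      0≤rest = 0≤+ (0≤* 0≤N (0≤² Z)) (0≤* (<⇒≤ (positive⁻¹ (1ℚ + 1ℚ))) (0≤+ (0≤* 0≤N (0≤² κ)) 0≤Φ₀))
      κ²≤R : κ ² ≤ R
      κ²≤R = ≤-by (N * Z ² + (1ℚ + 1ℚ) * (N * κ ² + Φ₀)) 0≤rest (+-comm _ (κ ²))
      0<R : 0ℚ < R
      0<R = <-≤-trans 0<κ² κ²≤R
      0<2R : 0ℚ < R + R
      0<2R = +-mono-< 0<R 0<R
      0<τ : 0ℚ < τ
      0<τ = 0<× 0<κ² (0<inv 0<2R)
      τ*2R : τ * (R + R) ≡ κ ²
      τ*2R = *-inv-cancel λ eq → ⊥-elim (0<⇒≢0 0<2R eq)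
      τ≤1 : τ ≤ 1ℚ
      τ≤1 = *-cancelʳ 0<2R (subst₂ _≤_ (sym τ*2R) (sym (*-identityˡ (R + R))) (≤-by (R + (R - κ ²))
        (0≤+ (<⇒≤ 0<R) (≤⇒0≤- κ²≤R)) (solve 2 (λ R k → R :+ R := k :+ (R :+ (R :- k))) refl R (κ ²))))
      0<ε : 0ℚ < ε
      0<ε = 0<× (positive⁻¹ ½) (0<× 0<τ 0<κ²)

      step : ∀ s → Φ s ≤ Φ₀ → κ ² ≤ Φ s → ∃[ s′ ] Φ s′ ≤ Φ s - ε
      step s Φ≤Φ₀ κ²≤Φ = finish (respond w 0<w)
        where
        w : I → ℚ
        w i = y⁺ s i + η
        0<w : ∀ i → 0ℚ < w i
        0<w i = +-mono-≤-< (0≤⁺ (z s i - κ)) 0<η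
        Y : ℚ
        Y = ∑ₗ xs (y⁺ s)
        ∑w : ∑ₗ xs w ≡ Y + N * η
        ∑w = trans (∑-+ xs (y⁺ s) (λ _ → η)) (cong (Y +_) (∑-const xs η))
        Y≤ : Y ≤ N + Φ₀
        Y≤ = ≤-trans (∑-mono xs {g = λ i → 1ℚ + y⁺ s i ²} λ i →
            ≤-by (½ * ((y⁺ s i - 1ℚ) ² + (1ℚ + y⁺ s i ²)))
                (0≤* (<⇒≤ (positive⁻¹ ½)) (0≤+ (0≤² (y⁺ s i - 1ℚ)) (0≤+ 0≤1 (0≤² (y⁺ s i)))))
            (solve 1 (λ y → con 1ℚ :+ y :* y := y :+ con ½ :*
                ((y :- con 1ℚ) :* (y :- con 1ℚ) :+ (con 1ℚ :+ y :* y))) refl (y⁺ s i)))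
          (≤-trans (≤-reflexive (trans (∑-+ xs (λ _ → 1ℚ) (λ i → y⁺ s i ²))
              (cong (_+ Φ s) (trans (∑-const xs 1ℚ) (*-identityʳ N)))))
            (+-monoʳ-≤ N Φ≤Φ₀))

        finish : ∃[ s′ ] ∑[ i ← xs ] (w i * z s′ i) ≤ κ * ∑ₗ xs w → ∃[ s″ ] Φ s″ ≤ Φ s - ε
        finish (s′ , wz′≤) = combine (mix τ s s′ (<⇒≤ 0<τ) τ≤1)
          where
          Δ : I → ℚ
          Δ i = z s′ i - z s i
          C Q : ℚ
          C = ∑[ i ← xs ] (y⁺ s i * Δ i)
          Q = ∑[ i ← xs ] (Δ i ²)

          -- Pairing y⁺ with z gives Φ + κ Y, with z′ at most κ (Y + N η); the difference is at most
          -- κ N η - Φ ≤ ¼ κ² - κ².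
          C≤ : C ≤ - (½ * κ ²)
          C≤ = begin
            C ≡⟨ ∑-cong xs (λ i → solve 3 (λ y a b → y :* (a :- b) := con 1ℚ :* (y :* a) :+ con (- 1ℚ) :*
                (y :* b)) refl (y⁺ s i) (z s′ i) (z s i)) ⟩
            ∑[ i ← xs ] (1ℚ * (y⁺ s i * z s′ i) + - 1ℚ * (y⁺ s i * z s i))
              ≡⟨ ∑-lin xs 1ℚ (λ i → y⁺ s i * z s′ i) (- 1ℚ) (λ i → y⁺ s i * z s i) ⟩
            1ℚ * yz′ + - 1ℚ * ∑[ i ← xs ] (y⁺ s i * z s i)
              ≡⟨ cong (λ a → 1ℚ * yz′ + - 1ℚ * a) yz ⟩
            1ℚ * yz′ + - 1ℚ * (Φ s + κ * Y)
              ≤⟨ +-monoˡ-≤ (- 1ℚ * (Φ s + κ * Y)) (*-monoˡ 0≤1 yz′≤) ⟩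
            1ℚ * (κ * (Y + N * η)) + - 1ℚ * (Φ s + κ * Y)
              ≤⟨ ≤-by ((Φ s - κ ²) + ½ * ½ * (κ * (κ - ι 4 * N * η)) + ½ * ½ * κ ²)
                   (0≤+ (0≤+ (≤⇒0≤- κ²≤Φ) (0≤* (<⇒≤ (positive⁻¹ (½ * ½))) (0≤* 0≤κ (≤⇒0≤- 4Nη≤κ))))
                       (0≤* (<⇒≤ (positive⁻¹ (½ * ½))) (0≤² κ)))
                   (solve 5 (λ κ Y N η Φ → :- (con ½ :* (κ :* κ)) :=
                       (con 1ℚ :* (κ :* (Y :+ N :* η)) :+ con (- 1ℚ) :* (Φ :+ κ :* Y)) :+
                      ((Φ :- κ :* κ) :+ con ½ :* con ½ :* (κ :* (κ :- con (ι 4) :* N :* η)) :+ con ½ :* con ½ :*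
                          (κ :* κ)))
                      refl κ Y N η (Φ s)) ⟩
            - (½ * κ ²) ∎
            where
            open ≤-Reasoning
            yz′ : ℚ
            yz′ = ∑[ i ← xs ] (y⁺ s i * z s′ i)
            yz′≤ : yz′ ≤ κ * (Y + N * η)
            yz′≤ = ≤-trans (∑-mono xs λ i → *-monoʳ (0≤z s′ i) (≤-by {y⁺ s i} {w i} η (<⇒≤ 0<η) refl))
              (≤-trans wz′≤ (≤-reflexive (cong (κ *_) ∑w)))
            yz : ∑[ i ← xs ] (y⁺ s i * z s i) ≡ Φ s + κ * Y
            yz = trans (∑-cong xs λ i → trans (solve 3 (λ y z κ → y :* z := y :* (z :- κ) :+ κ :* y) refl
                (y⁺ s i) (z s i) κ)
                (cong (_+ κ * y⁺ s i) (⁺*⁺ (z s i - κ))))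
              (trans (∑-+ xs (λ i → y⁺ s i ²) (λ i → κ * y⁺ s i)) (cong (Φ s +_) (∑-*ˡ xs κ (y⁺ s))))

          z′≤Z : ∀ i → z s′ i ≤ Z
          z′≤Z i = *-cancelʳ 0<η (subst (z s′ i * η ≤_) (sym (*-inv-cancel λ eq → ⊥-elim (0<⇒≢0 0<η eq))) (begin
            z s′ i * η   ≡⟨ *-comm (z s′ i) η ⟩
            η * z s′ i   ≤⟨ *-monoʳ (0≤z s′ i) (≤-by {η} {w i} (y⁺ s i) (0≤⁺ (z s i - κ)) (+-comm (y⁺ s i) η)) ⟩
            w i * z s′ i ≤⟨ term≤∑ xs (λ i → 0≤* (<⇒≤ (0<w i)) (0≤z s′ i)) (complete i) ⟩
            ∑[ i ← xs ] (w i * z s′ i) ≤⟨ wz′≤ ⟩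
            κ * ∑ₗ xs w  ≡⟨ cong (κ *_) ∑w ⟩
            κ * (Y + N * η) ≤⟨ *-monoˡ 0≤κ (+-monoˡ-≤ (N * η) Y≤) ⟩
            κ * (N + Φ₀ + N * η) ∎))
            where open ≤-Reasoning

          Q≤R : Q ≤ R
          Q≤R = begin
            Q ≤⟨ ∑-mono xs (λ i → Δ²≤ i) ⟩
            ∑[ i ← xs ] (Z ² + (1ℚ + 1ℚ) * (κ ² + y⁺ s i ²))
              ≡⟨ ∑-+ xs (λ _ → Z ²) (λ i → (1ℚ + 1ℚ) * (κ ² + y⁺ s i ²)) ⟩
            ∑[ i ← xs ] (Z ²) + ∑[ i ← xs ] ((1ℚ + 1ℚ) * (κ ² + y⁺ s i ²))
              ≡⟨ cong₂ _+_ (∑-const xs (Z ²)) (trans (∑-*ˡ xs (1ℚ + 1ℚ) (λ i → κ ² + y⁺ s i ²)) (cong ((1ℚ + 1ℚ) *_)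
                   (trans (∑-+ xs (λ _ → κ ²) (λ i → y⁺ s i ²)) (cong (_+ Φ s) (∑-const xs (κ ²)))))) ⟩
            N * Z ² + (1ℚ + 1ℚ) * (N * κ ² + Φ s)
              ≤⟨ +-monoʳ-≤ (N * Z ²) (*-monoˡ (<⇒≤ (positive⁻¹ (1ℚ + 1ℚ))) (+-monoʳ-≤ (N * κ ²) Φ≤Φ₀)) ⟩
            N * Z ² + (1ℚ + 1ℚ) * (N * κ ² + Φ₀) ≤⟨ ≤-by (κ ²) (0≤² κ) refl ⟩
            R ∎
            where
            open ≤-Reasoning
            Δ²≤ : ∀ i → Δ i ² ≤ Z ² + (1ℚ + 1ℚ) * (κ ² + y⁺ s i ²)
            Δ²≤ i = ≤-trans (≤-by ((1ℚ + 1ℚ) * (z s′ i * z s i))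
                (0≤* (<⇒≤ (positive⁻¹ (1ℚ + 1ℚ))) (0≤* (0≤z s′ i) (0≤z s i)))
                (solve 2 (λ a b → a :* a :+ b :* b := (a :- b) :* (a :- b) :+ (con 1ℚ :+ con 1ℚ) :*
                    (a :* b)) refl (z s′ i) (z s i)))
              (+-mono-≤ (²-mono (0≤z s′ i) (z′≤Z i)) (≤-trans (²-mono (0≤z s i) z≤)
                (≤-by ((κ - y⁺ s i) ²) (0≤² (κ - y⁺ s i))
                  (solve 2 (λ κ y → (con 1ℚ :+ con 1ℚ) :* (κ :* κ :+ y :* y) := (κ :+ y) :* (κ :+ y) :+
                      (κ :- y) :* (κ :- y)) refl κ (y⁺ s i)))))
              where
              z≤ : z s i ≤ κ + y⁺ s i
              z≤ = ≤-trans (≤-reflexive (solve 2 (λ z κ → z := κ :+ (z :- κ)) refl (z s i) κ))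
                  (+-monoʳ-≤ κ (≤⁺ (z s i - κ)))

          combine : ∃[ s″ ] (∀ i → z s″ i ≡ (1ℚ - τ) * z s i + τ * z s′ i) → ∃[ s″ ] Φ s″ ≤ Φ s - ε
          combine (s″ , eq) = s″ , (begin
            Φ s″ ≤⟨ ∑-mono xs (λ i → ≤-trans (≤-reflexive (cong (λ a → a ⁺ ²) (trans (cong (_- κ) (eq i))
                      (solve 4 (λ t a b κ → (con 1ℚ :- t) :* a :+ t :* b :- κ := (a :- κ) :+ t :*
                          (b :- a)) refl τ (z s i) (z s′ i) κ))))
                      (⁺-+-² (z s i - κ) (τ * Δ i))) ⟩
            ∑[ i ← xs ] ((y⁺ s i + τ * Δ i) ²)
              ≡⟨ ∑-cong xs (λ i → solve 3 (λ y t d → (y :+ t :* d) :* (y :+ t :* d) := con 1ℚ :*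
                  (y :* y) :+ t :* (con (ι 2) :* (y :* d) :+ t :* (d :* d))) refl (y⁺ s i) τ (Δ i)) ⟩
            ∑[ i ← xs ] (1ℚ * (y⁺ s i ²) + τ * (ι 2 * (y⁺ s i * Δ i) + τ * Δ i ²))
              ≡⟨ ∑-lin xs 1ℚ (λ i → y⁺ s i ²) τ (λ i → ι 2 * (y⁺ s i * Δ i) + τ * Δ i ²) ⟩
            1ℚ * Φ s + τ * ∑[ i ← xs ] (ι 2 * (y⁺ s i * Δ i) + τ * Δ i ²)
              ≡⟨ cong (λ a → 1ℚ * Φ s + τ * a) (∑-lin xs (ι 2) (λ i → y⁺ s i * Δ i) τ (λ i → Δ i ²)) ⟩
            1ℚ * Φ s + τ * (ι 2 * C + τ * Q)
              ≤⟨ +-monoʳ-≤ (1ℚ * Φ s) (*-monoˡ (<⇒≤ 0<τ) (+-mono-≤ (*-monoˡ (0≤ι 2) C≤) (*-monoˡ (<⇒≤ 0<τ) Q≤R))) ⟩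
            1ℚ * Φ s + τ * (ι 2 * - (½ * κ ²) + τ * R)
              ≡⟨ solve 4 (λ Φ t k R → con 1ℚ :* Φ :+ t :* (con (ι 2) :* :- (con ½ :* k) :+ t :* R)
                   := Φ :- t :* k :+ con ½ :* t :* (t :* (R :+ R))) refl (Φ s) τ (κ ²) R ⟩
            Φ s - τ * κ ² + ½ * τ * (τ * (R + R))  ≡⟨ cong (λ a → Φ s - τ * κ ² + ½ * τ * a) τ*2R ⟩
            Φ s - τ * κ ² + ½ * τ * κ ²
              ≡⟨ solve 3 (λ Φ t k → Φ :- t :* k :+ con ½ :* t :* k := Φ :- con ½ :* (t :* k)) refl (Φ s) τ (κ ²) ⟩
            Φ s - ε ∎)
            where open ≤-Reasoning

      iterate : ∀ m s → Φ s ≤ Φ₀ → Φ s ≤ m · ε + κ ² → ∃[ s′ ] Φ s′ ≤ κ ²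
      iterate zero    s _    le = s , subst (Φ s ≤_) (+-identityˡ (κ ²)) le
      iterate (suc m) s Φ≤Φ₀ le = go (κ ² ≤? Φ s)
        where
        go : Dec (κ ² ≤ Φ s) → ∃[ s′ ] Φ s′ ≤ κ ²
        go (no κ²≰Φ)  = s , <⇒≤ (≰⇒> κ²≰Φ)
        go (yes κ²≤Φ) = let s′ , Φ′≤ = step s Φ≤Φ₀ κ²≤Φ in iterate m s′
          (≤-trans Φ′≤ (≤-trans (≤-by ε (<⇒≤ 0<ε) (solve 2 (λ a b → a := (a :- b) :+ b) refl (Φ s) ε)) Φ≤Φ₀))
          (≤-trans Φ′≤ (≤-trans (+-monoˡ-≤ (- ε) le)
            (≤-reflexive (solve 3 (λ e m k → ((e :+ m) :+ k) :- e := m :+ k) refl ε (m · ε) (κ ²)))))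

  -- It suffices to come within distance κ of the box, which takes finitely many steps of fixed gain
  -- ε and needs no limit point. The price is the factor 2.
  approach : ∃[ s ] (∀ i → z s i ≤ κ + κ)
  approach = let s , Φ≤κ² = near in s , λ i → ≤-trans
      (≤-reflexive (solve 2 (λ z κ → z := (z :- κ) :+ κ) refl (z s i) κ))
      (+-monoˡ-≤ κ (≤-trans (≤⁺ (z s i - κ)) (²-cancel 0≤κ
        (≤-trans (term≤∑ xs (λ i → 0≤² (y⁺ s i)) (complete i)) Φ≤κ²))))
    where
    s₀ : S
    s₀ = proj₁ (respond (λ _ → 1ℚ) (λ _ → positive⁻¹ 1ℚ))
    open Step (Φ s₀) (0≤∑ xs λ i → 0≤² (y⁺ s₀ i))
    near : ∃[ s ] Φ s ≤ κ ²
    near = let m , lt = archimedean (Φ s₀) ε 0<ε in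
      iterate m s₀ ≤-refl (≤-trans (<⇒≤ lt) (≤-by (κ ²) (0≤² κ) refl))

-- The length of greedy Gram–Schmidt sequences

∑² : ∀ k → (Vec Bool k → ℕ) → ℕ
∑² zero    g = g []
∑² (suc k) g = ∑² k (λ J → g (false ∷ J)) ℕ.+ ∑² k (λ J → g (true ∷ J))

∑³ : ∀ k → (Vec ℚ k → ℕ) → ℕ
∑³ zero    g = g []
∑³ (suc k) g = ∑³ k (λ x → g (0ℚ ∷ x)) ℕ.+ (∑³ k (λ x → g (1ℚ ∷ x)) ℕ.+ ∑³ k (λ x → g (- 1ℚ ∷ x)))

data Colours : ∀ {k} → Vec Bool k → Vec ℚ k → Set where
  []  : Colours [] []
  out : ∀ {k J x} → Colours {k} J x → Colours (false ∷ J) (0ℚ ∷ x)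
  pos : ∀ {k J x} → Colours {k} J x → Colours (true ∷ J) (1ℚ ∷ x)
  neg : ∀ {k J x} → Colours {k} J x → Colours (true ∷ J) (- 1ℚ ∷ x)

∑³-+ : ∀ k g h → ∑³ k (λ x → g x ℕ.+ h x) ≡ ∑³ k g ℕ.+ ∑³ k h
∑³-+ zero    g h = refl
∑³-+ (suc k) g h = trans (cong₂ ℕ._+_ (∑³-+ k _ _) (cong₂ ℕ._+_ (∑³-+ k _ _) (∑³-+ k _ _)))
  (solve 6 (λ a b c d e f → (a :+ b) :+ ((c :+ d) :+ (e :+ f)) := (a :+ (c :+ e)) :+ (b :+ (d :+ f))) refl
    (∑³ k (λ x → g (0ℚ ∷ x))) (∑³ k (λ x → h (0ℚ ∷ x))) (∑³ k (λ x → g (1ℚ ∷ x))) (∑³ k (λ x → h (1ℚ ∷ x)))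
    (∑³ k (λ x → g (- 1ℚ ∷ x))) (∑³ k (λ x → h (- 1ℚ ∷ x))))
  where open ℕ-Solver

-- The colourings of distinct subsets J are distinct, having different supports.
∑²≤∑³ : ∀ k (g : Vec ℚ k → ℕ) (h : Vec Bool k → ℕ) →
        (∀ J → ∃[ x ] Colours J x × h J ℕ.≤ g x) → ∑² k h ℕ.≤ ∑³ k g
∑²≤∑³ zero    g h col with col []
... | [] , [] , le = le
∑²≤∑³ (suc k) g h col = ℕ.+-mono-≤
  (∑²≤∑³ k (λ x → g (0ℚ ∷ x)) (λ J → h (false ∷ J)) λ J → outs J (col (false ∷ J)))
  (ℕ.≤-trans (∑²≤∑³ k (λ x → g (1ℚ ∷ x) ℕ.+ g (- 1ℚ ∷ x)) (λ J → h (true ∷ J)) λ J → ins J (col (true ∷ J)))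
    (ℕ.≤-reflexive (∑³-+ k (λ x → g (1ℚ ∷ x)) (λ x → g (- 1ℚ ∷ x)))))
  where
  outs : ∀ J → ∃[ x ] Colours (false ∷ J) x × h (false ∷ J) ℕ.≤ g x → ∃[ x ] Colours J x × h (false ∷ J) ℕ.≤
      g (0ℚ ∷ x)
  outs J (_ , out c , le) = _ , c , le
  ins : ∀ J → ∃[ x ] Colours (true ∷ J) x × h (true ∷ J) ℕ.≤ g x →
        ∃[ x ] Colours J x × h (true ∷ J) ℕ.≤ g (1ℚ ∷ x) ℕ.+ g (- 1ℚ ∷ x)
  ins J (_ , pos c , le) = _ , c , ℕ.≤-trans le (ℕ.m≤m+n _ _)
  ins J (_ , neg c , le) = _ , c , ℕ.≤-trans le (ℕ.m≤n+m _ _)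

∑²-const : ∀ k c → ∑² k (λ _ → c) ≡ 2 ℕ.^ k ℕ.* c
∑²-const zero    c = sym (ℕ.+-identityʳ c)
∑²-const (suc k) c = trans (cong₂ ℕ._+_ (∑²-const k c) (∑²-const k c))
  (solve 2 (λ p c → p :* c :+ p :* c := (con 2 :* p) :* c) refl (2 ℕ.^ k) c)
  where open ℕ-Solver

∑³-*ˡ : ∀ k s g → ∑³ k (λ x → s ℕ.* g x) ≡ s ℕ.* ∑³ k g
∑³-*ˡ zero    s g = refl
∑³-*ˡ (suc k) s g = trans (cong₂ ℕ._+_ (∑³-*ˡ k s _) (cong₂ ℕ._+_ (∑³-*ˡ k s _) (∑³-*ˡ k s _)))
  (solve 4 (λ s a b c → s :* a :+ (s :* b :+ s :* c) := s :* (a :+ (b :+ c))) refl s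
    (∑³ k (λ x → g (0ℚ ∷ x))) (∑³ k (λ x → g (1ℚ ∷ x))) (∑³ k (λ x → g (- 1ℚ ∷ x))))
  where open ℕ-Solver

-- For d ≥ 0 this is |s / d| < ½: along a basis vector of squared norm d, a vector with inner
-- product s has a coordinate below ½.
Near : ℚ → ℚ → Set
Near s d = ι 4 * s ² < d ²

near? : ∀ s d → Dec (Near s d)
near? s d = ι 4 * s ² <? d ²

-- A generating function for the number of far coordinates: since at most one of three values is
-- near, each position contributes a factor at most 8 + 1 + 1 to the sum over all patterns.
weight : ∀ {A : Set} → Dec A → ℕ
weight (yes _) = 8
weight (no  _) = 1

far : ∀ {A : Set} → Dec A → ℕ
far (yes _) = 0
far (no  _) = 1

-- The two inner products differ by (a - b) d, but two near ones differ by less than d; the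
-- certificate is the parallelogram identity.
near-unique : ∀ s d a b → 1ℚ ≤ (a - b) ² → Near (s + a * d) d → Near (s + b * d) d → ⊥
near-unique s d a b 1≤ na nb = <⇒≱ (+-mono-< na nb) (≤-by
    ((1ℚ + 1ℚ) * ((s + a * d) + (s + b * d)) ² + (1ℚ + 1ℚ) * (((a - b) ² - 1ℚ) * d ²))
    (0≤+ (0≤* (<⇒≤ (positive⁻¹ (1ℚ + 1ℚ))) (0≤² ((s + a * d) + (s + b * d))))
        (0≤* (<⇒≤ (positive⁻¹ (1ℚ + 1ℚ))) (0≤* (≤⇒0≤- 1≤) (0≤² d))))
    (solve 4 (λ s d a b → con (ι 4) :* ((s :+ a :* d) :* (s :+ a :* d)) :+ con (ι 4) :*
        ((s :+ b :* d) :* (s :+ b :* d))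
      := (d :* d :+ d :* d) :+ ((con 1ℚ :+ con 1ℚ) :* (((s :+ a :* d) :+ (s :+ b :* d)) :*
          ((s :+ a :* d) :+ (s :+ b :* d)))
         :+ (con 1ℚ :+ con 1ℚ) :* (((a :- b) :* (a :- b) :- con 1ℚ) :* (d :* d)))) refl s d a b))
  where open +-*-Solver

weights≤10 : ∀ s d (n₀ : Dec (Near (s + 0ℚ * d) d)) (n₁ : Dec (Near (s + 1ℚ * d) d))
    (n₂ : Dec (Near (s + - 1ℚ * d) d)) →
             weight n₀ ℕ.+ (weight n₁ ℕ.+ weight n₂) ℕ.≤ 10
weights≤10 s d (yes p) (yes q) _ = ⊥-elim (near-unique s d 0ℚ 1ℚ ≤-refl p q)
weights≤10 s d (yes p) _ (yes q) = ⊥-elim (near-unique s d 0ℚ (- 1ℚ) ≤-refl p q)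
weights≤10 s d _ (yes p) (yes q) = ⊥-elim (near-unique s d 1ℚ (- 1ℚ) (ι-mono-≤ {1} {4} (ℕ.s≤s ℕ.z≤n)) p q)
weights≤10 s d (yes _) (no _) (no _) = ℕ.≤-refl
weights≤10 s d (no _) (yes _) (no _) = ℕ.≤-refl
weights≤10 s d (no _) (no _) (yes _) = ℕ.≤-refl
weights≤10 s d (no _) (no _) (no _) = ℕ.s≤s (ℕ.s≤s (ℕ.s≤s ℕ.z≤n))

private
  *-distribʳ-+₃ : ∀ a b c p → a ℕ.* p ℕ.+ (b ℕ.* p ℕ.+ c ℕ.* p) ≡ (a ℕ.+ (b ℕ.+ c)) ℕ.* p
  *-distribʳ-+₃ = solve 4 (λ a b c p → a :* p :+ (b :* p :+ c :* p) := (a :+ (b :+ c)) :* p) refl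
    where open ℕ-Solver

  ^-distribʳ-* : ∀ k a b → (a ℕ.* b) ℕ.^ k ≡ a ℕ.^ k ℕ.* b ℕ.^ k
  ^-distribʳ-* zero    a b = refl
  ^-distribʳ-* (suc k) a b = trans (cong (a ℕ.* b ℕ.*_) (^-distribʳ-* k a b))
    (solve 4 (λ a b c d → (a :* b) :* (c :* d) := (a :* c) :* (b :* d)) refl a b (a ℕ.^ k) (b ℕ.^ k))
    where open ℕ-Solver

  1a*8b : ∀ a b → 1 ℕ.* a ℕ.* (8 ℕ.* b) ≡ 8 ℕ.* (a ℕ.* b)
  1a*8b = solve 2 (λ a b → (con 1 :* a) :* (con 8 :* b) := con 8 :* (a :* b)) refl
    where open ℕ-Solver

module GreedyLength {X I : Set} (𝔽 : Form X) (col : I → X → ℚ) where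
  open Form 𝔽
  open Residual 𝔽 col
  open +-*-Solver

  combination : ∀ (L : List I) → (X → ℚ) → Vec ℚ (length L) → X → ℚ
  combination []      y []      = y
  combination (j ∷ L) y (a ∷ x) = combination L (lc 1ℚ y a (col j)) x

  private
    module Head (j : I) (L : List I) (y : X → ℚ) where
      e : X → ℚ
      e = res L (col j)
      d s : ℚ
      d = ⟪ e , e ⟫
      s = ⟪ y , e ⟫

  -- The head of L, the newest basis vector, is decided first. Its e is orthogonal to all columns of
  -- the tail, so the later choices cannot change the inner product s + a d.
  wt : ∀ (L : List I) → (X → ℚ) → Vec ℚ (length L) → ℕ
  wt []      y []      = 1
  wt (j ∷ L) y (a ∷ x) = weight (near? (s + a * d) d) ℕ.* wt L (lc 1ℚ y a (col j)) x
    where open Head j L y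

  #far : ∀ (L : List I) → (X → ℚ) → Vec ℚ (length L) → ℕ
  #far []      y []      = 0
  #far (j ∷ L) y (a ∷ x) = far (near? (s + a * d) d) ℕ.+ #far L (lc 1ℚ y a (col j)) x
    where open Head j L y

  ∑³-wt : ∀ L y → ∑³ (length L) (wt L y) ℕ.≤ 10 ℕ.^ length L
  ∑³-wt []      y = ℕ.≤-refl
  ∑³-wt (j ∷ L) y = ℕ.≤-trans (ℕ.+-mono-≤ (part 0ℚ) (ℕ.+-mono-≤ (part 1ℚ) (part (- 1ℚ))))
    (ℕ.≤-trans (ℕ.≤-reflexive (*-distribʳ-+₃ (v 0ℚ) (v 1ℚ) (v (- 1ℚ)) (10 ℕ.^ length L)))
      (ℕ.*-monoˡ-≤ (10 ℕ.^ length L) (weights≤10 s d (near? (s + 0ℚ * d) d) (near? (s + 1ℚ * d) d)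
          (near? (s + - 1ℚ * d) d))))
    where
    open Head j L y
    v : ℚ → ℕ
    v a = weight (near? (s + a * d) d)
    part : ∀ a → ∑³ (length L) (λ x → wt (j ∷ L) y (a ∷ x)) ℕ.≤ v a ℕ.* 10 ℕ.^ length L
    part a = ℕ.≤-trans (ℕ.≤-reflexive (∑³-*ˡ (length L) (v a) (wt L (lc 1ℚ y a (col j)))))
      (ℕ.*-monoʳ-≤ (v a) (∑³-wt L (lc 1ℚ y a (col j))))

  wt*8^far : ∀ L y x → wt L y x ℕ.* 8 ℕ.^ #far L y x ≡ 8 ℕ.^ length L
  wt*8^far []      y []      = refl
  wt*8^far (j ∷ L) y (a ∷ x) = go (near? (s + a * d) d)
    where
    open Head j L y
    y′ : X → ℚ
    y′ = lc 1ℚ y a (col j)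
    go : (n : Dec (Near (s + a * d) d)) →
         weight n ℕ.* wt L y′ x ℕ.* 8 ℕ.^ (far n ℕ.+ #far L y′ x) ≡ 8 ℕ.* 8 ℕ.^ length L
    go (yes _) = trans (ℕ.*-assoc 8 (wt L y′ x) _) (cong (8 ℕ.*_) (wt*8^far L y′ x))
    go (no _)  = trans (1a*8b (wt L y′ x) (8 ℕ.^ #far L y′ x))
      (cong (8 ℕ.*_) (wt*8^far L y′ x))

  Good : ℚ → List I → Set
  Good τ []      = ⊤
  Good τ (j ∷ L) = τ < ⟪ res L (col j) , res L (col j) ⟫ × Good τ L

  energy : List I → (X → ℚ) → ℚ
  energy []      Y = 0ℚ
  energy (j ∷ L) Y = ⟪ Y , res L (col j) ⟫ ² * inv ⟪ res L (col j) , res L (col j) ⟫ + energy L Y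

  bessel : ∀ L Y → ⟪ Y , Y ⟫ ≡ energy L Y + ⟪ res L Y , res L Y ⟫
  bessel []      Y = sym (+-identityˡ ⟪ Y , Y ⟫)
  bessel (j ∷ L) Y = trans (bessel L Y) (trans
    (solve 3 (λ a b c → b :+ c := (a :+ b) :+ (c :- a)) refl
      (⟪ Y , res L (col j) ⟫ ² * inv ⟪ res L (col j) , res L (col j) ⟫) (energy L Y) ⟪ res L Y , res L Y ⟫)
    (cong (energy (j ∷ L) Y +_) (sym (∣res∣² j L Y))))

  combination-⊥ : ∀ L y x e → (∀ {i} → i ∈ L → ⟪ e , col i ⟫ ≡ 0ℚ) → ⟪ combination L y x , e ⟫ ≡ ⟪ y , e ⟫
  combination-⊥ []      y []      e e⊥ = refl
  combination-⊥ (j ∷ L) y (a ∷ x) e e⊥ = trans (combination-⊥ L (lc 1ℚ y a (col j)) x e (e⊥ ∘ there))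
    (trans (⟪⟫-linˡ 1ℚ y a (col j) e) (trans (cong (λ b → 1ℚ * ⟪ y , e ⟫ + a * b)
        (trans (⟪⟫-sym (col j) e) (e⊥ (here refl))))
      (solve 2 (λ s a → con 1ℚ :* s :+ a :* con 0ℚ := s) refl ⟪ y , e ⟫ a)))

  -- A far coordinate carries energy at least d / 4 > τ / 4.
  far≤energy : ∀ {τ} → 0ℚ < τ → ∀ L → Good τ L → ∀ y x → ι (#far L y x) * τ ≤ ι 4 * energy L (combination L y x)
  far≤energy {τ} 0<τ []      _             y []      = ≤-reflexive (*-zeroˡ τ)
  far≤energy {τ} 0<τ (j ∷ L) (τ<d , good) y (a ∷ x) = subst (_≤ ι 4 * energy (j ∷ L) Y) (sym split)
      (≤-trans (+-mono-≤ (≤-trans (first (near? (s + a * d) d))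
          (≤-reflexive (cong (λ q → ι 4 * (q ² * inv d)) (sym Ye)))) (far≤energy 0<τ L good y′ x))
        (≤-reflexive (sym (*-distribˡ-+ (ι 4) (⟪ Y , e ⟫ ² * inv d) (energy L Y)))))
    where
    open Head j L y
    y′ Y : X → ℚ
    y′ = lc 1ℚ y a (col j)
    Y = combination L y′ x
    0<d : 0ℚ < d
    0<d = <-trans 0<τ τ<d
    Ye : ⟪ Y , e ⟫ ≡ s + a * d
    Ye = trans (combination-⊥ L y′ x e (res⊥col L (col j))) (trans (⟪⟫-linˡ 1ℚ y a (col j) e)
      (cong₂ _+_ (*-identityˡ s) (cong (a *_) (sym (⟪res,res⟫ L (col j) (col j))))))
    split : ι (far (near? (s + a * d) d) ℕ.+ #far L y′ x) * τ ≡
        ι (far (near? (s + a * d) d)) * τ + ι (#far L y′ x) * τ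
    split = trans (cong (_* τ) (ι-+ (far (near? (s + a * d) d)) (#far L y′ x)))
        (*-distribʳ-+ τ (ι (far (near? (s + a * d) d))) (ι (#far L y′ x)))
    first : (n : Dec (Near (s + a * d) d)) → ι (far n) * τ ≤ ι 4 * ((s + a * d) ² * inv d)
    first (yes _) = ≤-trans (≤-reflexive (*-zeroˡ τ)) (0≤* (0≤ι 4) (0≤* (0≤² (s + a * d)) (0≤inv (<⇒≤ 0<d))))
    first (no ¬n) = ≤-trans (≤-reflexive (*-identityˡ τ)) (≤-trans (<⇒≤ τ<d) (*-cancelʳ 0<d (≤-trans (≮⇒≥ ¬n)
      (≤-reflexive (trans (cong (ι 4 *_) (sym (*-inv-cancel {(s + a * d) ²} λ d≡0 → ⊥-elim (0<⇒≢0 0<d d≡0))))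
        (sym (*-assoc (ι 4) ((s + a * d) ² * inv d) d)))))))

  -- If k τ > 20 B, each of the given colourings has at most q = ⌊k / 5⌋ far coordinates, by
  -- `far≤energy` and `bessel`, hence weight at least 8^(k - q). Summing over the 2^k subsets gives
  -- 2^k 8^k ≤ 8^q 10^k. The fifth power of this contradicts 16^5 = 1048576 > 800000 = 8 · 10^5.
  greedy-length : ∀ {τ B} → 0ℚ < τ → 0ℚ ≤ B → ∀ L → Good τ L →
    (∀ J → ∃[ x ] Colours J x × ⟪ combination L (λ _ → 0ℚ) x , combination L (λ _ → 0ℚ) x ⟫ ≤ B) →
    ι (length L) * τ ≤ ι 20 * B
  greedy-length {τ} {B} 0<τ 0≤B L good colour = ≮⇒≥ λ lt → contradiction lt (absurd (length L) refl)
    where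
    y : X → ℚ
    y _ = 0ℚ
    absurd : ∀ k → k ≡ length L → ¬ ι 20 * B < ι (length L) * τ
    absurd zero k≡ lt = <⇒≱ lt (≤-trans (≤-reflexive (trans (cong (λ k → ι k * τ) (sym k≡)) (*-zeroˡ τ)))
        (0≤* (0≤ι 20) 0≤B))
    absurd k@(suc _) k≡ lt = ℕ.<⇒≱ (ℕ.^-monoˡ-< k (ℕ.<ᵇ⇒< 800000 1048576 tt)) powers
      where
      q : ℕ
      q = k ℕ./ 5
      few : ∀ x → ⟪ combination L y x , combination L y x ⟫ ≤ B → #far L y x ℕ.≤ q
      few x ≤B = subst (ℕ._≤ q) (ℕ.m*n/n≡m (#far L y x) 5)
          (ℕ./-monoˡ-≤ 5 (ι-cancel-≤ {#far L y x ℕ.* 5} {k} (*-cancelʳ 0<τ (begin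
        ι (#far L y x ℕ.* 5) * τ ≡⟨ trans (cong (_* τ) (ι-* (#far L y x) 5))
            (solve 2 (λ f t → f :* con (ι 5) :* t := con (ι 5) :* (f :* t)) refl (ι (#far L y x)) τ) ⟩
        ι 5 * (ι (#far L y x) * τ) ≤⟨ *-monoˡ (0≤ι 5) (far≤energy 0<τ L good y x) ⟩
        ι 5 * (ι 4 * energy L Y) ≤⟨ *-monoˡ (0≤ι 5) (*-monoˡ (0≤ι 4)
            (≤-trans (≤-by {energy L Y} ⟪ res L Y , res L Y ⟫ (0≤⟪⟫ (res L Y)) (bessel L Y)) ≤B)) ⟩
        ι 5 * (ι 4 * B) ≡⟨ *-assoc (ι 5) (ι 4) B ⟨
        ι 20 * B ≤⟨ <⇒≤ lt ⟩
        ι (length L) * τ ≡⟨ cong (λ k → ι k * τ) (sym k≡) ⟩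
        ι k * τ ∎))))
        where
        open ≤-Reasoning
        Y : X → ℚ
        Y = combination L y x
      many : 2 ℕ.^ length L ℕ.* 8 ℕ.^ length L ℕ.≤ 8 ℕ.^ q ℕ.* 10 ℕ.^ length L
      many = ℕ.≤-trans (ℕ.≤-reflexive (sym (∑²-const (length L) (8 ℕ.^ length L))))
        (ℕ.≤-trans (∑²≤∑³ (length L) (λ x → 8 ℕ.^ q ℕ.* wt L y x) (λ _ → 8 ℕ.^ length L)
          λ J → let x , c , ≤B = colour J in x , c , ℕ.≤-trans (ℕ.≤-reflexive (trans (sym (wt*8^far L y x)) (ℕ.*-comm (wt L y x) _)))
            (ℕ.*-monoˡ-≤ (wt L y x) (ℕ.^-monoʳ-≤ 8 (few x ≤B))))
        (ℕ.≤-trans (ℕ.≤-reflexive (∑³-*ˡ (length L) (8 ℕ.^ q) (wt L y))) (ℕ.*-monoʳ-≤ (8 ℕ.^ q) (∑³-wt L y))))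
      powers : 1048576 ℕ.^ k ℕ.≤ 800000 ℕ.^ k
      powers = begin
        1048576 ℕ.^ k               ≡⟨ ^-^-comm 16 5 k ⟩
        (16 ℕ.^ k) ℕ.^ 5            ≡⟨ cong (ℕ._^ 5) (^-distribʳ-* k 2 8) ⟩
        (2 ℕ.^ k ℕ.* 8 ℕ.^ k) ℕ.^ 5 ≤⟨ ℕ.^-monoˡ-≤ 5 (subst (λ k → 2 ℕ.^ k ℕ.* 8 ℕ.^ k ℕ.≤ 8 ℕ.^ q ℕ.* 10 ℕ.^ k)
            (sym k≡) many) ⟩
        (8 ℕ.^ q ℕ.* 10 ℕ.^ k) ℕ.^ 5 ≡⟨ ^-distribʳ-* 5 (8 ℕ.^ q) (10 ℕ.^ k) ⟩
        (8 ℕ.^ q) ℕ.^ 5 ℕ.* (10 ℕ.^ k) ℕ.^ 5 ≡⟨ cong₂ ℕ._*_ (ℕ.^-*-assoc 8 q 5) (sym (^-^-comm 10 5 k)) ⟩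
        8 ℕ.^ (q ℕ.* 5) ℕ.* 100000 ℕ.^ k ≤⟨ ℕ.*-monoˡ-≤ (100000 ℕ.^ k) (ℕ.^-monoʳ-≤ 8 (ℕ.m/n*n≤m k 5)) ⟩
        8 ℕ.^ k ℕ.* 100000 ℕ.^ k    ≡⟨ ^-distribʳ-* k 8 100000 ⟨
        800000 ℕ.^ k ∎
        where
        open ℕ.≤-Reasoning
        ^-^-comm : ∀ a b c → (a ℕ.^ b) ℕ.^ c ≡ (a ℕ.^ c) ℕ.^ b
        ^-^-comm a b c = trans (ℕ.^-*-assoc a b c) (trans (cong (a ℕ.^_) (ℕ.*-comm b c)) (sym (ℕ.^-*-assoc a c b)))

-- Factorisation of systems of small hereditary discrepancy

unit-sym : ∀ {n} (i j : Fin n) → unit i j ≡ unit j i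
unit-sym i j = go (i Fin.≟ j)
  where
  go : Dec (i ≡ j) → unit i j ≡ unit j i
  go (yes refl) = refl
  go (no i≢j)   = trans (unit-≢ i≢j) (sym (unit-≢ (i≢j ∘ sym)))

∑-unit-∉ : ∀ {n} (xs : List (Fin n)) {i} → i ∉ xs → ∀ (g : Fin n → ℚ) → ∑[ j ← xs ] (unit i j * g j) ≡ 0ℚ
∑-unit-∉ []       i∉ g = refl
∑-unit-∉ (x ∷ xs) {i} i∉ g = cong₂ _+_ (trans (cong (_* g x) (unit-≢ (i∉ ∘ here))) (*-zeroˡ (g x)))
    (∑-unit-∉ xs (i∉ ∘ there) g)

∑-unit-∈ : ∀ {n} (xs : List (Fin n)) → Unique xs → ∀ {i} → i ∈ xs → ∀ (g : Fin n → ℚ) →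
    ∑[ j ← xs ] (unit i j * g j) ≡ g i
∑-unit-∈ (x ∷ xs) (x∉ ∷ _) (here refl) g = trans
  (cong₂ _+_ (trans (cong (_* g x) (unit-≡ x)) (*-identityˡ (g x)))
      (∑-unit-∉ xs (λ x∈ → All.lookup x∉ x∈ refl) g)) (+-identityʳ (g x))
∑-unit-∈ (x ∷ xs) (x∉ ∷ u) {i} (there i∈) g = trans
  (cong₂ _+_ (trans (cong (_* g x) (unit-≢ {i = i} {x} λ { refl →
      All.lookup x∉ i∈ refl })) (*-zeroˡ (g x))) (∑-unit-∈ xs u i∈ g)) (+-identityˡ (g i))

∑-unit : ∀ {n} (i : Fin n) (g : Fin n → ℚ) → ∑[ j ← allFin n ] (unit i j * g j) ≡ g i
∑-unit {n} i g = ∑-unit-∈ (allFin n) (allFin⁺ n) (∈-allFin i) g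

∑-supported : ∀ {n} (L : List (Fin n)) → Unique L → ∀ (g : Fin n → ℚ) → (∀ j → j ∉ L → g j ≡ 0ℚ) →
    ∑ₗ (allFin n) g ≡ ∑ₗ L g
∑-supported {n} L unique g supp = trans (∑-cong (allFin n) λ j → sym (spread j (j ∈? L)))
  (trans (∑-swap (allFin n) L (λ j i → unit j i * g j))
    (∑-cong L λ i → trans (∑-cong (allFin n) λ j → cong (_* g j) (unit-sym j i)) (∑-unit i g)))
  where
  open DecMembership (Fin._≟_ {n}) using (_∈?_)
  spread : ∀ j → Dec (j ∈ L) → ∑[ i ← L ] (unit j i * g j) ≡ g j
  spread j (yes j∈) = ∑-unit-∈ L unique j∈ (λ _ → g j)
  spread j (no j∉)  = trans (∑-unit-∉ L j∉ (λ _ → g j)) (sym (supp j j∉))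

-- A factorisation of a matrix with rows R and n columns is stored as a list of
-- weighted rank-one terms.
record Term (R : Set) (n : ℕ) : Set where
  field
    w   : ℚ
    0≤w : 0ℚ ≤ w
    b   : R → ℚ
    c   : Fin n → ℚ

open Term

entry : ∀ {R n} → List (Term R n) → R → Fin n → ℚ
entry ts r j = ∑[ t ← ts ] (w t * (b t r * c t j))

row² : ∀ {R n} → List (Term R n) → R → ℚ
row² ts r = ∑[ t ← ts ] (w t * (b t r * b t r))

col² : ∀ {R n} → List (Term R n) → Fin n → ℚ
col² ts j = ∑[ t ← ts ] (w t * (c t j * c t j))

Hereditary : ∀ {m n} → (Fin m → Fin n → ℚ) → ℚ → Set
Hereditary {m} {n} a h = ∀ (J : Fin n → Bool) → Σ (Fin n → ℚ) λ χ → (∀ j → J j ≡ false → χ j ≡ 0ℚ) ×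
    (∀ j → J j ≡ true → Hit (χ j)) ×
  (∀ r → (∑[ j ← allFin n ] (χ j * a r j)) ² ≤ h ²)

select : ∀ {n} (L : List (Fin n)) → Vec Bool (length L) → Fin n → Bool
select []      []       j = false
select (i ∷ L) (b ∷ bs) j = if does (i Fin.≟ j) then b else select L bs j

select-here : ∀ {n} (i : Fin n) L b bs → select (i ∷ L) (b ∷ bs) i ≡ b
select-here i L b bs with i Fin.≟ i
... | yes _  = refl
... | no i≢i = contradiction refl i≢i

select-there : ∀ {n} (i : Fin n) {j} L b bs → i ≢ j → select (i ∷ L) (b ∷ bs) j ≡ select L bs j
select-there i {j} L b bs i≢j with i Fin.≟ j
... | yes i≡j = contradiction i≡j i≢j
... | no _    = refl

select-∉ : ∀ {n} (L : List (Fin n)) bs {j} → j ∉ L → select L bs j ≡ false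
select-∉ []      []       j∉ = refl
select-∉ (i ∷ L) (b ∷ bs) j∉ = trans (select-there i L b bs
    (λ { refl → j∉ (here refl) })) (select-∉ L bs (j∉ ∘ there))

colours-select : ∀ {n} (L : List (Fin n)) → Unique L → ∀ bs (χ : Fin n → ℚ) →
  (∀ {j} → j ∈ L → select L bs j ≡ false → χ j ≡ 0ℚ) → (∀ {j} → j ∈ L → select L bs j ≡ true → Hit (χ j)) →
  Colours bs (Vec.map χ (Vec.fromList L))
colours-select []      _        []       χ zeros signs = []
colours-select {n} (i ∷ L) (i∉ ∷ u) (b ∷ bs) χ zeros signs = go b refl
  where
  rest : Colours bs (Vec.map χ (Vec.fromList L))
  rest = colours-select L u bs χ
    (λ j∈ eq → zeros (there j∈) (trans (select-there i L b bs (All.lookup i∉ j∈)) eq))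
    (λ j∈ eq → signs (there j∈) (trans (select-there i L b bs (All.lookup i∉ j∈)) eq))
  go : ∀ b′ → b′ ≡ b → Colours (b ∷ bs) (χ i ∷ Vec.map χ (Vec.fromList L))
  go false refl = subst (λ a → Colours (false ∷ bs) (a ∷ Vec.map χ (Vec.fromList L)))
      (sym (zeros (here refl) (select-here i L b bs))) (out rest)
  go true  refl with signs (here refl) (select-here i L b bs)
  ... | inj₁ eq = subst (λ a → Colours (true ∷ bs) (a ∷ Vec.map χ (Vec.fromList L))) (sym eq) (pos rest)
  ... | inj₂ eq = subst (λ a → Colours (true ∷ bs) (a ∷ Vec.map χ (Vec.fromList L))) (sym eq) (neg rest)

module Response {m n : ℕ} (a : Fin m → Fin n → ℚ) (a²≤1 : ∀ r j → a r j ² ≤ 1ℚ) (h : ℚ) (1≤h : 1ℚ ≤ h)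
  (hereditary : Hereditary a h) (p : Fin m → ℚ) (0<p : ∀ r → 0ℚ < p r) (r₀ : Fin m) where

  open +-*-Solver

  𝔽 : Form (Fin m)
  𝔽 = coordForm (allFin m) p (λ r → <⇒≤ (0<p r))

  col : Fin n → Fin m → ℚ
  col j r = a r j

  open Form 𝔽
  open Residual 𝔽 col
  open GreedyLength 𝔽 col

  P Θ : ℚ
  P = ∑ₗ (allFin m) p
  Θ = ι 20 * (h ² * P)

  0<h : 0ℚ < h
  0<h = <-≤-trans (positive⁻¹ 1ℚ) 1≤h

  0<P : 0ℚ < P
  0<P = <-≤-trans (0<p r₀) (term≤∑ (allFin m) (λ r → <⇒≤ (0<p r)) (∈-allFin r₀))

  0<hP : 0ℚ < h * P
  0<hP = 0<× 0<h 0<P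

  0<Θ : 0ℚ < Θ
  0<Θ = 0<× (0<ι 19) (0<× (0<× 0<h 0<h) 0<P)

  good-∉ : ∀ {τ} → 0ℚ < τ → ∀ L {j} → Good τ (j ∷ L) → j ∉ L
  good-∉ 0<τ L {j} (τ<d , _) j∈L = <⇒≱ (<-trans 0<τ τ<d)
    (≤-reflexive (trans (sym (res-selfadjoint L (col j) (col j))) (res⊥col L (col j) j∈L)))

  good-Unique : ∀ {τ} → 0ℚ < τ → ∀ L → Good τ L → Unique L
  good-Unique 0<τ []      _    = []
  good-Unique 0<τ (j ∷ L) good = All.tabulate (λ { i∈ refl →
      good-∉ 0<τ L good i∈ }) ∷ good-Unique 0<τ L (proj₂ good)

  good-mono : ∀ {τ τ′} → τ′ ≤ τ → ∀ L → Good τ L → Good τ′ L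
  good-mono τ′≤τ []      _            = tt
  good-mono τ′≤τ (j ∷ L) (τ<d , good) = ≤-<-trans τ′≤τ τ<d , good-mono τ′≤τ L good

  combination-map : ∀ L y (χ : Fin n → ℚ) r →
    combination L y (Vec.map χ (Vec.fromList L)) r ≡ y r + ∑[ j ← L ] (χ j * a r j)
  combination-map []      y χ r = sym (+-identityʳ (y r))
  combination-map (j ∷ L) y χ r = trans (combination-map L (lc 1ℚ y (χ j) (col j)) χ r)
    (solve 3 (λ y c s → (con 1ℚ :* y :+ c) :+ s := y :+ (c :+ s)) refl (y r) (χ j * a r j)
        (∑[ j ← L ] (χ j * a r j)))

  -- Every subset of L has a colouring with all row sums at most h in absolute value, so of p-norm²
  -- at most h² P; this is the B of `greedy-length`.
  length-bound : ∀ {τ} → 0ℚ < τ → ∀ L → Good τ L → ι (length L) * τ ≤ Θ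
  length-bound 0<τ L good = greedy-length 0<τ (0≤* (0≤² h) (<⇒≤ 0<P)) L good colour
    where
    unique : Unique L
    unique = good-Unique 0<τ L good
    colour : ∀ J → ∃[ x ] Colours J x × ⟪ combination L (λ _ → 0ℚ) x , combination L (λ _ → 0ℚ) x ⟫ ≤ h ² * P
    colour J with hereditary (select L J)
    ... | χ , zeros , signs , small = x , colours-select L unique J χ (λ {j} _ → zeros j) (λ {j} _ → signs j) ,
        ≤-trans (∑-mono (allFin m) λ r → *-monoˡ (<⇒≤ (0<p r))
            (≤-trans (≤-reflexive (cong (_²) (value r))) (small r)))
          (≤-reflexive (trans (∑-*ʳ (allFin m) (h ²) p) (*-comm P (h ²))))
      where
      x : Vec ℚ (length L)
      x = Vec.map χ (Vec.fromList L)
      value : ∀ r → combination L (λ _ → 0ℚ) x r ≡ ∑[ j ← allFin n ] (χ j * a r j)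
      value r = trans (combination-map L (λ _ → 0ℚ) χ r) (trans (+-identityˡ (∑[ j ← L ] (χ j * a r j)))
        (sym (∑-supported L unique (λ j → χ j * a r j) λ j j∉ →
            trans (cong (_* a r j) (zeros j (select-∉ L J j∉))) (*-zeroˡ (a r j)))))

  ∣res∣ : List (Fin n) → Fin n → ℚ
  ∣res∣ L j = ⟪ res L (col j) , res L (col j) ⟫

  rowCost : List (Term (Fin m) n) → ℚ
  rowCost ts = ∑[ r ← allFin m ] (p r * row² ts r)

  module Extend {τ α c₁ c₂ : ℚ} (0<τ : 0ℚ < τ) (0<α : 0ℚ < α) where

    -- A new term costs exactly α in `rows`. It adds to `col²` what it takes from |res|² / α, by
    -- `∣res∣²`, so the left side of `cols` is invariant.
    record Partial : Set where
      field
        L     : List (Fin n)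
        ts    : List (Term (Fin m) n)
        good  : Good τ L
        exact : ∀ r j → entry ts r j ≡ a r j - res L (col j) r
        rows  : rowCost ts ≤ c₁ + α * ι (length L)
        cols  : ∀ j → col² ts j + inv α * ∣res∣ L j ≤ c₂

    α-inv : α * inv α ≡ 1ℚ
    α-inv = *-inv (0<⇒≢0 0<α)

    add : (s : Partial) → ∀ j → τ < ∣res∣ (Partial.L s) j → Σ Partial λ s′ → length (Partial.L s′) ≡
        suc (length (Partial.L s))
    add s j₀ τ<d = record
      { L = j₀ ∷ L ; ts = t ∷ ts ; good = τ<d , good ; exact = exact′ ; rows = rows′ ; cols = cols′ } , refl
      where
      open Partial s
      e : Fin m → ℚ
      e = res L (col j₀)
      d : ℚ
      d = ⟪ e , e ⟫
      0<d : 0ℚ < d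
      0<d = <-trans 0<τ τ<d
      t : Term (Fin m) n
      -- This is the unit vector e / √d with factor √α on the row side and 1 / √α on the column
      -- side; the weight α / d removes the roots.
      t = record { w = α * inv d ; 0≤w = 0≤* (<⇒≤ 0<α) (0≤inv (<⇒≤ 0<d)) ; b = e ; c = λ j → ⟪ col j , e ⟫ * inv α }
      exact′ : ∀ r j → entry (t ∷ ts) r j ≡ a r j - res (j₀ ∷ L) (col j) r
      exact′ r j = trans (cong₂ _+_ (trans
          (solve 5 (λ α i e q k → α :* i :* (e :* (q :* k)) := (α :* k) :* (q :* i :* e)) refl α (inv d)
              (e r) ⟪ col j , e ⟫ (inv α))
          (trans (cong (_* (⟪ col j , e ⟫ * inv d * e r)) α-inv) (*-identityˡ (⟪ col j , e ⟫ * inv d * e r))))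
              (exact r j))
        (trans (solve 4 (λ q e a s → q :* e :+ (a :- s) := a :- (con 1ℚ :* s :+ :- q :* e)) refl
            (⟪ col j , e ⟫ * inv d) (e r) (a r j) (res L (col j) r))
          (cong (λ q → a r j - (1ℚ * res L (col j) r + - (q * inv d) * e r)) (sym (⟪res,res⟫ L (col j) (col j₀)))))
      rows′ : rowCost (t ∷ ts) ≤ c₁ + α * ι (suc (length L))
      rows′ = ≤-trans (≤-reflexive (trans (∑-cong (allFin m) λ r →
          solve 4 (λ p w e q → p :* (w :* e :+ q) := w :* (p :* e) :+ con 1ℚ :* (p :* q)) refl (p r) (α * inv d)
              (e r * e r) (row² ts r))
          (trans (∑-lin (allFin m) (α * inv d) (λ r → p r * (e r * e r)) 1ℚ (λ r → p r * row² ts r))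
            (cong₂ _+_ (*-inv-cancel {α} λ d≡0 → ⊥-elim (0<⇒≢0 0<d d≡0)) (*-identityˡ (rowCost ts))))))
        (≤-trans (+-monoʳ-≤ α rows) (≤-reflexive (trans
          (solve 3 (λ α c k → α :+ (c :+ α :* k) := c :+ α :* (con 1ℚ :+ k)) refl α c₁ (ι (length L)))
          (cong (λ k → c₁ + α * k) (sym (ι-suc (length L)))))))
      cols′ : ∀ j → col² (t ∷ ts) j + inv α * ∣res∣ (j₀ ∷ L) j ≤ c₂
      cols′ j = ≤-trans (≤-reflexive (trans (cong (λ s → col² (t ∷ ts) j + inv α * s) (∣res∣² j₀ L (col j)))
          (trans (solve 6 (λ α i q k C s → (α :* i :* ((q :* k) :* (q :* k)) :+ C) :+ k :* (s :- q :* q :* i)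
              := (α :* k :* (q :* q :* i :* k) :- q :* q :* i :* k) :+ (C :+ k :* s)) refl α (inv d) ⟪ col j ,
                  e ⟫ (inv α) (col² ts j) (∣res∣ L j))
            (trans (cong (λ u → (u * (⟪ col j , e ⟫ * ⟪ col j , e ⟫ * inv d * inv α) - ⟪ col j , e ⟫ * ⟪ col j ,
                e ⟫ * inv d * inv α) + (col² ts j + inv α * ∣res∣ L j)) α-inv)
              (solve 2 (λ x y → (con 1ℚ :* x :- x) :+ y := y) refl
                  (⟪ col j , e ⟫ * ⟪ col j , e ⟫ * inv d * inv α) (col² ts j + inv α * ∣res∣ L j))))))
        (cols j)

    -- Each round lengthens L by one column and `length-bound` caps its length, so the fuel cannot
    -- run out.
    extend : ∀ fuel (s : Partial) → Θ < ι (fuel ℕ.+ length (Partial.L s)) * τ →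
             Σ Partial λ s′ → ∀ j → ∣res∣ (Partial.L s′) j ≤ τ
    extend zero       s lt = contradiction (length-bound 0<τ (Partial.L s) (Partial.good s)) (<⇒≱ lt)
    extend (suc fuel) s lt = go (Fin.any? (λ j → τ <? ∣res∣ (Partial.L s) j))
      where
      go : Dec (∃[ j ] τ < ∣res∣ (Partial.L s) j) → Σ Partial λ s′ → ∀ j → ∣res∣ (Partial.L s′) j ≤ τ
      go (no none) = s , λ j → ≮⇒≥ λ τ<d → none (j , τ<d)
      go (yes (j , τ<d)) = let s′ , len = add s j τ<d in extend fuel s′ (subst (λ k → Θ < ι k * τ)
        (trans (sym (ℕ.+-suc fuel (length (Partial.L s)))) (cong (fuel ℕ.+_) (sym len))) lt)

  -- Every stage costs the same. Stage r + 1 lowers the threshold to τ = Θ / 2^r, so L gets at most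
  -- 2^r columns; with α = h P / 2^r they cost at most h P in the rows, and the residuals, at most 2
  -- Θ / 2^r before, give at most 40 h to the columns.
  record Stage (r : ℕ) : Set where
    field
      L     : List (Fin n)
      ts    : List (Term (Fin m) n)
      good  : Good (Θ * (½ ^ᵠ r + ½ ^ᵠ r)) L
      exact : ∀ i j → entry ts i j ≡ a i j - res L (col j) i
      rows  : rowCost ts ≤ ι r * (h * P)
      cols  : ∀ j → col² ts j ≤ ι r * (ι 40 * h)
      rest  : ∀ j → ∣res∣ L j ≤ Θ * (½ ^ᵠ r + ½ ^ᵠ r)

  ½^*2^ : ∀ r → ι (2 ℕ.^ r) * ½ ^ᵠ r ≡ 1ℚ
  ½^*2^ zero    = refl
  ½^*2^ (suc r) = trans (cong (_* (½ * ½ ^ᵠ r)) (ι-* 2 (2 ℕ.^ r)))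
    (trans (solve 2 (λ t h → con (ι 2) :* t :* (con ½ :* h) := t :* h) refl (ι (2 ℕ.^ r)) (½ ^ᵠ r)) (½^*2^ r))

  0<½^ : ∀ r → 0ℚ < ½ ^ᵠ r
  0<½^ r = 0<^ r (positive⁻¹ ½)

  stage-zero : Stage 0
  stage-zero = record { L = [] ; ts = [] ; good = tt
    ; exact = λ i j → sym (+-inverseʳ (a i j))
    ; rows = ≤-reflexive (trans (∑-zero (allFin m) λ r → *-zeroʳ (p r)) (sym (*-zeroˡ (h * P))))
    ; cols = λ j → ≤-reflexive (sym (*-zeroˡ (ι 40 * h)))
    ; rest = λ j → ≤-trans (∑-mono (allFin m) {g = p} λ r →
        ≤-trans (*-monoˡ (<⇒≤ (0<p r)) (a²≤1 r j)) (≤-reflexive (*-identityʳ (p r))))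
        (≤-trans P≤h²P (≤-by (ι 39 * (h ² * P)) (0≤* (0≤ι 39) (0≤* (0≤² h) (<⇒≤ 0<P)))
          (solve 1 (λ x → con (ι 20) :* x :* (con 1ℚ :+ con 1ℚ) := x :+ con (ι 39) :* x) refl (h ² * P)))) }
    where
    P≤h²P : P ≤ h ² * P
    P≤h²P = ≤-trans (≤-reflexive (sym (*-identityˡ P))) (*-monoʳ (<⇒≤ 0<P) (²-mono 0≤1 1≤h))

  stage-suc : ∀ r → Stage r → Stage (suc r)
  stage-suc r s = finish (extend (suc (2 ℕ.^ r)) start enough)
    where
    open Stage s
    τ α : ℚ
    τ = Θ * ½ ^ᵠ r
    α = h * P * ½ ^ᵠ r
    0<τ : 0ℚ < τ
    0<τ = 0<× 0<Θ (0<½^ r)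
    0<α : 0ℚ < α
    0<α = 0<× 0<hP (0<½^ r)
    open Extend {τ} {α} {ι r * (h * P)} {ι r * (ι 40 * h) + ι 40 * h} 0<τ 0<α
    scale : inv α * (Θ * (½ ^ᵠ r + ½ ^ᵠ r)) ≡ ι 40 * h
    scale = trans (solve 4 (λ k h P t → k :* (con (ι 20) :* (h :* h :* P) :* (t :+ t)) := (h :* P :* t :* k) :*
        (con (ι 40) :* h)) refl (inv α) h P (½ ^ᵠ r))
      (trans (cong (_* (ι 40 * h)) α-inv) (*-identityˡ (ι 40 * h)))
    start : Partial
    start = record { L = L ; ts = ts
      ; good = good-mono (*-monoˡ (<⇒≤ 0<Θ) (≤-by (½ ^ᵠ r) (<⇒≤ (0<½^ r)) refl)) L good
      ; exact = exact
      ; rows = ≤-trans rows (≤-by (α * ι (length L)) (0≤* (<⇒≤ 0<α) (0≤ι (length L))) refl)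
      ; cols = λ j → +-mono-≤ (cols j) (≤-trans (*-monoˡ (0≤inv (<⇒≤ 0<α)) (rest j)) (≤-reflexive scale)) }
    enough : Θ < ι (suc (2 ℕ.^ r) ℕ.+ length L) * τ
    enough = <-≤-trans (subst₂ _<_ (+-identityˡ Θ) refl (+-monoˡ-< Θ 0<τ)) (≤-trans (≤-reflexive (sym (trans
        (cong (_* τ) (ι-suc (2 ℕ.^ r))) (trans (solve 3
            (λ t T x → (con 1ℚ :+ t) :* (T :* x) := T :* x :+ T :* (t :* x)) refl (ι (2 ℕ.^ r)) Θ (½ ^ᵠ r))
          (cong (τ +_) (trans (cong (Θ *_) (½^*2^ r)) (*-identityʳ Θ)))))))
      (*-monoʳ (<⇒≤ 0<τ) (ι-mono-≤ {suc (2 ℕ.^ r)} {suc (2 ℕ.^ r) ℕ.+ length L}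
          (ℕ.m≤m+n (suc (2 ℕ.^ r)) (length L)))))
    halves : ½ ^ᵠ suc r + ½ ^ᵠ suc r ≡ ½ ^ᵠ r
    halves = solve 1 (λ t → con ½ :* t :+ con ½ :* t := t) refl (½ ^ᵠ r)
    finish : (Σ Partial λ s′ → ∀ j → ∣res∣ (Partial.L s′) j ≤ τ) → Stage (suc r)
    finish (s′ , small) = record { L = L′ ; ts = Partial.ts s′
      ; good = subst (λ t → Good (Θ * t) L′) (sym halves) (Partial.good s′)
      ; exact = Partial.exact s′
      ; rows = ≤-trans (Partial.rows s′) (≤-trans (+-monoʳ-≤ (ι r * (h * P)) αlen≤) (≤-reflexive (suc* (h * P))))
      ; cols = λ j → ≤-trans (≤-by (inv α * ∣res∣ L′ j) (0≤* (0≤inv (<⇒≤ 0<α)) (0≤⟪⟫ (res L′ (col j)))) refl)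
          (≤-trans (Partial.cols s′ j) (≤-reflexive (suc* (ι 40 * h))))
      ; rest = λ j → subst (λ t → ∣res∣ L′ j ≤ Θ * t) (sym halves) (small j) }
      where
      L′ : List (Fin n)
      L′ = Partial.L s′
      suc* : ∀ x → ι r * x + x ≡ ι (suc r) * x
      suc* x = trans (solve 2 (λ k x → k :* x :+ x := (con 1ℚ :+ k) :* x) refl (ι r) x)
          (cong (_* x) (sym (ι-suc r)))
      len≤ : ι (length L′) * ½ ^ᵠ r ≤ 1ℚ
      len≤ = *-cancelʳ 0<Θ (≤-trans (≤-reflexive (solve 3 (λ k t T → k :* t :* T := k :* (T :* t)) refl
          (ι (length L′)) (½ ^ᵠ r) Θ))
        (≤-trans (length-bound 0<τ L′ (Partial.good s′)) (≤-reflexive (sym (*-identityˡ Θ)))))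
      αlen≤ : α * ι (length L′) ≤ h * P
      αlen≤ = ≤-trans (≤-reflexive (solve 3 (λ x t k → x :* t :* k := x :* (k :* t)) refl (h * P) (½ ^ᵠ r)
          (ι (length L′))))
        (≤-trans (*-monoˡ (<⇒≤ 0<hP) len≤) (≤-reflexive (*-identityʳ (h * P))))

  stage : ∀ r → Stage r
  stage zero    = stage-zero
  stage (suc r) = stage-suc r (stage r)

  -- The residual of the last stage is factored through the identity matrix.
  respond : ∀ l → m ℕ.≤ 2 ℕ.^ l → ∃[ ts ] (∀ r j → entry ts r j ≡ a r j) ×
    (∀ j → col² ts j ≤ ι (2 ℕ.+ l) * (ι 40 * h)) × rowCost ts ≤ ι (2 ℕ.+ l) * h * P
  respond l m≤2^l = last ++ ts , exact′ , cols′ , rows′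
    where
    open Stage (stage (suc l))
    x α : ℚ
    x = ½ ^ᵠ l
    α = h * P * x
    0<α : 0ℚ < α
    0<α = 0<× 0<hP (0<½^ l)
    y : Fin n → Fin m → ℚ
    y j = res L (col j)
    last-term : Fin m → Term (Fin m) n
    -- Weighted by α / p i, each of the m rows costs α = h P / 2^l, in total at most h P as m ≤ 2^l.
    -- The columns receive |res|² / α ≤ 20 h.
    last-term i = record { w = α * inv (p i) ; 0≤w = 0≤* (<⇒≤ 0<α) (0≤inv (<⇒≤ (0<p i))) ; b = unit i
                         ; c = λ j → y j i * (p i * inv α) }
    last : List (Term (Fin m) n)
    last = map last-term (allFin m)
    p-inv : ∀ i → p i * inv (p i) ≡ 1ℚ
    p-inv i = *-inv (0<⇒≢0 (0<p i))
    α-inv : α * inv α ≡ 1ℚ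
    α-inv = *-inv (0<⇒≢0 0<α)
    last-entry : ∀ r j → entry last r j ≡ y j r
    last-entry r j = trans (∑-map last-term (allFin m) (λ t → w t * (b t r * c t j)))
        (trans (∑-cong (allFin m) λ i → trans
      (solve 6 (λ α k u y p q → α :* k :* (u :* (y :* (p :* q))) := (α :* q) :* (p :* k) :* (u :* y)) refl α
          (inv (p i)) (unit i r) (y j i) (p i) (inv α))
      (trans (cong₂ (λ s t → s * t * (unit i r * y j i)) α-inv (p-inv i))
          (trans (*-identityˡ (unit i r * y j i)) (cong (_* y j i) (unit-sym i r)))))
      (∑-unit r (y j)))
    last-row : ∀ r → p r * row² last r ≡ α
    last-row r = trans (cong (p r *_) (trans (∑-map last-term (allFin m) (λ t → w t * (b t r * b t r)))
        (trans (∑-cong (allFin m) λ i → trans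
        (solve 2 (λ s u → s :* (u :* u) := u :* (u :* s)) refl (α * inv (p i)) (unit i r))
        (cong₂ (λ u v → u * (v * (α * inv (p i)))) (unit-sym i r) (unit-sym i r)))
        (trans (∑-unit r (λ i → unit r i * (α * inv (p i)))) (cong (_* (α * inv (p r))) (unit-≡ r))))))
      (trans (solve 3 (λ p α k → p :* (con 1ℚ :* (α :* k)) := (p :* k) :* α) refl (p r) α (inv (p r)))
        (trans (cong (_* α) (p-inv r)) (*-identityˡ α)))
    last-col : ∀ j → col² last j ≡ inv α * ∣res∣ L j
    last-col j = trans (∑-map last-term (allFin m) (λ t → w t * (c t j * c t j)))
        (trans (∑-cong (allFin m) λ i → trans
      (solve 5 (λ α k y p q → α :* k :* ((y :* (p :* q)) :* (y :* (p :* q))) := (α :* q) :* (p :* k) :*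
          (q :* (p :* (y :* y)))) refl α (inv (p i)) (y j i) (p i) (inv α))
      (trans (cong₂ (λ s t → s * t * (inv α * (p i * (y j i * y j i)))) α-inv (p-inv i))
          (*-identityˡ (inv α * (p i * (y j i * y j i))))))
      (∑-*ˡ (allFin m) (inv α) (λ i → p i * (y j i * y j i))))
    exact′ : ∀ r j → entry (last ++ ts) r j ≡ a r j
    exact′ r j = trans (∑-++ last ts (λ t → w t * (b t r * c t j))) (trans (cong₂ _+_ (last-entry r j) (exact r j))
      (solve 2 (λ y a → y :+ (a :- y) := a) refl (y j r) (a r j)))
    +2 : ∀ z → ι (suc l) * z + z ≡ ι (2 ℕ.+ l) * z
    +2 z = trans (solve 2 (λ k z → k :* z :+ z := (con 1ℚ :+ k) :* z) refl (ι (suc l)) z)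
        (cong (_* z) (sym (ι-suc (suc l))))
    cols′ : ∀ j → col² (last ++ ts) j ≤ ι (2 ℕ.+ l) * (ι 40 * h)
    cols′ j = ≤-trans (≤-reflexive (trans (∑-++ last ts (λ t → w t * (c t j * c t j)))
        (+-comm (col² last j) (col² ts j)))) (≤-trans (+-mono-≤ (cols j)
      (≤-trans (≤-reflexive (last-col j)) (≤-trans (*-monoˡ (0≤inv (<⇒≤ 0<α)) (rest j))
          (≤-trans (≤-reflexive scale) (≤-by (ι 20 * h) (0≤* (0≤ι 20) (<⇒≤ 0<h))
        (solve 1 (λ h → con (ι 40) :* h := con (ι 20) :* h :+ con (ι 20) :* h) refl h))))))
      (≤-reflexive (+2 (ι 40 * h))))
      where
      scale : inv α * (Θ * (½ ^ᵠ suc l + ½ ^ᵠ suc l)) ≡ ι 20 * h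
      scale = trans (solve 4 (λ k h P t → k :* (con (ι 20) :* (h :* h :* P) :* (con ½ :* t :+ con ½ :* t)) :=
          (h :* P :* t :* k) :* (con (ι 20) :* h)) refl (inv α) h P x)
        (trans (cong (_* (ι 20 * h)) α-inv) (*-identityˡ (ι 20 * h)))
    rows′ : rowCost (last ++ ts) ≤ ι (2 ℕ.+ l) * h * P
    rows′ = ≤-trans (≤-reflexive (trans (∑-cong (allFin m) λ r →
        trans (cong (p r *_) (∑-++ last ts (λ t → w t * (b t r * b t r))))
        (trans (*-distribˡ-+ (p r) (row² last r) (row² ts r)) (cong (_+ p r * row² ts r) (last-row r))))
        (trans (∑-+ (allFin m) (λ _ → α) (λ r → p r * row² ts r))
            (trans (cong (_+ rowCost ts) (trans (∑-const (allFin m) α)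
                (cong (λ k → ι k * α) (length-tabulate {n = m} (λ i → i)))))
          (+-comm (ι m * α) (rowCost ts))))))
      (≤-trans (+-mono-≤ rows mα≤) (≤-reflexive (trans (+2 (h * P)) (sym (*-assoc (ι (2 ℕ.+ l)) h P)))))
      where
      mα≤ : ι m * α ≤ h * P
      mα≤ = ≤-trans (≤-reflexive (solve 3 (λ k z x → k :* (z :* x) := z :* (k :* x)) refl (ι m) (h * P) x))
        (≤-trans (*-monoˡ (<⇒≤ 0<hP) (≤-trans (*-monoʳ (<⇒≤ (0<½^ l)) (ι-mono-≤ {m} {2 ℕ.^ l} m≤2^l))
            (≤-reflexive (½^*2^ l)))) (≤-reflexive (*-identityʳ (h * P))))

-- Mixing factorisations for a uniform row bound

scaleTerm : ∀ {R n} τ → 0ℚ ≤ τ → Term R n → Term R n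
scaleTerm τ 0≤τ t = record { w = τ * w t ; 0≤w = 0≤* 0≤τ (0≤w t) ; b = b t ; c = c t }

∑-scale : ∀ {R n} τ (0≤τ : 0ℚ ≤ τ) (ts : List (Term R n)) (q : Term R n → ℚ) → (∀ t → q (scaleTerm τ 0≤τ t) ≡ q t) →
  ∑[ t ← map (scaleTerm τ 0≤τ) ts ] (w t * q t) ≡ τ * ∑[ t ← ts ] (w t * q t)
∑-scale τ 0≤τ ts q eq = trans (∑-map (scaleTerm τ 0≤τ) ts (λ t → w t * q t))
  (trans (∑-cong ts λ t → trans (cong (τ * w t *_) (eq t)) (*-assoc τ (w t) (q t))) (∑-*ˡ ts τ (λ t → w t * q t)))

-- Concatenation with scaled weights makes `entry`, `row²` and `col²` affine in τ. Averaging the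
-- factors themselves would spoil their product.
mixTerms : ∀ {R n} τ → 0ℚ ≤ τ → τ ≤ 1ℚ → (ts us : List (Term R n)) → List (Term R n)
mixTerms τ 0≤τ τ≤1 ts us = map (scaleTerm (1ℚ - τ) (≤⇒0≤- τ≤1)) ts ++ map (scaleTerm τ 0≤τ) us

∑-mix : ∀ {R n} τ (0≤τ : 0ℚ ≤ τ) (τ≤1 : τ ≤ 1ℚ) (ts us : List (Term R n)) (q : Term R n → ℚ) →
    (∀ σ (0≤σ : 0ℚ ≤ σ) t → q (scaleTerm σ 0≤σ t) ≡ q t) →
  ∑[ t ← mixTerms τ 0≤τ τ≤1 ts us ] (w t * q t) ≡ (1ℚ - τ) * ∑[ t ← ts ] (w t * q t) + τ * ∑[ t ← us ] (w t * q t)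
∑-mix τ 0≤τ τ≤1 ts us q eq = trans (∑-++ (map (scaleTerm (1ℚ - τ) (≤⇒0≤- τ≤1)) ts) (map (scaleTerm τ 0≤τ) us)
    (λ t → w t * q t))
  (cong₂ _+_ (∑-scale (1ℚ - τ) (≤⇒0≤- τ≤1) ts q (eq (1ℚ - τ) (≤⇒0≤- τ≤1))) (∑-scale τ 0≤τ us q (eq τ 0≤τ)))

factorise : ∀ {m n} (a : Fin m → Fin n → ℚ) → (∀ r j → a r j ² ≤ 1ℚ) → ∀ h → 1ℚ ≤ h → Hereditary a h → Fin m →
  ∀ l → m ℕ.≤ 2 ℕ.^ l → ∃[ ts ] (∀ r j → entry ts r j ≡ a r j) ×
    (∀ r → row² ts r ≤ ι (2 ℕ.+ l) * (ι 40 * h)) × (∀ j → col² ts j ≤ ι (2 ℕ.+ l) * (ι 40 * h))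
factorise {m} {n} a a²≤1 h 1≤h hereditary r₀ l m≤2^l =
  let (ts , exact , cols) , rows = approach in
  ts , exact , (λ r → ≤-trans (rows r) 2κ≤K) , cols
  where
  open +-*-Solver
  K κ : ℚ
  K = ι (2 ℕ.+ l) * (ι 40 * h)
  κ = ι (2 ℕ.+ l) * h
  0<κ : 0ℚ < κ
  0<κ = 0<× (0<ι (suc l)) (<-≤-trans (positive⁻¹ 1ℚ) 1≤h)
  2κ≤K : κ + κ ≤ K
  2κ≤K = ≤-by (ι 38 * κ) (0≤* (0≤ι 38) (<⇒≤ 0<κ))
    (solve 2 (λ k h → k :* (con (ι 40) :* h) := (k :* h :+ k :* h) :+ con (ι 38) :* (k :* h)) refl (ι (2 ℕ.+ l)) h)
  -- The column bound belongs to the state, since every response satisfies it and mixing preserves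
  -- it; the game is played for the rows only.
  S : Set
  S = Σ (List (Term (Fin m) n)) λ ts → (∀ r j → entry ts r j ≡ a r j) × (∀ j → col² ts j ≤ K)
  mix : ∀ τ (s s′ : S) → 0ℚ ≤ τ → τ ≤ 1ℚ → Σ S λ s″ → (∀ r → row² (proj₁ s″) r ≡
      (1ℚ - τ) * row² (proj₁ s) r + τ * row² (proj₁ s′) r)
  mix τ (ts , exact , cols) (us , exact′ , cols′) 0≤τ τ≤1 =
    (mixTerms τ 0≤τ τ≤1 ts us ,
      (λ r j → trans (∑-mix τ 0≤τ τ≤1 ts us (λ t → b t r * c t j) (λ _ _ _ → refl))
        (trans (cong₂ (λ x y → (1ℚ - τ) * x + τ * y) (exact r j) (exact′ r j)) (average (a r j)))) ,
      (λ j → ≤-trans (≤-reflexive (∑-mix τ 0≤τ τ≤1 ts us (λ t → c t j * c t j) (λ _ _ _ → refl)))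
        (≤-trans (+-mono-≤ (*-monoˡ (≤⇒0≤- τ≤1) (cols j)) (*-monoˡ 0≤τ (cols′ j))) (≤-reflexive (average K))))) ,
    λ r → ∑-mix τ 0≤τ τ≤1 ts us (λ t → b t r * b t r) (λ _ _ _ → refl)
    where
    average : ∀ x → (1ℚ - τ) * x + τ * x ≡ x
    average = solve 2 (λ t x → (con 1ℚ :- t) :* x :+ t :* x := x) refl τ
  answer : ∀ (p : Fin m → ℚ) → (∀ i → 0ℚ < p i) →
    Σ S λ s → ∑[ i ← allFin m ] (p i * row² (proj₁ s) i) ≤ κ * ∑ₗ (allFin m) p
  answer p 0<p = let ts , exact , cols , rows = respond l m≤2^l in (ts , exact , cols) , rows
    where open Response a a²≤1 h 1≤h hereditary p 0<p r₀
  open Approachability {S} (allFin m) ∈-allFin (λ s r → row² (proj₁ s) r)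
    (λ s r → 0≤∑ (proj₁ s) λ t → 0≤* (0≤w t) (0≤² (b t r))) mix κ 0<κ answer

-- Set systems

minColouring-≤ : ∀ {n} (f : Colouring n → ℕ) x → minColouring f ℕ.≤ f x
minColouring-≤ f []            = ℕ.≤-refl
minColouring-≤ f (Sign.+ ∷ x) = ℕ.≤-trans (ℕ.m⊓n≤m _ _) (minColouring-≤ (λ x → f (Sign.+ ∷ x)) x)
minColouring-≤ f (Sign.- ∷ x) = ℕ.≤-trans (ℕ.m⊓n≤n _ _) (minColouring-≤ (λ x → f (Sign.- ∷ x)) x)

minColouring-attained : ∀ {n} (f : Colouring n → ℕ) → Σ (Colouring n) λ x → f x ≡ minColouring f
minColouring-attained {zero}  f = [] , refl
minColouring-attained {suc n} f
  with minColouring-attained (λ x → f (Sign.+ ∷ x)) | minColouring-attained (λ x → f (Sign.- ∷ x))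
     | ℕ.⊓-sel (minColouring (λ x → f (Sign.+ ∷ x))) (minColouring (λ x → f (Sign.- ∷ x)))
... | x , eq | _ | inj₁ sel = Sign.+ ∷ x , trans eq (sym sel)
... | _ | x , eq | inj₂ sel = Sign.- ∷ x , trans eq (sym sel)

≤-maxSubset : ∀ {n} (f : Subset n → ℕ) J → f J ℕ.≤ maxSubset f
≤-maxSubset f []            = ℕ.≤-refl
≤-maxSubset f (inside  ∷ J) = ℕ.≤-trans (≤-maxSubset (λ J → f (inside ∷ J)) J) (ℕ.m≤m⊔n _ _)
≤-maxSubset f (outside ∷ J) = ℕ.≤-trans (≤-maxSubset (λ J → f (outside ∷ J)) J) (ℕ.m≤n⊔m _ _)

maxSubset-≤ : ∀ {n} (f : Subset n → ℕ) {B} → (∀ J → f J ℕ.≤ B) → maxSubset f ℕ.≤ B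
maxSubset-≤ {zero}  f le = le []
maxSubset-≤ {suc n} f le = ℕ.⊔-lub (maxSubset-≤ (λ J → f (inside ∷ J)) (λ J → le (inside ∷ J)))
                                    (maxSubset-≤ (λ J → f (outside ∷ J)) (λ J → le (outside ∷ J)))

module _ {n : ℕ} (𝓕 : SetSystem n) where
  open SetSystem 𝓕

  private
    ∣_∣ˢ : (F : Subset n) → Colouring n → ℕ
    ∣ F ∣ˢ x = ℤ.∣ signedSum F x ∣

  herdisc-colouring : ∀ J → Σ (Colouring n) λ x → ∀ {F} → F ∈ sets → ∣ F ∩ J ∣ˢ x ℕ.≤ herdisc 𝓕
  herdisc-colouring J with minColouring-attained (λ x → max 0 (map (λ F → ∣ F ∣ˢ x) (SetSystem.sets (𝓕 ↾ J))))
  ... | x , eq = x , λ {F} F∈ → ℕ.≤-trans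
    (All.lookup (xs≤max 0 (map (λ F → ∣ F ∣ˢ x) (SetSystem.sets (𝓕 ↾ J))))
        (∈-map⁺ (λ F → ∣ F ∣ˢ x) (∈-deduplicate⁺ _≟ˢ_ (∈-map⁺ (_∩ J) F∈))))
    (ℕ.≤-trans (ℕ.≤-reflexive eq) (≤-maxSubset (λ J → disc (𝓕 ↾ J)) J))

  herdisc-≤ : ∀ {B} → (∀ J → Σ (Colouring n) λ x → ∀ {F} → F ∈ sets → ∣ F ∩ J ∣ˢ x ℕ.≤ B) → herdisc 𝓕 ℕ.≤ B
  herdisc-≤ {B} colour = maxSubset-≤ (λ J → disc (𝓕 ↾ J)) λ J → let x , small = colour J in
    ℕ.≤-trans (minColouring-≤ (λ x → max 0 (map (λ F → ∣ F ∣ˢ x) (SetSystem.sets (𝓕 ↾ J)))) x)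
      (max≤v⁺ ℕ.z≤n (All.map⁺ (All.tabulate λ F∈ → restricted J x small
          (∈-map⁻ (_∩ J) (∈-deduplicate⁻ _≟ˢ_ (map (_∩ J) sets) F∈)))))
    where
    restricted : ∀ J x → (∀ {F} → F ∈ sets → ∣ F ∩ J ∣ˢ x ℕ.≤ B) → ∀ {F′} → (∃[ F ] F ∈ sets × F′ ≡ F ∩ J) →
        ∣ F′ ∣ˢ x ℕ.≤ B
    restricted J x small (F , F∈ , refl) = small F∈

ind : ∀ {n} → Subset n → Fin n → ℚ
ind F j = if Vec.lookup F j then 1ℚ else 0ℚ

sgn : Sign → ℚ
sgn Sign.+ = 1ℚ
sgn Sign.- = - 1ℚ

sgn-Hit : ∀ s → Hit (sgn s)
sgn-Hit Sign.+ = inj₁ refl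
sgn-Hit Sign.- = inj₂ refl

ind-∩ : ∀ {n} (F J : Subset n) j → ind (F ∩ J) j ≡ ind F j * ind J j
ind-∩ F J j = trans (cong (λ b → if b then 1ℚ else 0ℚ) (Vec.lookup-zipWith _∧_ j F J))
    (go (Vec.lookup F j) (Vec.lookup J j))
  where
  go : ∀ a b → (if a ∧ b then 1ℚ else 0ℚ) ≡ (if a then 1ℚ else 0ℚ) * (if b then 1ℚ else 0ℚ)
  go true  true  = refl
  go true  false = refl
  go false true  = refl
  go false false = refl

ind²≤1 : ∀ {n} (F : Subset n) j → ind F j ² ≤ 1ℚ
ind²≤1 F j with Vec.lookup F j
... | true  = ≤-refl
... | false = 0≤1

0≤ind : ∀ {n} (F : Subset n) j → 0ℚ ≤ ind F j
0≤ind F j with Vec.lookup F j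
... | true  = 0≤1
... | false = ≤-refl

∑-allFin-suc : ∀ {n} (g : Fin (suc n) → ℚ) → ∑ₗ (allFin (suc n)) g ≡
    g Fin.zero + ∑ₗ (allFin n) (λ j → g (Fin.suc j))
∑-allFin-suc {n} g = cong (g Fin.zero +_) (trans (cong (λ xs → ∑ₗ xs g) (sym (map-tabulate (λ j → j) Fin.suc)))
    (∑-map Fin.suc (allFin n) g))

signedSum-∑ : ∀ {n} (F : Subset n) (x : Colouring n) →
              fromℤ (signedSum F x) ≡ ∑[ j ← allFin n ] (sgn (Vec.lookup x j) * ind F j)
signedSum-∑ []            []      = refl
signedSum-∑ {suc n} (inside ∷ F) (s ∷ x) = trans (fromℤ-+ (s ◃ 1) (signedSum F x)) (trans
  (cong₂ _+_ (unit-sign s) (signedSum-∑ F x)) (sym (∑-allFin-suc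
      (λ j → sgn (Vec.lookup (s ∷ x) j) * ind (inside ∷ F) j))))
  where
  unit-sign : ∀ s → fromℤ (s ◃ 1) ≡ sgn s * 1ℚ
  unit-sign Sign.+ = refl
  unit-sign Sign.- = refl
signedSum-∑ {suc n} (outside ∷ F) (s ∷ x) = trans (signedSum-∑ F x) (trans
  (sym (trans (cong (_+ rest) (*-zeroʳ (sgn s))) (+-identityˡ rest)))
      (sym (∑-allFin-suc (λ j → sgn (Vec.lookup (s ∷ x) j) * ind (outside ∷ F) j))))
  where
  rest : ℚ
  rest = ∑[ j ← allFin n ] (sgn (Vec.lookup x j) * ind F j)

fromℤ-² : ∀ i → fromℤ i ² ≡ ι (ℤ.∣ i ∣ ℕ.* ℤ.∣ i ∣)
fromℤ-² i = trans (sym (fromℤ-* i i)) (cong fromℤ (square i))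
  where
  square : ∀ i → i ℤ.* i ≡ ℤ.+ (ℤ.∣ i ∣ ℕ.* ℤ.∣ i ∣)
  square (ℤ.+ n)      = sym (ℤ.pos-* n n)
  square (ℤ.-[1+ n ]) = refl

incidence : ∀ {n} (𝓖 : SetSystem n) → Fin (card 𝓖) → Fin n → ℚ
incidence 𝓖 r = ind (List.lookup (SetSystem.sets 𝓖) r)

hereditary : ∀ {n} (𝓖 : SetSystem n) → Hereditary (incidence 𝓖) (ι (herdisc 𝓖))
hereditary {n} 𝓖 J = χ , zeros , signs , bound
  where
  coloured : Σ (Colouring n) λ x → ∀ {F} → F ∈ SetSystem.sets 𝓖 → ℤ.∣ signedSum (F ∩ Vec.tabulate J) x ∣ ℕ.≤
      herdisc 𝓖
  coloured = herdisc-colouring 𝓖 (Vec.tabulate J)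
  x : Colouring n
  x = proj₁ coloured
  J′ : Subset n
  J′ = Vec.tabulate J
  χ : Fin n → ℚ
  χ j = sgn (Vec.lookup x j) * ind J′ j
  ind-J′ : ∀ j → ind J′ j ≡ (if J j then 1ℚ else 0ℚ)
  ind-J′ j = cong (λ b → if b then 1ℚ else 0ℚ) (Vec.lookup∘tabulate J j)
  zeros : ∀ j → J j ≡ false → χ j ≡ 0ℚ
  zeros j eq = trans (cong (sgn (Vec.lookup x j) *_) (trans (ind-J′ j) (cong (λ b → if b then 1ℚ else 0ℚ) eq)))
      (*-zeroʳ (sgn (Vec.lookup x j)))
  signs : ∀ j → J j ≡ true → Hit (χ j)
  signs j eq = subst Hit (sym (trans (cong (sgn (Vec.lookup x j) *_)
      (trans (ind-J′ j) (cong (λ b → if b then 1ℚ else 0ℚ) eq))) (*-identityʳ (sgn (Vec.lookup x j)))))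
    (sgn-Hit (Vec.lookup x j))
  bound : ∀ r → (∑[ j ← allFin n ] (χ j * incidence 𝓖 r j)) ² ≤ ι (herdisc 𝓖) ²
  bound r = ≤-trans (≤-reflexive (trans (cong _² (sym value)) (fromℤ-² s)))
      (≤-trans (ι-mono-≤ {ℤ.∣ s ∣ ℕ.* ℤ.∣ s ∣} {herdisc 𝓖 ℕ.* herdisc 𝓖} (ℕ.*-mono-≤ s≤ s≤))
          (≤-reflexive (ι-* (herdisc 𝓖) (herdisc 𝓖))))
    where
    F : Subset n
    F = List.lookup (SetSystem.sets 𝓖) r
    s : ℤ
    s = signedSum (F ∩ J′) x
    s≤ : ℤ.∣ s ∣ ℕ.≤ herdisc 𝓖
    s≤ = proj₂ coloured (∈-lookup {xs = SetSystem.sets 𝓖} r)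
    value : fromℤ s ≡ ∑[ j ← allFin n ] (χ j * incidence 𝓖 r j)
    value = trans (signedSum-∑ (F ∩ J′) x) (∑-cong (allFin n) λ j →
        trans (cong (sgn (Vec.lookup x j) *_) (trans (ind-∩ F J′ j) (*-comm (ind F j) (ind J′ j))))
      (sym (*-assoc (sgn (Vec.lookup x j)) (ind J′ j) (ind F j))))

-- Restriction to the singleton of j leaves only ±a j in each signed sum.
herdisc≡0⇒incidence≡0 : ∀ {n} (𝓖 : SetSystem n) → herdisc 𝓖 ≡ 0 → ∀ r j → incidence 𝓖 r j ≡ 0ℚ
herdisc≡0⇒incidence≡0 {n} 𝓖 eq r j = go (hereditary 𝓖 J)
  where
  J : Fin n → Bool
  J i = does (j Fin.≟ i)
  J-j : J j ≡ true
  J-j with j Fin.≟ j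
  ... | yes _  = refl
  ... | no j≢j = contradiction refl j≢j
  J-≢ : ∀ {i} → j ≢ i → J i ≡ false
  J-≢ {i} j≢i with j Fin.≟ i
  ... | yes j≡i = contradiction j≡i j≢i
  ... | no _    = refl
  a : Fin n → ℚ
  a = incidence 𝓖 r
  go : (Σ (Fin n → ℚ) λ χ → (∀ j → J j ≡ false → χ j ≡ 0ℚ) × (∀ j → J j ≡ true → Hit (χ j)) ×
        (∀ r → (∑[ j ← allFin n ] (χ j * incidence 𝓖 r j)) ² ≤ ι (herdisc 𝓖) ²)) → a j ≡ 0ℚ
  go (χ , zeros , signs , bound) = cases (signs j J-j)
    where
    χa≡0 : χ j * a j ≡ 0ℚ
    χa≡0 = trans (sym (trans (∑-supported (j ∷ []) ([] ∷ []) (λ i → χ i * a i)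
        (λ i i∉ → trans (cong (_* a i) (zeros i (J-≢ λ { refl →
            i∉ (here refl) }))) (*-zeroˡ (a i)))) (+-identityʳ (χ j * a j))))
      (²≡0⇒≡0 (≤-trans (bound r) (≤-reflexive (cong (λ h → ι h ²) eq))))
    cases : Hit (χ j) → a j ≡ 0ℚ
    cases (inj₁ χ≡1)  = trans (sym (*-identityˡ (a j))) (trans (cong (_* a j) (sym χ≡1)) χa≡0)
    cases (inj₂ χ≡-1) = trans (solve 1 (λ a → a := con (- 1ℚ) :* (con (- 1ℚ) :* a)) refl (a j))
      (trans (cong (λ c → - 1ℚ * (c * a j)) (sym χ≡-1)) (trans (cong (- 1ℚ *_) χa≡0) refl))
      where open +-*-Solver

ind-injective : ∀ {n} (F G : Subset n) → (∀ j → ind F j ≡ ind G j) → F ≡ G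
ind-injective F G eq = trans (sym (Vec.tabulate∘lookup F))
    (trans (Vec.tabulate-cong λ j → bool (Vec.lookup F j) (Vec.lookup G j) (eq j)) (Vec.tabulate∘lookup G))
  where
  bool : ∀ a b → (if a then 1ℚ else 0ℚ) ≡ (if b then 1ℚ else 0ℚ) → a ≡ b
  bool true  true  _ = refl
  bool false false _ = refl

distinct-rows : ∀ {A : Set} (xs : List A) → Unique xs → 2 ℕ.≤ length xs →
    ∃[ r ] ∃[ s ] List.lookup xs r ≢ List.lookup xs s
distinct-rows (x ∷ y ∷ _) ((x≢y ∷ _) ∷ _) _ = Fin.zero , Fin.suc Fin.zero , x≢y
distinct-rows (_ ∷ []) _ (ℕ.s≤s ())

-- Two different sets cannot both be empty. This provides the hypothesis 1 ≤ h of `factorise`.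
0<herdisc : ∀ {n} (𝓖 : SetSystem n) → 2 ℕ.≤ card 𝓖 → 1 ℕ.≤ herdisc 𝓖
0<herdisc 𝓖 2≤ = ℕ.n≢0⇒n>0 λ eq → let r , s , r≢s = distinct-rows (SetSystem.sets 𝓖) (SetSystem.unique 𝓖) 2≤ in
  r≢s (ind-injective _ _ λ j → trans (herdisc≡0⇒incidence≡0 𝓖 eq r j) (sym (herdisc≡0⇒incidence≡0 𝓖 eq s j)))

-- From factorisations to colourings

*-^ : ∀ a b k → (a * b) ^ᵠ k ≡ a ^ᵠ k * b ^ᵠ k
*-^ a b zero    = refl
*-^ a b (suc k) = trans (cong (a * b *_) (*-^ a b k))
  (solve 4 (λ a b p q → a :* b :* (p :* q) := a :* p :* (b :* q)) refl a b (a ^ᵠ k) (b ^ᵠ k))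
  where open +-*-Solver

ι-^ : ∀ a k → ι (a ℕ.^ k) ≡ ι a ^ᵠ k
ι-^ a zero    = refl
ι-^ a (suc k) = trans (ι-* a (a ℕ.^ k)) (cong (ι a *_) (ι-^ a k))

-- Dividing the weights by K normalises rows and columns at once and turns f r u into (A u) r / K.
-- With k = l + 1 and m ≤ 2^k, the walk's bound (f²)^k ≤ m (32 k)^k yields f² ≤ 64 k.
factorisation⇒colouring : ∀ {m n} (A : Fin m → Fin n → ℚ) (ts : List (Term (Fin m) n)) →
  (∀ r j → entry ts r j ≡ A r j) → ∀ {K} → 0ℚ < K → (∀ r → row² ts r ≤ K) → (∀ j → col² ts j ≤ K) →
  ∀ l → m ℕ.≤ 2 ℕ.^ suc l →
  Σ (Fin n → ℚ) λ x → (∀ j → Hit (x j)) × (∀ r → (∑[ j ← allFin n ] (A r j * x j)) ² ≤ ι 64 * ι (suc l) * (K * K))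
factorisation⇒colouring {m} {n} A ts exact {K} 0<K rows cols l m≤ =
  let x , hits , small = subgaussian-colouring f-0 in x , hits , λ r → bound x r (small (∈-allFin r))
  where
  open +-*-Solver
  i : ℚ
  i = inv K
  iK : i * K ≡ 1ℚ
  iK = trans (*-comm i K) (*-inv (0<⇒≢0 0<K))
  𝔾 : Form (Term (Fin m) n)
  𝔾 = coordForm ts (λ t → w t * i) (λ t → 0≤* (0≤w t) (0≤inv (<⇒≤ 0<K)))
  open Form 𝔾
  dot : (Fin n → ℚ) → Term (Fin m) n → ℚ
  dot u t = ∑[ j ← allFin n ] (c t j * u j)
  dot-lin : ∀ s u s′ v t → dot (lc s u s′ v) t ≡ lc s (dot u) s′ (dot v) t
  dot-lin s u s′ v t = trans (∑-cong (allFin n) λ j →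
      solve 5 (λ c s u s′ v → c :* (s :* u :+ s′ :* v) := s :* (c :* u) :+ s′ :* (c :* v)) refl (c t j) s
          (u j) s′ (v j))
    (∑-lin (allFin n) s (λ j → c t j * u j) s′ (λ j → c t j * v j))
  ⟪⟫-congˡ : ∀ {y y′} z → (∀ t → y t ≡ y′ t) → ⟪ y , z ⟫ ≡ ⟪ y′ , z ⟫
  ⟪⟫-congˡ z eq = ∑-cong ts λ t → cong (λ a → w t * i * (a * z t)) (eq t)
  ⟪⟫-congʳ : ∀ y {z z′} → (∀ t → z t ≡ z′ t) → ⟪ y , z ⟫ ≡ ⟪ y , z′ ⟫
  ⟪⟫-congʳ y eq = ∑-cong ts λ t → cong (λ a → w t * i * (y t * a)) (eq t)
  𝔽 : Form (Fin n)
  𝔽 = record { ⟪_,_⟫ = λ u v → ⟪ dot u , dot v ⟫ ; ⟪⟫-sym = λ u v → ⟪⟫-sym (dot u) (dot v)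
             ; ⟪⟫-linˡ = λ s u s′ v z → trans (⟪⟫-congˡ (dot z) (dot-lin s u s′ v))
                 (⟪⟫-linˡ s (dot u) s′ (dot v) (dot z))
             ; 0≤⟪⟫ = λ u → 0≤⟪⟫ (dot u) }
  f : Fin m → (Fin n → ℚ) → ℚ
  f r u = ⟪ (λ t → b t r) , dot u ⟫
  f-lin : ∀ r s u s′ v → f r (lc s u s′ v) ≡ s * f r u + s′ * f r v
  f-lin r s u s′ v = trans (⟪⟫-congʳ (λ t → b t r) (dot-lin s u s′ v)) (⟪⟫-linʳ s (dot u) s′ (dot v) (λ t → b t r))
  scaled≤1 : ∀ {q} → q ≤ K → i * q ≤ 1ℚ
  scaled≤1 q≤K = ≤-trans (*-monoˡ (0≤inv (<⇒≤ 0<K)) q≤K) (≤-reflexive iK)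
  ∑-scaled : ∀ (q : Term (Fin m) n → ℚ) → ∑[ t ← ts ] (w t * i * q t) ≡ i * ∑[ t ← ts ] (w t * q t)
  ∑-scaled q = trans (∑-cong ts λ t → solve 3 (λ w i q → w :* i :* q := i :* (w :* q)) refl (w t) i (q t))
      (∑-*ˡ ts i (λ t → w t * q t))
  f-bound : ∀ r u → f r u ² ≤ ⟪ dot u , dot u ⟫
  f-bound r u = ≤-trans (cauchy-schwarz (λ t → b t r) (dot u)) (≤-trans
    (*-monoʳ (0≤⟪⟫ (dot u)) (≤-trans (≤-reflexive (∑-scaled (λ t → b t r * b t r))) (scaled≤1 (rows r))))
        (≤-reflexive (*-identityˡ ⟪ dot u , dot u ⟫)))
  dot-unit : ∀ j t → dot (unit j) t ≡ c t j
  dot-unit j t = trans (∑-cong (allFin n) λ j′ → *-comm (c t j′) (unit j j′)) (∑-unit j (c t))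
  unit≤1 : ∀ j → ⟪ dot (unit j) , dot (unit j) ⟫ ≤ 1ℚ
  unit≤1 j = ≤-trans (≤-reflexive (trans (∑-cong ts λ t →
      cong₂ (λ p q → w t * i * (p * q)) (dot-unit j t) (dot-unit j t)) (∑-scaled (λ t → c t j * c t j))))
          (scaled≤1 (cols j))
  expand : ∀ v u → ⟪ dot v , dot u ⟫ ≡ ∑[ j ← allFin n ] (u j * ⟪ dot v , dot (unit j) ⟫)
  expand v u = trans (∑-cong ts λ t → trans (sym (*-assoc (w t * i) (dot v t) (dot u t)))
      (sym (∑-*ˡ (allFin n) (w t * i * dot v t) (λ j → c t j * u j))))
    (trans (∑-swap ts (allFin n) (λ t j → w t * i * dot v t * (c t j * u j))) (∑-cong (allFin n) λ j → trans
      (∑-cong ts λ t → trans (solve 4 (λ W d c u → W :* d :* (c :* u) := u :* (W :* (d :* c))) refl (w t * i)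
          (dot v t) (c t j) (u j))
        (cong (λ q → u j * (w t * i * (dot v t * q))) (sym (dot-unit j t))))
      (∑-*ˡ ts (u j) (λ t → w t * i * (dot v t * dot (unit j) t)))))
  f-value : ∀ r u → f r u ≡ i * ∑[ j ← allFin n ] (A r j * u j)
  f-value r u = trans (∑-scaled (λ t → b t r * dot u t)) (cong (i *_) (trans
    (∑-cong ts λ t → trans (sym (*-assoc (w t) (b t r) (dot u t)))
        (sym (∑-*ˡ (allFin n) (w t * b t r) (λ j → c t j * u j))))
    (trans (∑-swap ts (allFin n) (λ t j → w t * b t r * (c t j * u j))) (∑-cong (allFin n) λ j → trans
      (∑-cong ts λ t → solve 4 (λ w b c u → w :* b :* (c :* u) := w :* (b :* c) :* u) refl (w t) (b t r) (c t j)
          (u j))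
      (trans (∑-*ʳ ts (u j) (λ t → w t * (b t r * c t j))) (cong (_* u j) (exact r j)))))))
  f-0 : ∀ r → f r (λ _ → 0ℚ) ≡ 0ℚ
  f-0 r = trans (f-value r (λ _ → 0ℚ)) (trans (cong (i *_) (∑-zero (allFin n) λ j → *-zeroʳ (A r j))) (*-zeroʳ i))
  open GramSchmidtWalk 𝔽 (allFin m) f expand unit≤1 f-lin f-bound l using (subgaussian-colouring)
  bound : ∀ x r → (f r x ²) ^ᵠ suc l ≤ ι (length (allFin m)) * (ι 32 * ι (suc l)) ^ᵠ suc l →
          (∑[ j ← allFin n ] (A r j * x j)) ² ≤ ι 64 * ι (suc l) * (K * K)
  bound x r le = ≤-trans (≤-reflexive eq) (*-monoʳ (0≤² K) f²≤)
    where
    D : ℚ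
    D = ∑[ j ← allFin n ] (A r j * x j)
    eq : D ² ≡ f r x ² * (K * K)
    eq = trans (solve 1 (λ D → D :* D := (con 1ℚ :* D) :* (con 1ℚ :* D)) refl D)
        (trans (cong (λ o → (o * D) * (o * D)) (sym iK))
      (trans (solve 3 (λ i K D → (i :* K :* D) :* (i :* K :* D) := (i :* D) :* (i :* D) :* (K :* K)) refl i K D)
        (cong (λ q → q * q * (K * K)) (sym (f-value r x)))))
    f²≤ : f r x ² ≤ ι 64 * ι (suc l)
    f²≤ = ^-cancel l (0≤* (0≤ι 64) (0≤ι (suc l))) (≤-trans le (≤-trans
      (*-monoʳ (0≤^ (suc l) (0≤* (0≤ι 32) (0≤ι (suc l))))
          (ι-mono-≤ {length (allFin m)} {2 ℕ.^ suc l} (subst (ℕ._≤ 2 ℕ.^ suc l)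
              (sym (length-tabulate {n = m} (λ i → i))) m≤)))
      (≤-reflexive (trans (cong (_* (ι 32 * ι (suc l)) ^ᵠ suc l) (ι-^ 2 (suc l)))
          (trans (sym (*-^ (ι 2) (ι 32 * ι (suc l)) (suc l)))
        (cong (_^ᵠ suc l) (sym (*-assoc (ι 2) (ι 32) (ι (suc l))))))))))

-- Integer logarithms and the blocks of the direct sum

logarithm : ∀ m → ∃[ L ] 2 ℕ.^ L ℕ.≤ suc m × suc m ℕ.< 2 ℕ.^ suc L
logarithm zero    = 0 , ℕ.≤-refl , ℕ.≤-refl
logarithm (suc m) with logarithm m
... | L , lo , hi with suc (suc m) ℕ.<? 2 ℕ.^ suc L
...   | yes lt = L , ℕ.m≤n⇒m≤1+n lo , lt
...   | no ≮   = suc L , ℕ.≮⇒≥ ≮ , ℕ.≤-<-trans hi (ℕ.^-monoʳ-< 2 (ℕ.s≤s (ℕ.s≤s ℕ.z≤n)) (ℕ.n<1+n (suc L)))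

-- ⌊log₂ m⌋ for m ≥ 1
lg : ℕ → ℕ
lg zero    = 0
lg (suc m) = proj₁ (logarithm m)

2^lg≤ : ∀ {m} → 1 ℕ.≤ m → 2 ℕ.^ lg m ℕ.≤ m
2^lg≤ {suc m} _ = proj₁ (proj₂ (logarithm m))

<2^lg : ∀ m → m ℕ.< 2 ℕ.^ suc (lg m)
<2^lg zero    = ℕ.s≤s ℕ.z≤n
<2^lg (suc m) = proj₂ (proj₂ (logarithm m))

1≤lg : ∀ {m} → 2 ℕ.≤ m → 1 ℕ.≤ lg m
1≤lg {m} 2≤m = ℕ.n≢0⇒n>0 λ eq → ℕ.<⇒≱ (<2^lg m) (subst (λ L → 2 ℕ.^ suc L ℕ.≤ m) (sym eq) 2≤m)

module Block {n : ℕ} (𝓖 : SetSystem n) where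
  size : ℕ
  size = 160 ℕ.* (lg (card 𝓖) ℕ.* herdisc 𝓖)

  -- A 0-1 switch: a system with fewer than two sets is allowed no terms, its `size` being 0, and is
  -- left to `common`.
  large : ℚ
  large = if does (2 ℕ.≤? card 𝓖) then 1ℚ else 0ℚ

  large-yes : 2 ℕ.≤ card 𝓖 → large ≡ 1ℚ
  large-yes 2≤ = cong (λ b → if b then 1ℚ else 0ℚ) (dec-true (2 ℕ.≤? card 𝓖) 2≤)

  large-no : ¬ 2 ℕ.≤ card 𝓖 → large ≡ 0ℚ
  large-no 2≰ = cong (λ b → if b then 1ℚ else 0ℚ) (dec-false (2 ℕ.≤? card 𝓖) 2≰)

  block : ∃[ ts ] (∀ r j → entry ts r j ≡ large * incidence 𝓖 r j) × (∀ r → row² ts r ≤ ι size) ×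
      (∀ j → col² ts j ≤ ι size)
  block = go (2 ℕ.≤? card 𝓖)
    where
    go : Dec (2 ℕ.≤ card 𝓖) → ∃[ ts ] (∀ r j → entry ts r j ≡ large * incidence 𝓖 r j) ×
        (∀ r → row² ts r ≤ ι size) × (∀ j → col² ts j ≤ ι size)
    go (no 2≰) = [] , (λ r j → sym (trans (cong (_* incidence 𝓖 r j) (large-no 2≰))
        (*-zeroˡ (incidence 𝓖 r j)))) , (λ r → 0≤ι size) , λ j → 0≤ι size
    go (yes 2≤) = let ts , exact , rows , cols = factored in
        ts , (λ r j → trans (exact r j) (sym (trans (cong (_* incidence 𝓖 r j) (large-yes 2≤))
            (*-identityˡ (incidence 𝓖 r j))))) ,
        (λ r → ≤-trans (rows r) fits) , λ j → ≤-trans (cols j) fits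
      where
      L H : ℕ
      L = lg (card 𝓖)
      H = herdisc 𝓖
      factored : ∃[ ts ] (∀ r j → entry ts r j ≡ incidence 𝓖 r j) ×
        (∀ r → row² ts r ≤ ι (3 ℕ.+ L) * (ι 40 * ι H)) × (∀ j → col² ts j ≤ ι (3 ℕ.+ L) * (ι 40 * ι H))
      factored = factorise (incidence 𝓖) (λ r → ind²≤1 (List.lookup (SetSystem.sets 𝓖) r)) (ι H)
          (ι-mono-≤ {1} {H} (0<herdisc 𝓖 2≤))
        (hereditary 𝓖) (Fin.fromℕ< (ℕ.≤-trans (ℕ.s≤s ℕ.z≤n) 2≤)) (suc L) (ℕ.<⇒≤ (<2^lg (card 𝓖)))
      -- 3 + L ≤ 4 L because L ≥ 1, and 4 · 40 = 160.
      fits : ι (3 ℕ.+ L) * (ι 40 * ι H) ≤ ι size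
      fits = ≤-trans (≤-reflexive (trans (cong (ι (3 ℕ.+ L) *_) (sym (ι-* 40 H))) (sym (ι-* (3 ℕ.+ L) (40 ℕ.* H)))))
        (ι-mono-≤ {(3 ℕ.+ L) ℕ.* (40 ℕ.* H)} {size} (ℕ.≤-trans
            (ℕ.*-monoˡ-≤ (40 ℕ.* H) (ℕ.+-monoˡ-≤ L (ℕ.*-monoʳ-≤ 3 (1≤lg 2≤))))
          (ℕ.≤-reflexive (solve 2 (λ L H → (con 3 :* L :+ L) :* (con 40 :* H) := con 160 :* (L :* H)) refl L H))))
        where open ℕ-Solver

∑-concatMap : ∀ {A B : Set} (h : A → List B) (xs : List A) (f : B → ℚ) → ∑ₗ (concatMap h xs) f ≡
    ∑[ x ← xs ] ∑ₗ (h x) f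
∑-concatMap h []       f = refl
∑-concatMap h (x ∷ xs) f = trans (∑-++ (h x) (concatMap h xs) f) (cong (∑ₗ (h x) f +_) (∑-concatMap h xs f))

∑ℕ : ∀ {t} → (Fin t → ℕ) → ℕ
∑ℕ = Fun.foldr ℕ._+_ 0

ι-∑ℕ : ∀ {t} (g : Fin t → ℕ) → ι (∑ℕ g) ≡ ∑[ i ← allFin t ] ι (g i)
ι-∑ℕ {zero}  g = refl
ι-∑ℕ {suc t} g = trans (ι-+ (g Fin.zero) (∑ℕ (λ i → g (Fin.suc i))))
    (trans (cong (ι (g Fin.zero) +_) (ι-∑ℕ (λ i → g (Fin.suc i)))) (sym (∑-allFin-suc (λ i → ι (g i)))))

≤∑ℕ : ∀ {t} (g : Fin t → ℕ) i → g i ℕ.≤ ∑ℕ g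
≤∑ℕ g Fin.zero    = ℕ.m≤m+n (g Fin.zero) _
≤∑ℕ g (Fin.suc i) = ℕ.≤-trans (≤∑ℕ (λ i → g (Fin.suc i)) i) (ℕ.m≤n+m _ (g Fin.zero))

∑ℕ-*ˡ : ∀ {t} k (g : Fin t → ℕ) → ∑ℕ (λ i → k ℕ.* g i) ≡ k ℕ.* ∑ℕ g
∑ℕ-*ˡ {zero}  k g = sym (ℕ.*-zeroʳ k)
∑ℕ-*ˡ {suc t} k g = trans (cong (k ℕ.* g Fin.zero ℕ.+_) (∑ℕ-*ˡ k (λ i → g (Fin.suc i))))
    (sym (ℕ.*-distribˡ-+ k (g Fin.zero) _))

-- Disjointness enters here: it makes the incidence matrix of 𝓕 a sum of matrices whose rows are
-- rows of the 𝓖 i.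
∑-ind-disjoint : ∀ {n t} (G : Fin t → Subset n) → (∀ i j → i ≢ j → Empty (G i ∩ G j)) →
                 ∀ x → ∑[ i ← allFin t ] ind (G i) x ≡ ind (⋃ (tabulate G)) x
∑-ind-disjoint {n} {zero}  G disjoint x = sym (cong (λ b → if b then 1ℚ else 0ℚ) (Vec.lookup-replicate x outside))
∑-ind-disjoint {n} {suc t} G disjoint x = trans (∑-allFin-suc (λ i → ind (G i) x))
    (trans (go (Vec.lookup (G Fin.zero) x) refl)
    (cong (λ b → if b then 1ℚ else 0ℚ) (sym (Vec.lookup-zipWith _∨_ x (G Fin.zero)
        (⋃ (tabulate (λ i → G (Fin.suc i))))))))
  where
  rest : ℚ
  rest = ∑[ i ← allFin t ] ind (G (Fin.suc i)) x
  go : ∀ b → Vec.lookup (G Fin.zero) x ≡ b →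
       (if Vec.lookup (G Fin.zero) x then 1ℚ else 0ℚ) + rest ≡
           (if Vec.lookup (G Fin.zero) x ∨ Vec.lookup (⋃ (tabulate (λ i → G (Fin.suc i)))) x then 1ℚ else 0ℚ)
  go true  eq rewrite eq = trans (cong (1ℚ +_) (∑-zero (allFin t) λ i →
      absent i (Vec.lookup (G (Fin.suc i)) x) refl)) (+-identityʳ 1ℚ)
    where
    absent : ∀ i b → Vec.lookup (G (Fin.suc i)) x ≡ b → (if Vec.lookup (G (Fin.suc i)) x then 1ℚ else 0ℚ) ≡ 0ℚ
    absent i true  eq′ = contradiction (x , Subset.x∈p∩q⁺
        (Vec.lookup⇒[]= x (G Fin.zero) eq , Vec.lookup⇒[]= x (G (Fin.suc i)) eq′))
            (disjoint Fin.zero (Fin.suc i) λ ())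
    absent i false eq′ = cong (λ b → if b then 1ℚ else 0ℚ) eq′
  go false eq rewrite eq = trans (+-identityˡ rest) (∑-ind-disjoint (λ i → G (Fin.suc i))
      (λ i j i≢j → disjoint (Fin.suc i) (Fin.suc j) (i≢j ∘ Fin.suc-injective)) x)

singleton-unique : ∀ {A : Set} {xs : List A} {x y} → ¬ 2 ℕ.≤ length xs → x ∈ xs → y ∈ xs → x ≡ y
singleton-unique {xs = _ ∷ []}    _  (here refl) (here refl) = refl
singleton-unique {xs = _ ∷ _ ∷ _} 2≰ _ _ = contradiction (ℕ.s≤s (ℕ.s≤s ℕ.z≤n)) 2≰

-- The combined factorisation

reindex : ∀ {R R′ n} → (R′ → R) → Term R n → Term R′ n
reindex ρ t = record { w = w t ; 0≤w = 0≤w t ; b = λ r → b t (ρ r) ; c = c t }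

-- Clearing the columns outside J preserves the row bounds and does not raise the column bounds, so
-- one factorisation serves every restriction.
mask : ∀ {R n} → Subset n → Term R n → Term R n
mask J t = record { w = w t ; 0≤w = 0≤w t ; b = b t ; c = λ j → c t j * ind J j }

signOf : ∀ {y} → Hit y → Sign
signOf (inj₁ _) = Sign.+
signOf (inj₂ _) = Sign.-

sgn-signOf : ∀ {y} (h : Hit y) → sgn (signOf h) ≡ y
sgn-signOf (inj₁ eq) = sym eq
sgn-signOf (inj₂ eq) = sym eq

private
  squares : ∀ a b c y S → a ℕ.* a ℕ.* (b ℕ.* b ℕ.* (y ℕ.* y)) ℕ.* (c ℕ.* S ℕ.* (c ℕ.* S)) ≡
                          a ℕ.* b ℕ.* c ℕ.* (y ℕ.* S) ℕ.* (a ℕ.* b ℕ.* c ℕ.* (y ℕ.* S))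
  squares = solve 5 (λ a b c y S → a :* a :* (b :* b :* (y :* y)) :* (c :* S :* (c :* S)) :=
                                   a :* b :* c :* (y :* S) :* (a :* b :* c :* (y :* S))) refl
    where open ℕ-Solver

  [y+y]² : ∀ y → (y ℕ.+ y) ℕ.* (y ℕ.+ y) ≡ 4 ℕ.* (y ℕ.* y)
  [y+y]² = solve 1 (λ y → (y :+ y) :* (y :+ y) := con 4 :* (y :* y)) refl
    where open ℕ-Solver

module Assembly {n t : ℕ} (𝓖 : Fin t → SetSystem n) (𝓕 : SetSystem n) (2≤card : 2 ℕ.≤ card 𝓕)
  (decompose : ∀ F → F ∈ SetSystem.sets 𝓕 → Σ (Fin t → Subset n) λ G → (∀ i → G i ∈ SetSystem.sets (𝓖 i)) ×
               (∀ i j → i ≢ j → Empty (G i ∩ G j)) × F ≡ ⋃ (tabulate G)) where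
  open +-*-Solver
  open SetSystem 𝓕

  m : ℕ
  m = card 𝓕

  r₀ : Fin m
  r₀ = Fin.fromℕ< (ℕ.≤-trans (ℕ.s≤s ℕ.z≤n) 2≤card)

  G : Fin m → Fin t → Subset n
  G r = proj₁ (decompose (List.lookup sets r) (∈-lookup {xs = sets} r))

  G∈ : ∀ r i → G r i ∈ SetSystem.sets (𝓖 i)
  G∈ r = proj₁ (proj₂ (decompose (List.lookup sets r) (∈-lookup {xs = sets} r)))

  index : ∀ i → Fin m → Fin (card (𝓖 i))
  index i r = Any.index (G∈ r i)

  incidence-index : ∀ i r j → incidence (𝓖 i) (index i r) j ≡ ind (G r i) j
  incidence-index i r j = cong (λ F → ind F j) (sym (lookup-index (G∈ r i)))

  ∑-G : ∀ r j → ∑[ i ← allFin t ] ind (G r i) j ≡ incidence 𝓕 r j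
  ∑-G r j = trans (∑-ind-disjoint (G r) (proj₁ (proj₂ (proj₂ whole))) j)
      (cong (λ F → ind F j) (sym (proj₂ (proj₂ (proj₂ whole)))))
    where
    whole : Σ (Fin t → Subset n) λ G → (∀ i → G i ∈ SetSystem.sets (𝓖 i)) ×
        (∀ i j → i ≢ j → Empty (G i ∩ G j)) × List.lookup sets r ≡ ⋃ (tabulate G)
    whole = decompose (List.lookup sets r) (∈-lookup {xs = sets} r)

  S : ℕ
  S = ∑ℕ (λ i → lg (card (𝓖 i)) ℕ.* herdisc (𝓖 i))

  -- If no 𝓖 i had two sets, all members of 𝓕 would decompose in the same way and coincide.
  1≤S : 1 ℕ.≤ S
  1≤S = go (Fin.any? (λ i → 2 ℕ.≤? card (𝓖 i)))
    where
    go : Dec (∃[ i ] 2 ℕ.≤ card (𝓖 i)) → 1 ℕ.≤ S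
    go (yes (i , 2≤)) = ℕ.≤-trans (ℕ.*-mono-≤ (1≤lg 2≤) (0<herdisc (𝓖 i) 2≤))
        (≤∑ℕ (λ i → lg (card (𝓖 i)) ℕ.* herdisc (𝓖 i)) i)
    go (no none) = let r , s , r≢s = distinct-rows sets unique 2≤card in contradiction
      (ind-injective (List.lookup sets r) (List.lookup sets s) λ j → trans (sym (∑-G r j)) (trans
        (∑-cong (allFin t) λ i → cong (λ F → ind F j) (singleton-unique (λ 2≤ → none (i , 2≤)) (G∈ r i)
            (G∈ s i))) (∑-G s j))) r≢s

  -- The summand 1 belongs to `common`, the rest to the blocks.
  K : ℕ
  K = 1 ℕ.+ 160 ℕ.* S

  large : Fin t → ℚ
  large i = Block.large (𝓖 i)

  0≤1-large : ∀ i → 0ℚ ≤ 1ℚ - large i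
  0≤1-large i with does (2 ℕ.≤? card (𝓖 i))
  ... | true  = ≤-refl
  ... | false = 0≤1

  large≥0 : ∀ i → 0ℚ ≤ large i
  large≥0 i with does (2 ℕ.≤? card (𝓖 i))
  ... | true  = 0≤1
  ... | false = ≤-refl

  -- The systems consisting of one set only are merged: together they
  -- contribute the same set to every member of 𝓕.
  common : Fin n → ℚ
  common j = ∑[ i ← allFin t ] ((1ℚ - large i) * ind (G r₀ i) j)

  common² : ∀ j → common j * common j ≤ 1ℚ
  common² j = ≤-trans (²-mono (0≤∑ (allFin t) λ i → 0≤* (0≤1-large i) (0≤ind (G r₀ i) j)) (≤-trans
      (∑-mono (allFin t) λ i → ≤-by (large i * ind (G r₀ i) j) (0≤* (large≥0 i) (0≤ind (G r₀ i) j))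
        (solve 2 (λ l g → g := (con 1ℚ :- l) :* g :+ l :* g) refl (large i) (ind (G r₀ i) j)))
      (≤-reflexive (∑-G r₀ j))))
    (ind²≤1 (List.lookup sets r₀) j)

  common-G : ∀ r i j → (1ℚ - large i) * ind (G r₀ i) j ≡ (1ℚ - large i) * ind (G r i) j
  common-G r i j = go (2 ℕ.≤? card (𝓖 i))
    where
    go : Dec (2 ℕ.≤ card (𝓖 i)) → (1ℚ - large i) * ind (G r₀ i) j ≡ (1ℚ - large i) * ind (G r i) j
    go (no 2≰)  = cong (λ F → (1ℚ - large i) * ind F j) (singleton-unique 2≰ (G∈ r₀ i) (G∈ r i))
    go (yes 2≤) = trans (vanish (ind (G r₀ i) j)) (sym (vanish (ind (G r i) j)))
      where
      vanish : ∀ g → (1ℚ - large i) * g ≡ 0ℚ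
      vanish g = trans (cong (λ l → (1ℚ - l) * g) (Block.large-yes (𝓖 i) 2≤)) (*-zeroˡ g)

  part : Fin t → List (Term (Fin m) n)
  part i = map (reindex (index i)) (proj₁ (Block.block (𝓖 i)))

  terms : List (Term (Fin m) n)
  terms = record { w = 1ℚ ; 0≤w = 0≤1 ; b = λ _ → 1ℚ ; c = common } ∷ concatMap part (allFin t)

  ∑-part : ∀ i (q : Term (Fin m) n → ℚ) (q′ : Term (Fin (card (𝓖 i))) n → ℚ) →
      (∀ t → q (reindex (index i) t) ≡ q′ t) →
           ∑ₗ (part i) q ≡ ∑ₗ (proj₁ (Block.block (𝓖 i))) q′
  ∑-part i q q′ eq = trans (∑-map (reindex (index i)) (proj₁ (Block.block (𝓖 i))) q)
      (∑-cong (proj₁ (Block.block (𝓖 i))) eq)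

  terms-entry : ∀ r j → entry terms r j ≡ incidence 𝓕 r j
  terms-entry r j = trans (cong₂ _+_ (trans (*-identityˡ (1ℚ * common j))
      (trans (*-identityˡ (common j)) (∑-cong (allFin t) λ i → common-G r i j)))
      (trans (∑-concatMap part (allFin t) (λ t → w t * (b t r * c t j))) (∑-cong (allFin t) λ i → trans
        (∑-part i (λ t → w t * (b t r * c t j)) (λ t → w t * (b t (index i r) * c t j)) (λ _ → refl))
        (trans (proj₁ (proj₂ (Block.block (𝓖 i))) (index i r) j) (cong (large i *_) (incidence-index i r j))))))
    (trans (sym (∑-+ (allFin t) (λ i → (1ℚ - large i) * ind (G r i) j) (λ i → large i * ind (G r i) j)))
      (trans (∑-cong (allFin t) λ i → solve 2 (λ l g → (con 1ℚ :- l) :* g :+ l :* g := g) refl (large i)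
          (ind (G r i) j)) (∑-G r j)))

  ∑size : ∑[ i ← allFin t ] ι (Block.size (𝓖 i)) ≡ ι (160 ℕ.* S)
  ∑size = trans (sym (ι-∑ℕ (λ i → Block.size (𝓖 i)))) (cong ι (∑ℕ-*ˡ 160 (λ i → lg (card (𝓖 i)) ℕ.* herdisc (𝓖 i))))

  ≤ιK : ∀ {p q} → p ≤ 1ℚ → q ≤ ∑[ i ← allFin t ] ι (Block.size (𝓖 i)) → p + q ≤ ι K
  ≤ιK p≤ q≤ = ≤-trans (+-mono-≤ p≤ q≤) (≤-reflexive (trans (cong (1ℚ +_) ∑size) (sym (ι-suc (160 ℕ.* S)))))

  terms-row : ∀ r → row² terms r ≤ ι K
  terms-row r = ≤ιK {1ℚ * (1ℚ * 1ℚ)} ≤-refl (≤-trans (≤-reflexive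
      (∑-concatMap part (allFin t) (λ t → w t * (b t r * b t r))))
    (∑-mono (allFin t) λ i → ≤-trans (≤-reflexive (∑-part i (λ t → w t * (b t r * b t r))
        (λ t → w t * (b t (index i r) * b t (index i r))) (λ _ → refl)))
      (proj₁ (proj₂ (proj₂ (Block.block (𝓖 i)))) (index i r))))

  terms-col : ∀ j → col² terms j ≤ ι K
  terms-col j = ≤ιK (≤-trans (≤-reflexive (*-identityˡ (common j * common j))) (common² j))
      (≤-trans (≤-reflexive (∑-concatMap part (allFin t) (λ t → w t * (c t j * c t j))))
    (∑-mono (allFin t) λ i → ≤-trans (≤-reflexive (∑-part i (λ t → w t * (c t j * c t j))
        (λ t → w t * (c t j * c t j)) (λ _ → refl)))
      (proj₂ (proj₂ (proj₂ (Block.block (𝓖 i)))) j)))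

  colouring : ∀ J → Σ (Colouring n) λ x → ∀ {F} → F ∈ sets →
    ℤ.∣ signedSum (F ∩ J) x ∣ ℕ.* ℤ.∣ signedSum (F ∩ J) x ∣ ℕ.≤ 64 ℕ.* suc (lg m) ℕ.* (K ℕ.* K)
  colouring J = χ , λ {F} F∈ → subst (λ F → ℤ.∣ signedSum (F ∩ J) χ ∣ ℕ.* ℤ.∣ signedSum (F ∩ J) χ ∣ ℕ.≤
      64 ℕ.* suc (lg m) ℕ.* (K ℕ.* K))
      (sym (lookup-index F∈)) (bound (Any.index F∈))
    where
    masked : List (Term (Fin m) n)
    masked = map (mask J) terms
    A : Fin m → Fin n → ℚ
    A r j = incidence 𝓕 r j * ind J j
    exact : ∀ r j → entry masked r j ≡ A r j
    exact r j = trans (∑-map (mask J) terms (λ t → w t * (b t r * c t j))) (trans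
      (∑-cong terms λ t → solve 4 (λ w b c g → w :* (b :* (c :* g)) := w :* (b :* c) :* g) refl (w t) (b t r)
          (c t j) (ind J j))
      (trans (∑-*ʳ terms (ind J j) (λ t → w t * (b t r * c t j))) (cong (_* ind J j) (terms-entry r j))))
    masked-row : ∀ r → row² masked r ≤ ι K
    masked-row r = ≤-trans (≤-reflexive (∑-map (mask J) terms (λ t → w t * (b t r * b t r)))) (terms-row r)
    masked-col : ∀ j → col² masked j ≤ ι K
    masked-col j = ≤-trans (≤-reflexive (∑-map (mask J) terms (λ t → w t * (c t j * c t j)))) (≤-trans
      (∑-mono terms λ t → *-monoˡ (0≤w t) (≤-trans (≤-reflexive
          (solve 2 (λ c g → (c :* g) :* (c :* g) := (c :* c) :* (g :* g)) refl (c t j) (ind J j)))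
        (≤-trans (*-monoˡ (0≤² (c t j)) (ind²≤1 J j)) (≤-reflexive (*-identityʳ (c t j * c t j))))))
      (terms-col j))
    result : Σ (Fin n → ℚ) λ x → (∀ j → Hit (x j)) × (∀ r → (∑[ j ← allFin n ] (A r j * x j)) ² ≤
        ι 64 * ι (suc (lg m)) * (ι K * ι K))
    result = factorisation⇒colouring A masked exact (0<ι (160 ℕ.* S)) masked-row masked-col (lg m) (ℕ.<⇒≤ (<2^lg m))
    x : Fin n → ℚ
    x = proj₁ result
    hits : ∀ j → Hit (x j)
    hits = proj₁ (proj₂ result)
    χ : Colouring n
    χ = Vec.tabulate (λ j → signOf (hits j))
    bound : ∀ r → ℤ.∣ signedSum (List.lookup sets r ∩ J) χ ∣ ℕ.* ℤ.∣ signedSum (List.lookup sets r ∩ J) χ ∣ ℕ.≤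
        64 ℕ.* suc (lg m) ℕ.* (K ℕ.* K)
    bound r = ι-cancel-≤ {ℤ.∣ s ∣ ℕ.* ℤ.∣ s ∣} {64 ℕ.* suc (lg m) ℕ.* (K ℕ.* K)}
        (≤-trans (≤-reflexive (trans (sym (fromℤ-² s)) (cong _² value)))
        (≤-trans (proj₂ (proj₂ result) r) (≤-reflexive (sym
            (trans (ι-* (64 ℕ.* suc (lg m)) (K ℕ.* K)) (cong₂ _*_ (ι-* 64 (suc (lg m))) (ι-* K K)))))))
      where
      s : ℤ
      s = signedSum (List.lookup sets r ∩ J) χ
      value : fromℤ s ≡ ∑[ j ← allFin n ] (A r j * x j)
      value = trans (signedSum-∑ (List.lookup sets r ∩ J) χ) (∑-cong (allFin n) λ j → trans (cong₂ _*_
          (trans (cong sgn (Vec.lookup∘tabulate (λ j → signOf (hits j)) j)) (sgn-signOf (hits j)))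
              (ind-∩ (List.lookup sets r) J j))
        (*-comm (x j) (A r j)))

  -- Here y stands for the root of lg m. It is at least 1, so lg m + 1 ≤ (y + 1)² ≤ 4 y²; with K ≤
  -- 161 S the root of 64 · 4 y² · (161 S)² is 2576 y S.
  herdisc-bound : ∀ {y} → lg m ℕ.< suc y ℕ.* suc y → herdisc 𝓕 ℕ.≤ 2576 ℕ.* (y ℕ.* S)
  herdisc-bound {y} lg< = herdisc-≤ 𝓕 λ J → let x , small = colouring J in x , λ F∈ → root (small F∈)
    where
    1≤y : 1 ℕ.≤ y
    1≤y = ℕ.n≢0⇒n>0 λ { refl → ℕ.<⇒≱ lg< (1≤lg 2≤card) }
    B : ℕ
    B = 2576 ℕ.* (y ℕ.* S)
    total : 64 ℕ.* suc (lg m) ℕ.* (K ℕ.* K) ℕ.≤ B ℕ.* B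
    total = begin
      64 ℕ.* suc (lg m) ℕ.* (K ℕ.* K)
        ≤⟨ ℕ.*-mono-≤ (ℕ.*-monoʳ-≤ 64 lg≤) (ℕ.*-mono-≤ K≤ K≤) ⟩
      64 ℕ.* (4 ℕ.* (y ℕ.* y)) ℕ.* (161 ℕ.* S ℕ.* (161 ℕ.* S))
        ≡⟨ squares 8 2 161 y S ⟩
      B ℕ.* B ∎
      where
      open ℕ.≤-Reasoning
      lg≤ : suc (lg m) ℕ.≤ 4 ℕ.* (y ℕ.* y)
      lg≤ = ℕ.≤-trans lg< (ℕ.≤-trans (ℕ.*-mono-≤ (ℕ.+-monoˡ-≤ y 1≤y) (ℕ.+-monoˡ-≤ y 1≤y))
          (ℕ.≤-reflexive ([y+y]² y)))
      K≤ : K ℕ.≤ 161 ℕ.* S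
      K≤ = ℕ.+-monoˡ-≤ (160 ℕ.* S) 1≤S
    root : ∀ {a} → a ℕ.* a ℕ.≤ 64 ℕ.* suc (lg m) ℕ.* (K ℕ.* K) → a ℕ.≤ B
    root {a} le = ℕ.≮⇒≥ λ B<a → ℕ.<⇒≱ (ℕ.*-mono-< B<a B<a) (ℕ.≤-trans le total)

squareRoot : ∀ L → ∃[ y ] y ℕ.* y ℕ.≤ L × L ℕ.< suc y ℕ.* suc y
squareRoot zero    = 0 , ℕ.≤-refl , ℕ.≤-refl
squareRoot (suc L) with squareRoot L
... | y , lo , hi with suc L ℕ.<? suc y ℕ.* suc y
...   | yes lt = y , ℕ.m≤n⇒m≤1+n lo , lt
...   | no ≮   = suc y , ℕ.≮⇒≥ ≮ , ℕ.≤-<-trans hi (ℕ.*-mono-< (ℕ.n<1+n (suc y)) (ℕ.n<1+n (suc y)))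

-- Bounding cuts from below

<ι⇒lower : ∀ {X a q} → fromℕ a ≤ᴿ X → q < ι a → ℝ≥0.lower X q
<ι⇒lower {a = a} {q} a≤X q<a = a≤X q (inj₂ (ι a , q<a , refl))

fromℕ-≤ᴿ : ∀ {a X} → (∀ q → 0ℚ ≤ q → q < ι a → ℝ≥0.lower X q) → fromℕ a ≤ᴿ X
fromℕ-≤ᴿ {X = X} below q (inj₁ q<0) = ℝ≥0.lower-negative X q<0
fromℕ-≤ᴿ {X = X} below q (inj₂ (_ , q<a , refl)) with 0ℚ ≤? q
... | yes 0≤q = below q 0≤q q<a
... | no  0≰q = ℝ≥0.lower-negative X (≰⇒> 0≰q)

fromℕ-mono : ∀ {a b} → a ℕ.≤ b → fromℕ a ≤ᴿ fromℕ b
fromℕ-mono {a} {b} a≤b q (inj₁ q<0)              = inj₁ q<0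
fromℕ-mono {a} {b} a≤b q (inj₂ (_ , q<a , refl)) = inj₂ (ι b , <-≤-trans q<a (ι-mono-≤ {a} {b} a≤b) , refl)

≤ᴿ-trans : ∀ {X Y Z} → X ≤ᴿ Y → Y ≤ᴿ Z → X ≤ᴿ Z
≤ᴿ-trans X≤Y Y≤Z q l = Y≤Z q (X≤Y q l)

between : ∀ {q c d} → 0ℚ ≤ q → 0ℚ ≤ d → q < c * d → ∃[ e ] 0ℚ ≤ e × e < c × q < e * d
between {q} {c} {d} 0≤q 0≤d q<cd = let e , lo , hi = <-dense qi<c in
    e , ≤-trans (0≤* 0≤q (<⇒≤ (0<inv 0<d))) (<⇒≤ lo) , hi ,
        subst (_< e * d) cancel (*-monoˡ-<-pos d {{positive 0<d}} lo)
  where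
  0<d : 0ℚ < d
  0<d = ≰⇒> λ d≤0 → <⇒≱ q<cd (≤-trans (≤-reflexive (trans (cong (c *_) (≤-antisym d≤0 0≤d)) (*-zeroʳ c))) 0≤q)
  cancel : q * inv d * d ≡ q
  cancel = *-inv-cancel λ d≡0 → ⊥-elim (0<⇒≢0 0<d d≡0)
  qi<c : q * inv d < c
  qi<c = *-cancelʳ-<-nonNeg d {{nonNegative 0≤d}} (subst (_< c * d) (sym cancel) q<cd)

-- Given q < a b, interpolating first in a and then in b gives e < a and f < b with q < e f, the
-- witnesses for the lower cut of the product.
fromℕ-* : ∀ {a b X Y} → fromℕ a ≤ᴿ X → fromℕ b ≤ᴿ Y → fromℕ (a ℕ.* b) ≤ᴿ X *ᴿ Y
fromℕ-* {a} {b} {X} {Y} a≤X b≤Y = fromℕ-≤ᴿ {a ℕ.* b} {X *ᴿ Y} λ q 0≤q q<ab →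
  let e , 0≤e , e<a , q<eb = between {q} {ι a} {ι b} 0≤q (0≤ι b) (subst (q <_) (ι-* a b) q<ab)
      f , 0≤f , f<b , q<fe = between {q} {ι b} {e} 0≤q 0≤e (subst (q <_) (*-comm e (ι b)) q<eb)
  in inj₂ (e * f , subst (q <_) (*-comm f e) q<fe , e , f , 0≤e , 0≤f ,
           <ι⇒lower {X} {a} a≤X e<a , <ι⇒lower {Y} {b} b≤Y f<b , refl)

fromℕ-+ : ∀ {a b X Y} → fromℕ a ≤ᴿ X → fromℕ b ≤ᴿ Y → fromℕ (a ℕ.+ b) ≤ᴿ X +ᴿ Y
fromℕ-+ {a} {b} {X} {Y} a≤X b≤Y = fromℕ-≤ᴿ {a ℕ.+ b} {X +ᴿ Y} λ q 0≤q q<a+b →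
    split q (<-dense (subst (q <_) (ι-+ a b) q<a+b))
  where
  open +-*-Solver
  split : ∀ q → ∃[ s ] q < s × s < ι a + ι b → ℝ≥0.lower (X +ᴿ Y) q
  split q (s , q<s , s<a+b) with halve (p<q⇒0<q-p s<a+b)
  ... | ε , 0<ε , 2ε = inj₂ ((ι a - ε) + (ι b - ε) , subst (q <_) s≡ q<s , ι a - ε , ι b - ε ,
        <ι⇒lower {X} {a} a≤X (below (ι a)) , <ι⇒lower {Y} {b} b≤Y (below (ι b)) , refl)
    where
    below : ∀ c → c - ε < c
    below c = subst (c - ε <_) (+-identityʳ c) (+-monoʳ-< c (neg-antimono-< 0<ε))
    s≡ : s ≡ (ι a - ε) + (ι b - ε)
    s≡ = trans (solve 3 (λ a b s → s := (a :+ b) :- (a :+ b :- s)) refl (ι a) (ι b) s)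
        (trans (cong (λ z → (ι a + ι b) - z) (sym 2ε))
      (solve 3 (λ a b e → (a :+ b) :- (e :+ e) := (a :- e) :+ (b :- e)) refl (ι a) (ι b) ε))

fromℕ-√ : ∀ {y X} → fromℕ (y ℕ.* y) ≤ᴿ X → fromℕ y ≤ᴿ √ X
fromℕ-√ {y} {X} y²≤X = fromℕ-≤ᴿ {y} {√ X} λ q 0≤q q<y → let r , q<r , r<y = <-dense q<y in
  let 0≤r = ≤-trans 0≤q (<⇒≤ q<r) in
  inj₂ (r , q<r , 0≤r , <ι⇒lower {X} {y ℕ.* y} y²≤X (subst (r * r <_) (sym (ι-* y y)) (*-mono-<-pos 0≤r r<y)))

fromℕ-log : ∀ {L m} → 2 ℕ.^ L ℕ.≤ m → fromℕ L ≤ᴿ log m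
fromℕ-log {L} {zero}  2^L≤0 = contradiction (ℕ.m^n>0 2 L) (ℕ.≤⇒≯ 2^L≤0)
fromℕ-log {L} {suc m} 2^L≤m = fromℕ-≤ᴿ {L} {log (suc m)} λ q 0≤q q<L →
  inj₂ (L′ , subst (q <_) (normalize-coprime coprime) q<L , nonNegative⁻¹ L′ ,
      ℕ.≤-trans 2^L≤m (ℕ.≤-reflexive (sym (ℕ.*-identityʳ (suc m)))))
  where
  coprime : Coprime L 1
  coprime = Coprime.sym (Coprime.1-coprimeTo L)
  L′ : ℚ
  L′ = mkℚ (ℤ.+ L) 0 coprime

fromℕ-∑ : ∀ {t} {g : Fin t → ℕ} {X : Fin t → ℝ≥0} → (∀ i → fromℕ (g i) ≤ᴿ X i) → fromℕ (∑ℕ g) ≤ᴿ ∑ X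
fromℕ-∑ {zero}  g≤X = λ q l → l
fromℕ-∑ {suc t} {g} {X} g≤X = fromℕ-+ {g Fin.zero} {∑ℕ (λ i → g (Fin.suc i))} {X Fin.zero} {∑ (λ i → X (Fin.suc i))}
  (g≤X Fin.zero) (fromℕ-∑ {g = λ i → g (Fin.suc i)} {λ i → X (Fin.suc i)} (λ i → g≤X (Fin.suc i)))

-- The hypothesis 2 ≤ card 𝓕 excludes the system of one non-empty set: its log is 0, but its
-- hereditary discrepancy is 1.
theorem5p2 : ∃[ C ] (fromℕ 0 <ᴿ C) ×
    (∀ (n t : ℕ) (𝓖 : Fin t → SetSystem n) (𝓕 : SetSystem n) →
    2 ℕ.≤ card 𝓕 →
    (∀ F → F ∈ˢ 𝓕 →
    ∃[ G ] (∀ i → G i ∈ˢ 𝓖 i) ×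
    (∀ i j → i ≢ j → Empty (G i ∩ G j)) ×
    F ≡ ⋃ (tabulate G)) →
    fromℕ (herdisc 𝓕) ≤ᴿ
    C *ᴿ √ (log (card 𝓕)) *ᴿ ∑ (λ i → log (card (𝓖 i)) *ᴿ fromℕ (herdisc (𝓖 i))))
theorem5p2 = fromℕ 2576 , (1ℚ , (0ℚ , positive⁻¹ 1ℚ , refl) ,
    inj₂ (ι 2576 , <-≤-trans (p<1+p 1ℚ) (ι-mono-≤ {2} {2576} (ℕ.s≤s (ℕ.s≤s ℕ.z≤n))) , refl)) , bound
  where
  p<1+p : ∀ p → p < 1ℚ + p
  p<1+p p = subst (_< 1ℚ + p) (+-identityˡ p) (+-monoˡ-< p (positive⁻¹ 1ℚ))
  bound : ∀ n t (𝓖 : Fin t → SetSystem n) (𝓕 : SetSystem n) → 2 ℕ.≤ card 𝓕 →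
    (∀ F → F ∈ˢ 𝓕 → ∃[ G ] (∀ i → G i ∈ˢ 𝓖 i) × (∀ i j → i ≢ j → Empty (G i ∩ G j)) × F ≡ ⋃ (tabulate G)) →
    fromℕ (herdisc 𝓕) ≤ᴿ fromℕ 2576 *ᴿ √ (log (card 𝓕)) *ᴿ ∑ (λ i → log (card (𝓖 i)) *ᴿ fromℕ (herdisc (𝓖 i)))
  bound n t 𝓖 𝓕 2≤ decompose = go (squareRoot (lg (card 𝓕)))
    where
    open Assembly 𝓖 𝓕 2≤ decompose using (S; G∈; r₀; herdisc-bound)
    total : ℝ≥0
    total = ∑ (λ i → log (card (𝓖 i)) *ᴿ fromℕ (herdisc (𝓖 i)))
    -- Needed because `lg` of 0 is 0 while 2^0 > 0. The decomposition of a member of 𝓕 supplies a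
    -- set of each 𝓖 i.
    1≤card : ∀ i → 1 ℕ.≤ card (𝓖 i)
    1≤card i = ℕ.≤-trans (ℕ.s≤s ℕ.z≤n) (Fin.toℕ<n (Any.index (G∈ r₀ i)))
    S≤ : fromℕ S ≤ᴿ total
    S≤ = fromℕ-∑ {g = λ i → lg (card (𝓖 i)) ℕ.* herdisc (𝓖 i)} λ i →
        fromℕ-* {lg (card (𝓖 i))} {herdisc (𝓖 i)} {log (card (𝓖 i))} {fromℕ (herdisc (𝓖 i))}
      (fromℕ-log {lg (card (𝓖 i))} {card (𝓖 i)} (2^lg≤ (1≤card i))) (λ q l → l)
    go : (∃[ y ] y ℕ.* y ℕ.≤ lg (card 𝓕) × lg (card 𝓕) ℕ.< suc y ℕ.* suc y) →
         fromℕ (herdisc 𝓕) ≤ᴿ fromℕ 2576 *ᴿ √ (log (card 𝓕)) *ᴿ total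
    go (y , y²≤ , <y²) = ≤ᴿ-trans {fromℕ (herdisc 𝓕)} {fromℕ (2576 ℕ.* y ℕ.* S)} {fromℕ 2576 *ᴿ √
        (log (card 𝓕)) *ᴿ total}
      (fromℕ-mono {herdisc 𝓕} {2576 ℕ.* y ℕ.* S} (ℕ.≤-trans (herdisc-bound {y} <y²)
          (ℕ.≤-reflexive (sym (ℕ.*-assoc 2576 y S)))))
      (fromℕ-* {2576 ℕ.* y} {S} {fromℕ 2576 *ᴿ √ (log (card 𝓕))} {total}
          (fromℕ-* {2576} {y} {fromℕ 2576} {√ (log (card 𝓕))} (λ q l → l)
        (fromℕ-√ {y} {log (card 𝓕)} (≤ᴿ-trans {fromℕ (y ℕ.* y)} {fromℕ (lg (card 𝓕))} {log (card 𝓕)}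
            (fromℕ-mono {y ℕ.* y} {lg (card 𝓕)} y²≤)
          (fromℕ-log {lg (card 𝓕)} {card 𝓕} (2^lg≤ (ℕ.≤-trans (ℕ.s≤s ℕ.z≤n) 2≤)))))) S≤)
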